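{- For every positive integer $k$, in the formal power series ring $\mathbb C[[\mathbf t]]$, \[ \sum_{n\ge0}\sum_{\underline\mu\vdash n}\frac{\mathrm{roots}_k^{B_n}(\underline\mu)}{|Z_{\underline\mu}|}\,\mathbf t^{\mathbf c(\underline\mu)}=\exp\Big(\sum_{j\ge1}\sum_{\theta\in\mathbb Z_2}\sum_{\substack{h\mid k\\ \gcd(h,j)=1}}\frac{t_{j,\theta}^{jk/h}}{2jk/h}\,\mathrm{roots}_h^{\mathbb Z_2}(\theta)\Big), \] where $h$ runs over positive divisors of $k$.
   Context: $B_n$ is the group of bijections $w$ of $\{\pm1,\dots,\pm n\}$ with $w(-i)=-w(i)$ ($B_0$ trivial). Cycles: if $c=(a_1,\dots,a_\ell)$ is a cycle of $w$ on $\{\pm1,\dots,\pm n\}$ so is $\bar c$ (negate entries); if $c\ne\bar c$, $c\bar c$ is a cycle of length $\ell$ and $\mathbb Z_2$-class $+1$; if $c=\bar c$, a cycle of length $\ell/2$ and class $-1$. Conjugacy classes of $B_n$ are indexed by bipartitions $\underline\mu=(\mu^+,\mu^-)\vdash n$, where $\mu^\theta$ lists the lengths of cycles of class $\theta$. $b_{j,\theta}$ denotes the number of parts of $\mu^\theta$ equal to $j$; $\mathbf t=(t_{j,\theta})_{j\ge1,\theta\in\{\pm1\}}$ are indeterminates and $\mathbf t^{\mathbf c(\underline\mu)}=\prod_{j,\theta}t_{j,\theta}^{jb_{j,\theta}}$. $\mathrm{roots}_k^{B_n}(\underline\mu)$ is the value of $\mathrm{roots}_k^{B_n}(g)=|\{h\in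 B_n:h^k=g\}|$ at any element of class $\underline\mu$, and $|Z_{\underline\mu}|$ is the order of the centralizer of such an element. $\mathbb Z_2=\{+1,-1\}$ and $\mathrm{roots}_h^{\mathbb Z_2}(\theta)=|\{\varepsilon\in\mathbb Z_2:\varepsilon^h=\theta\}|$. -}

module Defs where

open import Data.Bool using (Bool; true; false; _∧_; not; if_then_else_)
open import Data.Nat as ℕ using (ℕ; zero; suc; _≡ᵇ_; _<_; _!)
open import Data.Nat.Properties using (_<?_)
open import Data.Nat.Divisibility using (_∣?_)
open import Data.Nat.DivMod using (_/_)
open import Data.Nat.GCD using (gcd)
open import Data.Integer using (+_)
open import Data.Rational as ℚ using (ℚ; 0ℚ; 1ℚ)
open import Data.Product using (_×_; _,_; proj₁; proj₂)
open import Data.Fin as Fin using (Fin; toℕ; fromℕ<)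
open import Data.Vec as Vec using (Vec; []; _∷_; tabulate; lookup)
open import Data.Vec.Properties as VecP using ()
open import Data.Product.Properties as ProdP using ()
open import Data.List as List using (List; []; _∷_; _++_; map; concatMap; upTo; filterᵇ; length; allFin; cartesianProduct; foldr)
open import Data.Bool.ListAction using (any)
open import Data.Maybe using (Maybe; just; nothing)
open import Relation.Nullary.Decidable using (⌊_⌋; yes; no)
open import Relation.Binary using (DecidableEquality)
open import Relation.Binary.PropositionalEquality using (_≡_; refl)

-- a ÷ b as a rational number (with the convention a ÷ 0 = 0; it is only
-- ever applied to nonzero denominators below)
_÷_ : ℕ → ℕ → ℚ
a ÷ zero  = 0ℚ
a ÷ suc b = (+ a) ℚ./ suc b

sumℚ : List ℚ → ℚ
sumℚ = foldr ℚ._+_ 0ℚ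

count : {A : Set} → (A → Bool) → List A → ℕ
count p xs = length (filterᵇ p xs)

allVecs : {A : Set} → List A → (m : ℕ) → List (Vec A m)
allVecs xs zero    = [] ∷ []
allVecs xs (suc m) = concatMap (λ x → map (x ∷_) (allVecs xs m)) xs

data Sgn : Set where
  pos neg : Sgn

_·_ : Sgn → Sgn → Sgn
pos · s = s
neg · pos = neg
neg · neg = pos

_≟ˢ_ : DecidableEquality Sgn
pos ≟ˢ pos = yes refl
pos ≟ˢ neg = no (λ ())
neg ≟ˢ pos = no (λ ())
neg ≟ˢ neg = yes refl

_^ˢ_ : Sgn → ℕ → Sgn
ε ^ˢ zero  = pos
ε ^ˢ suc h = ε · (ε ^ˢ h)

rootsZ2 : ℕ → Sgn → ℕ
rootsZ2 h θ = count (λ ε → ⌊ (ε ^ˢ h) ≟ˢ θ ⌋) (pos ∷ neg ∷ [])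

-- The hyperoctahedral group B_n.
-- An element w (a bijection of {±1,…,±n} with w(-i) = -w(i)) is
-- determined by its values on the positive elements: w(i) = ε·a is
-- stored as entry i = (a , ε).  (Fin n is {1,…,n} shifted by one.)
-- w(-i) = -w(i) then determines w on negative elements, and w is a
-- bijection iff the unsigned parts form a permutation of Fin n.

SignedMap : ℕ → Set
SignedMap n = Vec (Fin n × Sgn) n

_≟ᴮ_ : ∀ {n} → DecidableEquality (SignedMap n)
_≟ᴮ_ = VecP.≡-dec (ProdP.≡-dec Fin._≟_ _≟ˢ_)

noDup : ∀ {n m} → Vec (Fin n) m → Bool
noDup []       = true
noDup (x ∷ xs) = not (any (λ y → ⌊ x Fin.≟ y ⌋) (Vec.toList xs)) ∧ noDup xs

Bn : (n : ℕ) → List (SignedMap n)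
Bn n = filterᵇ (λ w → noDup (Vec.map proj₁ w))
               (allVecs (cartesianProduct (allFin n) (pos ∷ neg ∷ [])) n)

_∘ᴮ_ : ∀ {n} → SignedMap n → SignedMap n → SignedMap n
w ∘ᴮ v = Vec.map (λ p → proj₁ (lookup w (proj₁ p)) , (proj₂ p · proj₂ (lookup w (proj₁ p)))) v

idᴮ : ∀ {n} → SignedMap n
idᴮ = tabulate (λ i → i , pos)

_^ᴮ_ : ∀ {n} → SignedMap n → ℕ → SignedMap n
w ^ᴮ zero  = idᴮ
w ^ᴮ suc k = w ∘ᴮ (w ^ᴮ k)

rootsB : (n k : ℕ) → SignedMap n → ℕ
rootsB n k g = count (λ h → ⌊ (h ^ᴮ k) ≟ᴮ g ⌋) (Bn n)

centralizer : (n : ℕ) → SignedMap n → ℕ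
centralizer n g = count (λ h → ⌊ (h ∘ᴮ g) ≟ᴮ (g ∘ᴮ h) ⌋) (Bn n)

-- Bipartitions, in multiplicity form.
-- A bipartition μ = (μ⁺, μ⁻) ⊢ n is recorded by b : Vec (ℕ × ℕ) n whose
-- entry at position j-1 is (b_{j,+1} , b_{j,-1}) for j = 1,…,n
-- (all parts of μ⁺, μ⁻ are ≤ n), subject to Σ_j j (b_{j,+1} + b_{j,-1}) = n.

weight : ∀ {m} → ℕ → Vec (ℕ × ℕ) m → ℕ
weight j []            = 0
weight j ((a , c) ∷ b) = j ℕ.* (a ℕ.+ c) ℕ.+ weight (suc j) b

bipartitions : (n : ℕ) → List (Vec (ℕ × ℕ) n)
bipartitions n = filterᵇ (λ b → weight 1 b ≡ᵇ n)
                         (allVecs (cartesianProduct (upTo (suc n)) (upTo (suc n))) n)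

-- A representative element of the conjugacy class of B_n indexed by μ:
-- cycles on consecutive blocks o, o+1, …, o+j-1 (0-based positions),
-- o ↦ o+1 ↦ … ↦ o+j-1 ↦ θ·o.  For θ = +1 this is a cycle c ≠ c̄ of
-- Z₂-class +1 and length j; for θ = -1 the cycle satisfies c = c̄ and has
-- length j and Z₂-class -1.
cyc : Sgn → ℕ → ℕ → List (ℕ × Sgn)
cyc θ o j = map (λ i → if suc i ℕ.<ᵇ j then (o ℕ.+ suc i , pos) else (o , θ)) (upTo j)

cycs : Sgn → ℕ → ℕ → ℕ → List (ℕ × Sgn)
cycs θ j zero    o = []
cycs θ j (suc a) o = cyc θ o j ++ cycs θ j a (o ℕ.+ j)

blocks : ∀ {m} → ℕ → Vec (ℕ × ℕ) m → ℕ → List (ℕ × Sgn)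
blocks j []            o = []
blocks j ((a , c) ∷ b) o =
  cycs pos j a o ++ cycs neg j c (o ℕ.+ a ℕ.* j) ++ blocks (suc j) b (o ℕ.+ (a ℕ.+ c) ℕ.* j)

nth : {A : Set} → List A → ℕ → Maybe A
nth []       _       = nothing
nth (x ∷ xs) zero    = just x
nth (x ∷ xs) (suc i) = nth xs i

toEntry : ∀ {n} → Fin n → Maybe (ℕ × Sgn) → Fin n × Sgn
toEntry i nothing = i , pos
toEntry {n} i (just (x , s)) with x <? n
... | yes p = fromℕ< p , s
... | no _  = i , pos

rep : ∀ {n} → Vec (ℕ × ℕ) n → SignedMap n
rep b = tabulate (λ i → toEntry i (nth (blocks 1 b 0) (toℕ i)))

-- Formal power series in the variables t_{j,θ}, j ≥ 1, θ ∈ Z₂.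
-- A monomial in the variables t_{j,θ} with j ≤ N is an exponent vector
-- e : Vec (ℕ × ℕ) N, entry j-1 = (exponent of t_{j,+1}, exponent of t_{j,-1}).
-- Ser N = series in the variables t_{j,θ}, j ≤ N (coefficient functions).

Mono : ℕ → Set
Mono N = Vec (ℕ × ℕ) N

Ser : ℕ → Set
Ser N = Mono N → ℚ

_≟ᴹ_ : ∀ {N} → DecidableEquality (Mono N)
_≟ᴹ_ = VecP.≡-dec (ProdP.≡-dec ℕ._≟_ ℕ._≟_)

deg : ∀ {N} → Mono N → ℕ
deg []            = 0
deg ((a , c) ∷ e) = a ℕ.+ c ℕ.+ deg e

below : ∀ {N} → Mono N → List (Mono N)
below []            = [] ∷ []
below ((a , c) ∷ e) =
  concatMap (λ x → concatMap (λ y → map ((x , y) ∷_) (below e)) (upTo (suc c))) (upTo (suc a))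

quot : ∀ {N} → Mono N → Mono N → Mono N
quot = Vec.zipWith (λ p q → (proj₁ p ℕ.∸ proj₁ q , proj₂ p ℕ.∸ proj₂ q))

ind : Bool → ℚ
ind true  = 1ℚ
ind false = 0ℚ

oneS : ∀ {N} → Ser N
oneS e = ind (deg e ≡ᵇ 0)

_⊛_ : ∀ {N} → Ser N → Ser N → Ser N
(F ⊛ G) e = sumℚ (map (λ d → F d ℚ.* G (quot e d)) (below e))

_^S_ : ∀ {N} → Ser N → ℕ → Ser N
F ^S zero  = oneS
F ^S suc m = F ⊛ (F ^S m)

-- exp F = Σ_{m ≥ 0} F^m / m!, for F with zero constant term (then only
-- m ≤ deg e contributes to the coefficient of the monomial e)
expS : ∀ {N} → Ser N → Ser N
expS F e = sumℚ (map (λ m → (F ^S m) e ℚ.* (1 ÷ (m !))) (upTo (suc (deg e))))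

-- the monomial t_{j,θ}^p   (j given 0-based as an element of Fin N)
single : ∀ {N} → Fin N → Sgn → ℕ → Mono N
single j θ p = tabulate (λ i → if ⌊ i Fin.≟ j ⌋ then expo θ else (0 , 0))
  where
  expo : Sgn → ℕ × ℕ
  expo pos = p , 0
  expo neg = 0 , p

monoS : ∀ {N} → Mono N → ℚ → Ser N
monoS m c e = ind ⌊ e ≟ᴹ m ⌋ ℚ.* c

monoEq : ∀ {a c} → Vec (ℕ × ℕ) a → Vec (ℕ × ℕ) c → Bool
monoEq []            []            = true
monoEq []            ((x , y) ∷ e) = (x ≡ᵇ 0) ∧ (y ≡ᵇ 0) ∧ monoEq {a = 0} [] e
monoEq ((x , y) ∷ e) []            = (x ≡ᵇ 0) ∧ (y ≡ᵇ 0) ∧ monoEq {c = 0} e []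
monoEq ((x , y) ∷ e) ((x′ , y′) ∷ e′) = (x ≡ᵇ x′) ∧ (y ≡ᵇ y′) ∧ monoEq e e′

-- the exponent vector of t^{c(μ)} = Π t_{j,θ}^{j b_{j,θ}}
cvec : ∀ {n} → ℕ → Vec (ℕ × ℕ) n → Vec (ℕ × ℕ) n
cvec j []            = []
cvec j ((a , c) ∷ b) = (j ℕ.* a , j ℕ.* c) ∷ cvec (suc j) b

-- LHS = Σ_{n≥0} Σ_{μ ⊢ n} roots_k^{B_n}(μ)/|Z_μ| t^{c(μ)}.
-- Its coefficient at e: only n = deg e can contribute, we sum over n ≤ deg e.
LHS : (k N : ℕ) → Ser N
LHS k N e =
  sumℚ (map (λ n →
    sumℚ (map (λ b → ind (monoEq (cvec 1 b) e)
                      ℚ.* (rootsB n k (rep b) ÷ centralizer n (rep b)))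
              (bipartitions n)))
    (upTo (suc (deg e))))

inner : (k N : ℕ) → Ser N
inner k N e =
  sumℚ (map (λ j →
    sumℚ (map (λ θ →
      sumℚ (map (λ i →
        let jj = suc (toℕ j)
            p  = (jj ℕ.* k) / suc i
        in ind (⌊ suc i ∣? k ⌋ ∧ (gcd (suc i) jj ≡ᵇ 1))
             ℚ.* monoS (single j θ p) (rootsZ2 (suc i) θ ÷ (2 ℕ.* p)) e)
        (upTo k)))
      (pos ∷ neg ∷ [])))
    (allFin N))

{-# OPTIONS --safe #-}
module Submission where

-- An element h commuting with g = rep μ is determined by its values on one base point of each
-- cycle of g up to sign. Revealing these values along the cycles of h, a path through m of the
-- g-cycles of type t = (j , θ) either moves on to one of the b unused g-cycles of the same type, in
-- 2j ways each, or closes up with a label a. It closes consistently with hᵏ = g iff m ∣ k and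
-- a^q = g on the cycle, where q = k/m: there are roots_q(θ) such labels if gcd(q , j) = 1, and
-- none otherwise. So the number of roots is a product over the types t of solutions R of a one-variable
-- recursion, and the order of the centralizer satisfies the same recursion with all labels admitted.
-- The quotients ρ(b) of the two satisfy 2jb ρ(b) = Σₘ κ(m) ρ(b - m), which is the logarithmic
-- derivative of the asserted exponential. Both sides L of the theorem thus solve D L = (D F) L, where
-- D is the Euler operator and F the exponent, and this equation determines L from its constant term.

open import Defs
open import Algebra.Structures using (IsCommutativeSemiring; IsCommutativeRing)
open import Data.Bool using (Bool; true; false; T; _∧_; not; if_then_else_)
open import Data.Bool.ListAction using (any)
open import Data.Bool.Properties using (T-∧)
open import Data.Empty using (⊥; ⊥-elim)
open import Data.Fin as Fin using (Fin; toℕ)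
import Data.Fin.Properties as FinP
open import Data.Integer as ℤ using () renaming (+_ to int)
import Data.Integer.Properties as ℤP
open import Data.List as List using (List; []; _∷_; _++_; map; concatMap; upTo; applyUpTo; filterᵇ; length; foldr; cartesianProduct; allFin)
open import Data.List.Membership.Propositional using (_∈_)
open import Data.List.Membership.Propositional.Properties
  using (∈-++⁺ˡ; ∈-++⁺ʳ; ∈-++⁻; ∈-map⁺; ∈-map⁻; ∈-filter⁺; ∈-filter⁻; ∈-∃++; ∈-cartesianProduct⁺; ∈-cartesianProduct⁻; ∈-allFin; ∈-upTo⁺; ∈-upTo⁻)
open import Data.List.Properties
  using (map-++; map-tabulate; map-applyUpTo; concatMap-map; concatMap-++; upTo-∷ʳ; length-++; length-map; length-applyUpTo; ++-assoc; ++-identityʳ)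
open import Data.List.Relation.Binary.Permutation.Propositional
  using (_↭_; prep; swap; ↭-refl; ↭-sym; ↭-trans; ↭-reflexive; ↭⇒↭ₛ)
open import Data.List.Relation.Binary.Permutation.Propositional.Properties
  using (++⁺; ++⁺ˡ; ++⁺ʳ; ++-comm; ∈-resp-↭; All-resp-↭; shift; shifts)
import Data.List.Relation.Binary.Permutation.Setoid.Properties as PermS
open import Data.List.Relation.Unary.All as All using (All; []; _∷_)
import Data.List.Relation.Unary.All.Properties as AllP
open import Data.List.Relation.Unary.AllPairs using (AllPairs; []; _∷_)
open import Data.List.Relation.Unary.Any using (here; there)
open import Data.List.Relation.Unary.Unique.Propositional using (Unique)
import Data.List.Relation.Unary.Unique.Propositional.Properties as UniqueP
open import Data.Maybe using (just)
open import Data.Nat as ℕ using (ℕ; zero; suc; _≤_; _<_; s≤s; z≤n; _∸_; _!; _≡ᵇ_; _<ᵇ_)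
open import Data.Nat.Coprimality using (coprime-Bézout; gcd≡1⇒coprime)
open import Data.Nat.Divisibility
  using (_∣_; _∣?_; divides; ∣m+n∣m⇒∣n; ∣m⇒∣m*n; ∣n⇒∣m*n; ∣m∣n⇒∣m+n; ∣1⇒≡1; ∣⇒≤; ∣-antisym; m%n≡0⇒n∣m)
open import Data.Nat.DivMod
  using (_%_; _/_; _mod_; m≡m%n+[m/n]*n; m%n<n; m%n%n≡m%n; %-distribˡ-*; [m+kn]%n≡m%n; m<n⇒m%n≡m; m/n*n≡m; m*n/n≡m; n/n≡1; *-/-assoc; m≥n⇒m/n>0)
open import Data.Nat.GCD using (gcd; gcd[m,n]∣m; gcd[m,n]∣n; module Bézout)
open import Data.Nat.ListAction using (product)
import Data.Nat.Properties as ℕP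
import Data.Nat.Solver as ℕSolver
open import Data.Product using (_×_; _,_; proj₁; proj₂; ∃)
open import Data.Product.Properties as ProdP using (,-injectiveˡ; ,-injectiveʳ)
open import Data.Rational as ℚ using (ℚ; 0ℚ; 1ℚ)
import Data.Rational.Properties as ℚP
import Data.Rational.Solver as ℚSolver
open import Data.Rational.Unnormalised as ℚᵘ using (mkℚᵘ; *≡*)
import Data.Rational.Unnormalised.Properties as ℚᵘP
open import Data.Sum using (inj₁; inj₂)
open import Data.Unit using (⊤; tt)
open import Data.Vec as Vec using (Vec; []; _∷_; tabulate; lookup)
open import Data.Vec.Properties as VecP using (lookup-map; lookup∘tabulate; tabulate∘lookup; tabulate-cong)
open import Function using (_∘_; id)
open import Function.Bundles using (Equivalence)
open import Relation.Binary using (DecidableEquality)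
open import Relation.Binary.PropositionalEquality
  using (_≡_; _≢_; refl; sym; trans; cong; cong₂; subst; setoid; module ≡-Reasoning)
open import Relation.Nullary using (Dec; yes; no; ¬_; _×-dec_)
open import Relation.Nullary.Decidable using (⌊_⌋; T?)
open import Relation.Unary using (Decidable)

-- On the 2j signed points of a g-cycle taken up to sign, g and -1 generate a group acting simply
-- transitively, whichever the class: it is cyclic of order 2j if θ = -1, and a cyclic group of
-- order j times ±1 if θ = +1. The labels s·gⁱ with i < j describe both cases uniformly, and this is
-- where the factor 2j comes from. The cycles of h on the g-cycles are not known in advance, so h is
-- revealed one value at a time, and each new value is made the base point of its g-cycle. A step
-- along a path then merely chooses a base point, and the condition hᵏ = g constrains only the label
-- at the closing. Division by the centralizer count Z, for which Z(b + 1) = 2j(b + 1) Z(b), cancels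
-- every factor of the recursion except κ. What remains is the factor 2jb, twice the degree jb of
-- the monomial; this is the 2 in the denominator 2jk/h, while D accounts for jk/h. The exponent F
-- has no constant term, so a coefficient of (D F) L involves only coefficients of L in lower
-- degrees.

private variable
  A B C : Set

-- Lists without repetitions, and rearrangements of lists.

Unique-++⁻ʳ : ∀ (xs : List A) {ys} → Unique (xs ++ ys) → Unique ys
Unique-++⁻ʳ []       u       = u
Unique-++⁻ʳ (x ∷ xs) (_ ∷ u) = Unique-++⁻ʳ xs u

Unique-++⁻ˡ : ∀ (xs : List A) {ys} → Unique (xs ++ ys) → Unique xs
Unique-++⁻ˡ []       u       = []
Unique-++⁻ˡ (x ∷ xs) (p ∷ u) =
  All.tabulate (λ z∈ → All.lookup p (∈-++⁺ˡ z∈)) ∷ Unique-++⁻ˡ xs u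

Unique-++⇒disjoint : ∀ (xs : List A) {ys z} → Unique (xs ++ ys) → z ∈ xs → z ∈ ys → ⊥
Unique-++⇒disjoint (x ∷ xs) (p ∷ u) (here refl) z∈ys = All.lookup p (∈-++⁺ʳ xs z∈ys) refl
Unique-++⇒disjoint (x ∷ xs) (p ∷ u) (there z∈)  z∈ys = Unique-++⇒disjoint xs u z∈ z∈ys

Unique-map⇒injective : ∀ (f : A → B) {xs x y} → Unique (map f xs) → x ∈ xs → y ∈ xs → f x ≡ f y → x ≡ y
Unique-map⇒injective f (p ∷ u) (here refl) (here refl) eq = refl
Unique-map⇒injective f (p ∷ u) (here refl) (there y∈)  eq = ⊥-elim (All.lookup p (∈-map⁺ f y∈) eq)
Unique-map⇒injective f (p ∷ u) (there x∈)  (here refl) eq = ⊥-elim (All.lookup p (∈-map⁺ f x∈) (sym eq))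
Unique-map⇒injective f (p ∷ u) (there x∈)  (there y∈)  eq = Unique-map⇒injective f u x∈ y∈ eq

∈-concatMap : ∀ (f : A → List B) {xs x y} → x ∈ xs → y ∈ f x → y ∈ concatMap f xs
∈-concatMap f (here refl)        y∈ = ∈-++⁺ˡ y∈
∈-concatMap f (there {z} x∈)     y∈ = ∈-++⁺ʳ (f z) (∈-concatMap f x∈ y∈)

∈-concatMap⁻′ : ∀ (f : A → List B) xs {y} → y ∈ concatMap f xs → ∃ λ x → x ∈ xs × y ∈ f x
∈-concatMap⁻′ f (x ∷ xs) y∈ with ∈-++⁻ (f x) y∈
... | inj₁ p = x , here refl , p
... | inj₂ p with ∈-concatMap⁻′ f xs p
...   | z , z∈ , q = z , there z∈ , q

Unique-concatMap⇒≡ : ∀ (f : A → List B) {xs x y z} → Unique (concatMap f xs) →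
  x ∈ xs → y ∈ xs → z ∈ f x → z ∈ f y → x ≡ y
Unique-concatMap⇒≡ f {x ∷ xs} u (here refl) (here refl) p q = refl
Unique-concatMap⇒≡ f {x ∷ xs} u (here refl) (there y∈) p q = ⊥-elim (Unique-++⇒disjoint (f x) u p (∈-concatMap f y∈ q))
Unique-concatMap⇒≡ f {x ∷ xs} u (there x∈) (here refl) p q = ⊥-elim (Unique-++⇒disjoint (f x) u q (∈-concatMap f x∈ p))
Unique-concatMap⇒≡ f {x ∷ xs} u (there x∈) (there y∈) p q = Unique-concatMap⇒≡ f (Unique-++⁻ʳ (f x) u) x∈ y∈ p q

Unique-concatMap⇒fibre : ∀ (f : A → List B) {xs x} → Unique (concatMap f xs) → x ∈ xs → Unique (f x)
Unique-concatMap⇒fibre f {x ∷ xs} u (here refl) = Unique-++⁻ˡ (f x) u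
Unique-concatMap⇒fibre f {x ∷ xs} u (there x∈)  = Unique-concatMap⇒fibre f (Unique-++⁻ʳ (f x) u) x∈

concatMap-↭ : ∀ (f : A → List B) {xs ys} → xs ↭ ys → concatMap f xs ↭ concatMap f ys
concatMap-↭ f _↭_.refl          = ↭-refl
concatMap-↭ f (_↭_.prep x p)    = ++⁺ˡ (f x) (concatMap-↭ f p)
concatMap-↭ f (_↭_.swap x y p)  = ↭-trans (shifts (f x) (f y)) (++⁺ˡ (f y) (++⁺ˡ (f x) (concatMap-↭ f p)))
concatMap-↭ f (_↭_.trans p q)   = ↭-trans (concatMap-↭ f p) (concatMap-↭ f q)

-- Finite sums over lists, for ℕ and ℚ at once.

module Sums {A : Set} {_+_ _*_ : A → A → A} {0# 1# : A}
            (isCSR : IsCommutativeSemiring _≡_ _+_ _*_ 0# 1#) where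
  open IsCommutativeSemiring isCSR
    using (+-assoc; +-comm; +-identityˡ; +-identityʳ; distribˡ; distribʳ; zeroˡ; zeroʳ)

  ∑ : List B → (B → A) → A
  ∑ xs f = foldr _+_ 0# (map f xs)

  ∑-cong∈ : ∀ (xs : List B) {f g : B → A} → (∀ x → x ∈ xs → f x ≡ g x) → ∑ xs f ≡ ∑ xs g
  ∑-cong∈ []       eq = refl
  ∑-cong∈ (x ∷ xs) eq = cong₂ _+_ (eq x (here refl)) (∑-cong∈ xs (λ y y∈ → eq y (there y∈)))

  ∑-cong : ∀ (xs : List B) {f g : B → A} → (∀ x → f x ≡ g x) → ∑ xs f ≡ ∑ xs g
  ∑-cong xs eq = ∑-cong∈ xs (λ x _ → eq x)

  ∑-zero : ∀ (xs : List B) {f : B → A} → (∀ x → x ∈ xs → f x ≡ 0#) → ∑ xs f ≡ 0#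
  ∑-zero []       eq = refl
  ∑-zero (x ∷ xs) eq = trans (cong₂ _+_ (eq x (here refl)) (∑-zero xs (λ y y∈ → eq y (there y∈)))) (+-identityˡ 0#)

  ∑-++ : ∀ (xs ys : List B) (f : B → A) → ∑ (xs ++ ys) f ≡ ∑ xs f + ∑ ys f
  ∑-++ []       ys f = sym (+-identityˡ _)
  ∑-++ (x ∷ xs) ys f = trans (cong (f x +_) (∑-++ xs ys f)) (sym (+-assoc _ _ _))

  ∑-map : ∀ (h : B → C) (xs : List B) (f : C → A) → ∑ (map h xs) f ≡ ∑ xs (f ∘ h)
  ∑-map h []       f = refl
  ∑-map h (x ∷ xs) f = cong (_ +_) (∑-map h xs f)

  ∑-concatMap : ∀ (h : B → List C) (xs : List B) (f : C → A) →
    ∑ (concatMap h xs) f ≡ ∑ xs (λ x → ∑ (h x) f)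
  ∑-concatMap h []       f = refl
  ∑-concatMap h (x ∷ xs) f = trans (∑-++ (h x) (concatMap h xs) f) (cong (_ +_) (∑-concatMap h xs f))

  ∑-product : ∀ (xs : List B) (ys : List C) (f : B × C → A) →
    ∑ (cartesianProduct xs ys) f ≡ ∑ xs (λ x → ∑ ys (λ y → f (x , y)))
  ∑-product []       ys f = refl
  ∑-product (x ∷ xs) ys f = trans (∑-++ (map (x ,_) ys) (cartesianProduct xs ys) f)
    (cong₂ _+_ (∑-map (x ,_) ys f) (∑-product xs ys f))

  +-interchange : ∀ a b c d → (a + b) + (c + d) ≡ (a + c) + (b + d)
  +-interchange a b c d = trans (+-assoc a b (c + d))
    (trans (cong (a +_) (trans (sym (+-assoc b c d)) (trans (cong (_+ d) (+-comm b c)) (+-assoc c b d))))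
           (sym (+-assoc a c (b + d))))

  ∑-+ : ∀ (xs : List B) (f g : B → A) → ∑ xs (λ x → f x + g x) ≡ ∑ xs f + ∑ xs g
  ∑-+ []       f g = sym (+-identityˡ 0#)
  ∑-+ (x ∷ xs) f g = trans (cong (_ +_) (∑-+ xs f g)) (+-interchange _ _ _ _)

  ∑-swap : ∀ (xs : List B) (ys : List C) (f : B → C → A) →
    ∑ xs (λ x → ∑ ys (f x)) ≡ ∑ ys (λ y → ∑ xs (λ x → f x y))
  ∑-swap []       ys f = sym (∑-zero ys (λ _ _ → refl))
  ∑-swap (x ∷ xs) ys f = trans (cong (_ +_) (∑-swap xs ys f)) (sym (∑-+ ys (f x) (λ y → ∑ xs (λ x → f x y))))

  ∑-*ˡ : ∀ c (xs : List B) (f : B → A) → c * ∑ xs f ≡ ∑ xs (λ x → c * f x)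
  ∑-*ˡ c []       f = zeroʳ c
  ∑-*ˡ c (x ∷ xs) f = trans (distribˡ c _ _) (cong (_ +_) (∑-*ˡ c xs f))

  ∑-*ʳ : ∀ c (xs : List B) (f : B → A) → ∑ xs f * c ≡ ∑ xs (λ x → f x * c)
  ∑-*ʳ c []       f = zeroˡ c
  ∑-*ʳ c (x ∷ xs) f = trans (distribʳ c _ _) (cong (_ +_) (∑-*ʳ c xs f))

  ∑-↭ : ∀ {xs ys : List B} (f : B → A) → xs ↭ ys → ∑ xs f ≡ ∑ ys f
  ∑-↭ f _↭_.refl         = refl
  ∑-↭ f (_↭_.prep x p)   = cong (f x +_) (∑-↭ f p)
  ∑-↭ f (_↭_.swap x y p) = trans (sym (+-assoc _ _ _)) (trans (cong₂ _+_ (+-comm _ _) (∑-↭ f p)) (+-assoc _ _ _))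
  ∑-↭ f (_↭_.trans p q)  = trans (∑-↭ f p) (∑-↭ f q)

  ∑-filterᵇ : ∀ (p : B → Bool) (xs : List B) (f : B → A) →
    ∑ (filterᵇ p xs) f ≡ ∑ xs (λ x → if p x then f x else 0#)
  ∑-filterᵇ p []       f = refl
  ∑-filterᵇ p (x ∷ xs) f with p x
  ... | true  = cong (f x +_) (∑-filterᵇ p xs f)
  ... | false = trans (∑-filterᵇ p xs f) (sym (+-identityˡ _))

  ∑-single : ∀ {xs : List B} {x₀} (f : B → A) → Unique xs → x₀ ∈ xs →
    (∀ x → x ∈ xs → x ≢ x₀ → f x ≡ 0#) → ∑ xs f ≡ f x₀
  ∑-single {xs = x ∷ xs} f (p ∷ u) (here refl) z =
    trans (cong (f x +_) (∑-zero xs (λ y y∈ → z y (there y∈) (λ { refl → All.lookup p y∈ refl }))))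
          (+-identityʳ _)
  ∑-single {xs = x ∷ xs} f (p ∷ u) (there x₀∈) z =
    trans (cong (_+ ∑ xs f) (z x (here refl) (λ { refl → All.lookup p x₀∈ refl })))
          (trans (+-identityˡ _) (∑-single f u x₀∈ (λ y y∈ → z y (there y∈))))

module ∑ℕ = Sums ℕP.+-*-isCommutativeSemiring
module ∑ℚ = Sums (IsCommutativeRing.isCommutativeSemiring ℚP.+-*-isCommutativeRing)

∑ℕ-const : ∀ (xs : List B) c → ∑ℕ.∑ xs (λ _ → c) ≡ length xs ℕ.* c
∑ℕ-const []       c = refl
∑ℕ-const (x ∷ xs) c = cong (c ℕ.+_) (∑ℕ-const xs c)

-- Counting by sums of indicators.

𝟙 : {P : Set} → Dec P → ℕ
𝟙 d = if ⌊ d ⌋ then 1 else 0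

𝟙-yes : {P : Set} (d : Dec P) → P → 𝟙 d ≡ 1
𝟙-yes (yes _) p = refl
𝟙-yes (no ¬p) p = ⊥-elim (¬p p)

𝟙-no : {P : Set} (d : Dec P) → ¬ P → 𝟙 d ≡ 0
𝟙-no (yes p) ¬p = ⊥-elim (¬p p)
𝟙-no (no _)  ¬p = refl

𝟙-cong : {P Q : Set} (d : Dec P) (e : Dec Q) → (P → Q) → (Q → P) → 𝟙 d ≡ 𝟙 e
𝟙-cong (yes p) e f g = sym (𝟙-yes e (f p))
𝟙-cong (no ¬p) e f g = sym (𝟙-no e (λ q → ¬p (g q)))

# : {P : A → Set} → Decidable P → List A → ℕ
# P? xs = count (λ x → ⌊ P? x ⌋) xs

#≡∑ : {P : A → Set} (P? : Decidable P) (xs : List A) → # P? xs ≡ ∑ℕ.∑ xs (λ x → 𝟙 (P? x))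
#≡∑ P? []       = refl
#≡∑ P? (x ∷ xs) with P? x
... | yes _ = cong suc (#≡∑ P? xs)
... | no  _ = #≡∑ P? xs

#-cong : {P Q : A → Set} (P? : Decidable P) (Q? : Decidable Q) (xs : List A) →
  (∀ x → x ∈ xs → P x → Q x) → (∀ x → x ∈ xs → Q x → P x) → # P? xs ≡ # Q? xs
#-cong P? Q? xs f g = trans (#≡∑ P? xs)
  (trans (∑ℕ.∑-cong∈ xs (λ x x∈ → 𝟙-cong (P? x) (Q? x) (f x x∈) (g x x∈))) (sym (#≡∑ Q? xs)))

#-none : {P : A → Set} (P? : Decidable P) (xs : List A) → (∀ x → x ∈ xs → ¬ P x) → # P? xs ≡ 0
#-none P? xs ¬P = trans (#≡∑ P? xs) (∑ℕ.∑-zero xs (λ x x∈ → 𝟙-no (P? x) (¬P x x∈)))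

#-one : {P : A → Set} (P? : Decidable P) {xs : List A} {x₀ : A} → Unique xs → x₀ ∈ xs → P x₀ →
  (∀ x → x ∈ xs → P x → x ≡ x₀) → # P? xs ≡ 1
#-one P? {xs} {x₀} u x₀∈ p uniq = trans (#≡∑ P? xs)
  (trans (∑ℕ.∑-single (λ x → 𝟙 (P? x)) u x₀∈ (λ x x∈ x≢ → 𝟙-no (P? x) (λ q → x≢ (uniq x x∈ q))))
         (𝟙-yes (P? x₀) p))

#-partition : {P : A → Set} (P? : Decidable P) (_≟_ : DecidableEquality B) (f : A → B)
  (xs : List A) {ys : List B} → Unique ys → (∀ x → x ∈ xs → f x ∈ ys) →
  # P? xs ≡ ∑ℕ.∑ ys (λ y → # (λ x → (f x ≟ y) ×-dec P? x) xs)
#-partition P? _≟_ f xs {ys} u cov = begin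
  # P? xs
    ≡⟨ #≡∑ P? xs ⟩
  ∑ℕ.∑ xs (λ x → 𝟙 (P? x))
    ≡⟨ ∑ℕ.∑-cong∈ xs (λ x x∈ → sym (trans
         (∑ℕ.∑-single (λ y → 𝟙 ((f x ≟ y) ×-dec P? x)) u (cov x x∈)
           (λ y _ y≢ → 𝟙-no ((f x ≟ y) ×-dec P? x) (λ q → y≢ (sym (proj₁ q)))))
         (𝟙-cong ((f x ≟ f x) ×-dec P? x) (P? x) proj₂ (refl ,_)))) ⟩
  ∑ℕ.∑ xs (λ x → ∑ℕ.∑ ys (λ y → 𝟙 ((f x ≟ y) ×-dec P? x)))
    ≡⟨ ∑ℕ.∑-swap xs ys _ ⟩
  ∑ℕ.∑ ys (λ y → ∑ℕ.∑ xs (λ x → 𝟙 ((f x ≟ y) ×-dec P? x)))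
    ≡⟨ ∑ℕ.∑-cong ys (λ y → sym (#≡∑ (λ x → (f x ≟ y) ×-dec P? x) xs)) ⟩
  ∑ℕ.∑ ys (λ y → # (λ x → (f x ≟ y) ×-dec P? x) xs) ∎
  where open ≡-Reasoning

-- The signed maps acting on signed points.

module RootCounting where
  open import Data.Nat using (_+_; _*_)

  private variable
    n : ℕ

  ·-assoc : ∀ s t r → (s · t) · r ≡ s · (t · r)
  ·-assoc pos t   r   = refl
  ·-assoc neg pos r   = refl
  ·-assoc neg neg pos = refl
  ·-assoc neg neg neg = refl

  ·-comm : ∀ s t → s · t ≡ t · s
  ·-comm pos pos = refl
  ·-comm pos neg = refl
  ·-comm neg pos = refl
  ·-comm neg neg = refl

  ·-self : ∀ s → s · s ≡ pos
  ·-self pos = refl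
  ·-self neg = refl

  ·-identityʳ : ∀ s → s · pos ≡ s
  ·-identityʳ s = ·-comm s pos

  signs : List Sgn
  signs = pos ∷ neg ∷ []

  ∈-signs : ∀ s → s ∈ signs
  ∈-signs pos = here refl
  ∈-signs neg = there (here refl)

  Unique-signs : Unique signs
  Unique-signs = ((λ ()) ∷ []) ∷ ([] ∷ [])

  Pt : ℕ → Set
  Pt n = Fin n × Sgn

  _≟ᴾ_ : DecidableEquality (Pt n)
  _≟ᴾ_ = ProdP.≡-dec Fin._≟_ _≟ˢ_

  allPts : (n : ℕ) → List (Pt n)
  allPts n = cartesianProduct (allFin n) signs

  ∈-allPts : (x : Pt n) → x ∈ allPts n
  ∈-allPts (i , s) = ∈-cartesianProduct⁺ (∈-allFin i) (∈-signs s)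

  Unique-allPts : Unique (allPts n)
  Unique-allPts {n} = UniqueP.cartesianProduct⁺ (UniqueP.allFin⁺ n) Unique-signs

  infixr 8 _⊙_
  _⊙_ : Sgn → Pt n → Pt n
  s ⊙ (i , t) = i , s · t

  ⊙-⊙ : ∀ s t (x : Pt n) → s ⊙ (t ⊙ x) ≡ (s · t) ⊙ x
  ⊙-⊙ s t (i , r) = cong (i ,_) (sym (·-assoc s t r))

  -- The encoded map of {±1,...,±n} itself, with its values on negative points; composition and
  -- powers of vectors are translated into this action.
  app : SignedMap n → Pt n → Pt n
  app w (i , s) = s ⊙ lookup w i

  app-⊙ : ∀ (w : SignedMap n) s x → app w (s ⊙ x) ≡ s ⊙ app w x
  app-⊙ w s (i , t) = sym (⊙-⊙ s t (lookup w i))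

  app-∘ : ∀ (w v : SignedMap n) x → app (w ∘ᴮ v) x ≡ app w (app v x)
  app-∘ w v (i , s) = trans (cong (s ⊙_) (lookup-map i _ v)) (sym (app-⊙ w s (lookup v i)))

  app-id : ∀ (x : Pt n) → app idᴮ x ≡ x
  app-id (i , s) = trans (cong (s ⊙_) (lookup∘tabulate (λ i → i , pos) i)) (cong (i ,_) (·-identityʳ s))

  app-ext : ∀ (w v : SignedMap n) → (∀ x → app w x ≡ app v x) → w ≡ v
  app-ext w v eq = trans (sym (tabulate∘lookup w))
    (trans (tabulate-cong (λ i → eq (i , pos))) (tabulate∘lookup v))

  iter : (A → A) → ℕ → A → A
  iter f zero    x = x
  iter f (suc k) x = f (iter f k x)

  iter-+ : ∀ (f : A → A) k l x → iter f (k + l) x ≡ iter f k (iter f l x)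
  iter-+ f zero    l x = refl
  iter-+ f (suc k) l x = cong f (iter-+ f k l x)

  iter-comm : ∀ (f g : A → A) → (∀ x → f (g x) ≡ g (f x)) → ∀ k x → iter f k (g x) ≡ g (iter f k x)
  iter-comm f g c zero    x = refl
  iter-comm f g c (suc k) x = trans (cong f (iter-comm f g c k x)) (c (iter f k x))

  app-^ : ∀ (w : SignedMap n) k x → app (w ^ᴮ k) x ≡ iter (app w) k x
  app-^ w zero    x = app-id x
  app-^ w (suc k) x = trans (app-∘ w (w ^ᴮ k) x) (cong (app w) (app-^ w k x))

  -- Membership in B_n as injectivity on signed points.

  ∈-allVecs : ∀ {xs : List A} → (∀ x → x ∈ xs) → ∀ {m} (v : Vec A m) → v ∈ allVecs xs m
  ∈-allVecs all []      = here refl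
  ∈-allVecs {xs = xs} all {suc m} (x ∷ v) =
    ∈-concatMap (λ y → map (y ∷_) (allVecs xs m)) (all x) (∈-map⁺ (x ∷_) (∈-allVecs all v))

  Unique-concatMap : ∀ (f : A → List B) {xs} → Unique xs → (∀ x → x ∈ xs → Unique (f x)) →
    (∀ x y z → z ∈ f x → z ∈ f y → x ≡ y) → Unique (concatMap f xs)
  Unique-concatMap f []        uf disj = []
  Unique-concatMap f {x ∷ xs} (p ∷ u) uf disj = UniqueP.++⁺ (uf x (here refl))
    (Unique-concatMap f u (λ y y∈ → uf y (there y∈)) disj)
    (λ { {z} (z∈ , z∈′) → let (y , y∈ , q) = ∈-concatMap⁻′ f xs z∈′
                          in All.lookup p y∈ (disj x y z z∈ q) })

  Unique-allVecs : ∀ {xs : List A} → Unique xs → ∀ m → Unique (allVecs xs m)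
  Unique-allVecs u zero    = [] ∷ []
  Unique-allVecs {xs = xs} u (suc m) = Unique-concatMap (λ x → map (x ∷_) (allVecs xs m)) u
    (λ x _ → UniqueP.map⁺ VecP.∷-injectiveʳ (Unique-allVecs u m))
    (λ x y z z∈ z∈′ → let (_ , _ , p) = ∈-map⁻ (x ∷_) z∈
                          (_ , _ , q) = ∈-map⁻ (y ∷_) z∈′
                      in VecP.∷-injectiveˡ (trans (sym p) q))

  Unique-Bn : ∀ n → Unique (Bn n)
  Unique-Bn n = UniqueP.filter⁺ (T? ∘ λ w → noDup (Vec.map proj₁ w)) (Unique-allVecs Unique-allPts n)

  private
    any-lookup : ∀ {m} (x : Fin n) (v : Vec (Fin n) m) i → lookup v i ≡ x →
      any (λ y → ⌊ x Fin.≟ y ⌋) (Vec.toList v) ≡ true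
    any-lookup x (y ∷ v) i eq with x Fin.≟ y
    ... | yes _ = refl
    any-lookup x (y ∷ v) Fin.zero    eq | no ≢ = ⊥-elim (≢ (sym eq))
    any-lookup x (y ∷ v) (Fin.suc i) eq | no _ = any-lookup x v i eq

    ¬any : ∀ {m} (x : Fin n) (v : Vec (Fin n) m) → (∀ i → lookup v i ≢ x) →
      any (λ y → ⌊ x Fin.≟ y ⌋) (Vec.toList v) ≡ false
    ¬any x []      ne = refl
    ¬any x (y ∷ v) ne with x Fin.≟ y
    ... | yes eq = ⊥-elim (ne Fin.zero (sym eq))
    ... | no _   = ¬any x v (ne ∘ Fin.suc)

    T-not : ∀ {b} → b ≡ true → T (not b) → ⊥
    T-not refl ()

    T-∧⁻ : ∀ a {b} → T (a ∧ b) → T a × T b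
    T-∧⁻ true t = tt , t

  noDup⇒injective : ∀ {m} (v : Vec (Fin n) m) → T (noDup v) → ∀ i j → lookup v i ≡ lookup v j → i ≡ j
  noDup⇒injective (x ∷ v) t Fin.zero    Fin.zero    eq = refl
  noDup⇒injective (x ∷ v) t Fin.zero    (Fin.suc j) eq = ⊥-elim (T-not (any-lookup x v j (sym eq)) (proj₁ (T-∧⁻ (not _) t)))
  noDup⇒injective (x ∷ v) t (Fin.suc i) Fin.zero    eq = ⊥-elim (T-not (any-lookup x v i eq) (proj₁ (T-∧⁻ (not _) t)))
  noDup⇒injective (x ∷ v) t (Fin.suc i) (Fin.suc j) eq = cong Fin.suc (noDup⇒injective v (proj₂ (T-∧⁻ (not _) t)) i j eq)

  injective⇒noDup : ∀ {m} (v : Vec (Fin n) m) → (∀ i j → lookup v i ≡ lookup v j → i ≡ j) → T (noDup v)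
  injective⇒noDup []      inj = tt
  injective⇒noDup (x ∷ v) inj
    rewrite ¬any x v (λ i eq → FinP.0≢1+n (inj Fin.zero (Fin.suc i) (sym eq)))
    = injective⇒noDup v (λ i j eq → FinP.suc-injective (inj (Fin.suc i) (Fin.suc j) eq))

  Inj : SignedMap n → Set
  Inj w = ∀ x y → app w x ≡ app w y → x ≡ y

  ·-cancelʳ : ∀ s t r → s · r ≡ t · r → s ≡ t
  ·-cancelʳ s t r eq = trans (trans (sym (·-identityʳ s)) (trans (cong (s ·_) (sym (·-self r))) (sym (·-assoc s r r))))
    (trans (cong (_· r) eq) (trans (·-assoc t r r) (trans (cong (t ·_) (·-self r)) (·-identityʳ t))))

  Bn⇒Inj : (w : SignedMap n) → w ∈ Bn n → Inj w
  Bn⇒Inj {n} w w∈ (i , s) (j , t) eq with noDup⇒injective (Vec.map proj₁ w)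
      (proj₂ (∈-filter⁻ (T? ∘ λ w → noDup (Vec.map proj₁ w)) {xs = allVecs (allPts n) n} w∈)) i j
      (trans (lookup-map i proj₁ w) (trans (,-injectiveˡ eq) (sym (lookup-map j proj₁ w))))
  ... | refl = cong (i ,_) (·-cancelʳ s t (proj₂ (lookup w i)) (,-injectiveʳ eq))

  Inj⇒Bn : (w : SignedMap n) → Inj w → w ∈ Bn n
  Inj⇒Bn w inj = ∈-filter⁺ (T? ∘ λ w → noDup (Vec.map proj₁ w)) (∈-allVecs ∈-allPts w)
    (injective⇒noDup (Vec.map proj₁ w) unsigned)
    where
    unsigned : ∀ i j → lookup (Vec.map proj₁ w) i ≡ lookup (Vec.map proj₁ w) j → i ≡ j
    -- Each of the two points is given the sign of its own image, so that both go to the positive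
    -- copy of the common unsigned image.
    unsigned i j eq = cong proj₁ (inj (i , proj₂ (lookup w i)) (j , proj₂ (lookup w j))
      (cong₂ _,_ (trans (sym (lookup-map i proj₁ w)) (trans eq (lookup-map j proj₁ w)))
                 (trans (·-self (proj₂ (lookup w i))) (sym (·-self (proj₂ (lookup w j)))))))

  Unique-resp-↭ : {A : Set} {xs ys : List A} → xs ↭ ys → Unique xs → Unique ys
  Unique-resp-↭ {A} p = PermS.Unique-resp-↭ (setoid A) (↭⇒↭ₛ p)

  -- Cycle types, and the labels of the points on a cycle.

  -- A cycle type (j - 1 , θ), for a cycle of length j and class θ.
  Ty : Set
  Ty = ℕ × Sgn

  -- (i , s) stands for s·gⁱ.
  Label : Set
  Label = ℕ × Sgn

  size : Ty → ℕ
  size t = suc (proj₁ t)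

  labels : Ty → List Label
  labels t = cartesianProduct (upTo (size t)) signs

  -- The normal form of a label on a cycle of length j + 1 and class θ: each full turn of g
  -- contributes one factor θ.
  red : Ty → Label → Label
  red (j , θ) (i , s) = i % suc j , s · (θ ^ˢ (i / suc j))

  ∈-labels⁺ : ∀ t {i} s → i < size t → (i , s) ∈ labels t
  ∈-labels⁺ t s i< = ∈-cartesianProduct⁺ (∈-upTo⁺ i<) (∈-signs s)

  ∈-labels⁻ : ∀ t {a} → a ∈ labels t → proj₁ a < size t
  ∈-labels⁻ t a∈ = ∈-upTo⁻ (proj₁ (∈-cartesianProduct⁻ (upTo (size t)) signs a∈))

  red∈labels : ∀ t a → red t a ∈ labels t
  red∈labels t (i , s) = ∈-labels⁺ t _ (m%n<n i (size t))

  -- The action of g and -1: orbits, frames, and the elements commuting with g.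

  module Action {n : ℕ} (g : SignedMap n) where

    act : Label → Pt n → Pt n
    act (i , s) x = s ⊙ iter (app g) i x

    iter-⊙ : ∀ i s x → iter (app g) i (s ⊙ x) ≡ s ⊙ iter (app g) i x
    iter-⊙ i s x = iter-comm (app g) (s ⊙_) (app-⊙ g s) i x

    act-act : ∀ i s j r x → act (i , s) (act (j , r) x) ≡ act (i + j , s · r) x
    act-act i s j r x = trans (cong (s ⊙_) (iter-⊙ i r (iter (app g) j x)))
      (trans (⊙-⊙ s r _) (cong ((s · r) ⊙_) (sym (iter-+ (app g) i j x))))

    act-comm : ∀ a b x → act a (act b x) ≡ act b (act a x)
    act-comm (i , s) (j , r) x = trans (act-act i s j r x)
      (trans (cong₂ (λ k q → act (k , q) x) (ℕP.+-comm i j) (·-comm s r)) (sym (act-act j r i s x)))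

    Comm : SignedMap n → Set
    Comm h = ∀ x → app h (app g x) ≡ app g (app h x)

    act-app : ∀ h → Comm h → ∀ a x → app h (act a x) ≡ act a (app h x)
    act-app h c (i , s) x = trans (app-⊙ h s _) (cong (s ⊙_) (sym (iter-comm (app g) (app h) (λ y → sym (c y)) i x)))

    -- This alone does not fix the length of the cycle, since a shorter one could satisfy the same
    -- equation; exactness comes from `Free`, which holds in every frame.
    OfType : Ty × Pt n → Set
    OfType (t , x) = iter (app g) (size t) x ≡ proj₂ t ⊙ x

    OfType-act : ∀ t x a → OfType (t , x) → OfType (t , act a x)
    OfType-act t x a ty = trans (act-comm (size t , pos) a x)
      (trans (cong (act a) ty) (act-comm a (0 , proj₂ t) x))

    act-red : ∀ t x → OfType (t , x) → ∀ a → act (red t a) x ≡ act a x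
    act-red (j , θ) x ty (i , s) = sym (begin
      s ⊙ iter (app g) i x
        ≡⟨ cong (λ k → s ⊙ iter (app g) k x) (m≡m%n+[m/n]*n i (suc j)) ⟩
      s ⊙ iter (app g) (i % suc j + (i / suc j) * suc j) x
        ≡⟨ cong (s ⊙_) (iter-+ (app g) (i % suc j) _ x) ⟩
      s ⊙ iter (app g) (i % suc j) (iter (app g) ((i / suc j) * suc j) x)
        ≡⟨ cong (λ y → s ⊙ iter (app g) (i % suc j) y) (multiple (i / suc j)) ⟩
      s ⊙ iter (app g) (i % suc j) ((θ ^ˢ (i / suc j)) ⊙ x)
        ≡⟨ cong (s ⊙_) (iter-⊙ (i % suc j) _ x) ⟩
      s ⊙ ((θ ^ˢ (i / suc j)) ⊙ iter (app g) (i % suc j) x)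
        ≡⟨ ⊙-⊙ s _ _ ⟩
      act (red (j , θ) (i , s)) x ∎)
      where
      open ≡-Reasoning
      multiple : ∀ d → iter (app g) (d * suc j) x ≡ (θ ^ˢ d) ⊙ x
      multiple zero    = refl
      multiple (suc d) = trans (iter-+ (app g) (suc j) (d * suc j) x)
        (trans (cong (iter (app g) (suc j)) (multiple d))
        (trans (iter-⊙ (suc j) (θ ^ˢ d) x)
        (trans (cong ((θ ^ˢ d) ⊙_) ty)
        (trans (⊙-⊙ (θ ^ˢ d) θ x) (cong (_⊙ x) (·-comm (θ ^ˢ d) θ))))))

    -- For θ = +1 this runs through a cycle c and its negative c̄, for θ = -1 through the single
    -- cycle c = c̄; in both cases the list has 2 · `size t` entries.
    orb : Ty × Pt n → List (Pt n)
    orb (t , x) = map (λ a → act a x) (labels t)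

    ∈-orb⁺ : ∀ t x → OfType (t , x) → ∀ a → act a x ∈ orb (t , x)
    ∈-orb⁺ t x ty a = subst (_∈ orb (t , x)) (act-red t x ty a) (∈-map⁺ (λ b → act b x) (red∈labels t a))

    pair : Pt n → List (Pt n)
    pair x = x ∷ neg ⊙ x ∷ []

    pair-⊙ : ∀ s x → pair (s ⊙ x) ↭ pair x
    pair-⊙ pos x = ↭-refl
    pair-⊙ neg x = ↭-trans (swap _ _ ↭-refl) (↭-reflexive (cong (λ y → y ∷ neg ⊙ x ∷ []) (⊙-⊙ neg neg x)))

    pairs : (ℕ → Pt n) → ℕ → List (Pt n)
    pairs u zero    = []
    pairs u (suc j) = pair (u 0) ++ pairs (u ∘ suc) j

    pairs-cong : ∀ {u v} → (∀ i → u i ≡ v i) → ∀ j → pairs u j ≡ pairs v j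
    pairs-cong eq zero    = refl
    pairs-cong eq (suc j) = cong₂ _++_ (cong pair (eq 0)) (pairs-cong (eq ∘ suc) j)

    pairs-snoc : ∀ u j → pairs u (suc j) ≡ pairs u j ++ pair (u j)
    pairs-snoc u zero    = refl
    pairs-snoc u (suc j) = cong (pair (u 0) ++_) (pairs-snoc (u ∘ suc) j)

    pairs-⊙ : ∀ s u j → pairs (λ i → s ⊙ u i) j ↭ pairs u j
    pairs-⊙ s u zero    = ↭-refl
    pairs-⊙ s u (suc j) = ++⁺ (pair-⊙ s (u 0)) (pairs-⊙ s (u ∘ suc) j)

    orb≡pairs : ∀ (x : Pt n) (f : ℕ → ℕ) j →
      map (λ a → act a x) (cartesianProduct (applyUpTo f j) signs) ≡ pairs (λ i → iter (app g) (f i) x) j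
    orb≡pairs x f zero    = refl
    orb≡pairs x f (suc j) = cong (λ z → _ ∷ _ ∷ z) (orb≡pairs x (f ∘ suc) j)

    private
      -- The pairs ±g x, ..., ±gʲ x are the pairs ±x, ..., ±gʲ⁻¹ x rotated by one place, because gʲ
      -- x = θ x and the pair ±θ x is ±x up to order.
      orb-app : ∀ t x → OfType (t , x) → orb (t , app g x) ↭ orb (t , x)
      orb-app t x ty = ↭-trans (↭-reflexive (begin
        orb (t , app g x)
          ≡⟨ orb≡pairs (app g x) id (size t) ⟩
        pairs (λ i → iter (app g) i (app g x)) (size t)
          ≡⟨ pairs-cong (λ i → iter-comm (app g) (app g) (λ _ → refl) i x) (size t) ⟩
        pairs (λ i → iter (app g) (suc i) x) (size t)
          ≡⟨ pairs-snoc _ (proj₁ t) ⟩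
        pairs (λ i → iter (app g) (suc i) x) (proj₁ t) ++ pair (iter (app g) (size t) x)
          ≡⟨ cong (λ y → pairs (λ i → iter (app g) (suc i) x) (proj₁ t) ++ pair y) ty ⟩
        pairs (λ i → iter (app g) (suc i) x) (proj₁ t) ++ pair (proj₂ t ⊙ x) ∎))
        (↭-trans (++-comm _ (pair (proj₂ t ⊙ x)))
        (↭-trans (++⁺ʳ _ (pair-⊙ (proj₂ t) x)) (↭-reflexive (sym (orb≡pairs x id (size t))))))
        where open ≡-Reasoning

    orb-act : ∀ t x a → OfType (t , x) → orb (t , act a x) ↭ orb (t , x)
    orb-act t x (i , s) ty = ↭-trans (orb-⊙ s (iter (app g) i x)) (orb-iter i)
      where
      orb-⊙ : ∀ s y → orb (t , s ⊙ y) ↭ orb (t , y)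
      orb-⊙ s y = ↭-trans (↭-reflexive (trans (orb≡pairs (s ⊙ y) id (size t))
          (pairs-cong (λ i → iter-⊙ i s y) (size t))))
        (↭-trans (pairs-⊙ s (λ i → iter (app g) i y) (size t)) (↭-reflexive (sym (orb≡pairs y id (size t)))))
      orb-iter : ∀ i → orb (t , iter (app g) i x) ↭ orb (t , x)
      orb-iter zero    = ↭-refl
      orb-iter (suc i) = ↭-trans (orb-app t (iter (app g) i x) (OfType-act t x (i , pos) ty)) (orb-iter i)

    Free : Ty × Pt n → Set
    Free (t , x) = ∀ a b → act a x ≡ act b x → red t a ≡ red t b

    -- One base point on each cycle of g up to sign, together with the type of that cycle.
    Frame : List (Ty × Pt n) → Set
    Frame ps = All OfType ps × concatMap orb ps ↭ allPts n

    frame-↭ : ∀ {ps qs} → ps ↭ qs → Frame ps → Frame qs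
    frame-↭ p (tys , fr) = All-resp-↭ p tys , ↭-trans (concatMap-↭ orb (↭-sym p)) fr

    frame-act : ∀ {t x ps} a → Frame ((t , x) ∷ ps) → Frame ((t , act a x) ∷ ps)
    frame-act {t} {x} a (ty ∷ tys , fr) = OfType-act t x a ty ∷ tys , ↭-trans (++⁺ʳ _ (orb-act t x a ty)) fr

    frame-unique : ∀ {ps} → Frame ps → Unique (concatMap orb ps)
    frame-unique (_ , fr) = Unique-resp-↭ (↭-sym fr) Unique-allPts

    -- The orbits of a frame list every signed point exactly once, so distinct normal forms move a
    -- base to distinct points.
    frame-free : ∀ {p ps} → Frame ps → p ∈ ps → Free p
    frame-free {t , x} fr p∈ a b eq = Unique-map⇒injective (λ a → act a x)
      (Unique-concatMap⇒fibre orb (frame-unique fr) p∈) (red∈labels t a) (red∈labels t b)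
      (trans (act-red t x ty a) (trans eq (sym (act-red t x ty b))))
      where ty = All.lookup (proj₁ fr) p∈

    frame-disjoint : ∀ {p ps} → Frame (p ∷ ps) → ∀ {q} → q ∈ ps → ∀ a b → act a (proj₂ p) ≢ act b (proj₂ q)
    frame-disjoint {p} {ps} fr {q} q∈ a b eq = Unique-++⇒disjoint (orb p) (frame-unique fr)
      (∈-orb⁺ (proj₁ p) (proj₂ p) (All.lookup (proj₁ fr) (here refl)) a)
      (subst (_∈ concatMap orb ps) (sym eq) (∈-concatMap orb q∈ (∈-orb⁺ (proj₁ q) (proj₂ q) (All.lookup (proj₁ fr) (there q∈)) b)))

    -- The prescription h x = y for a base x and its image y; one type serves both, as a bijection
    -- commuting with g preserves types.
    Arrow : Set
    Arrow = Ty × Pt n × Pt n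

    dom ran : Arrow → Ty × Pt n
    dom (t , x , y) = t , x
    ran (t , x , y) = t , y

    Sends : SignedMap n → Arrow → Set
    Sends h (t , x , y) = app h x ≡ y

    private
      -- Coordinates on the signed points: each is `act a` of the base of exactly one arrow, with
      -- exactly one label `a` in normal form. `f` is `dom` or `ran`.
      module Indexed (f : Arrow → Ty × Pt n) {st} (fr : Frame (map f st)) where
        unique : Unique (concatMap (orb ∘ f) st)
        unique = subst Unique (concatMap-map orb f st) (frame-unique fr)

        abstract
          cover : ∀ y → ∃ λ e → e ∈ st × ∃ λ a → a ∈ labels (proj₁ (f e)) × y ≡ act a (proj₂ (f e))
          cover y with ∈-concatMap⁻′ (orb ∘ f) st
            (subst (y ∈_) (concatMap-map orb f st) (∈-resp-↭ (↭-sym (proj₂ fr)) (∈-allPts y)))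
          ... | e , e∈ , y∈ with ∈-map⁻ _ y∈
          ...   | a , a∈ , eq = e , e∈ , a , a∈ , eq

        index-≡ : ∀ {e e′ a b} → e ∈ st → e′ ∈ st → a ∈ labels (proj₁ (f e)) → b ∈ labels (proj₁ (f e′)) →
          act a (proj₂ (f e)) ≡ act b (proj₂ (f e′)) → e ≡ e′
        index-≡ {e} {e′} {a} {b} e∈ e′∈ a∈ b∈ eq = Unique-concatMap⇒≡ (orb ∘ f) unique e∈ e′∈
          (∈-map⁺ _ a∈) (subst (_∈ orb (f e′)) (sym eq) (∈-map⁺ _ b∈))

        label-≡ : ∀ {e a b} → e ∈ st → a ∈ labels (proj₁ (f e)) → b ∈ labels (proj₁ (f e)) →
          act a (proj₂ (f e)) ≡ act b (proj₂ (f e)) → a ≡ b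
        label-≡ e∈ = Unique-map⇒injective _ (Unique-concatMap⇒fibre (orb ∘ f) unique e∈)

    -- Every point is a label applied to a base, and h (a·x) = a·(h x).
    Comm-determined : ∀ {st} → Frame (map dom st) → ∀ {h h′} → Comm h → Comm h′ →
      All (Sends h) st → All (Sends h′) st → h ≡ h′
    Comm-determined {st} fr {h} {h′} c c′ s s′ = app-ext h h′ agree
      where
      agree : ∀ x → app h x ≡ app h′ x
      agree x with Indexed.cover dom fr x
      ... | (t , p , q) , e∈ , a , _ , refl =
        trans (act-app h c a p) (trans (cong (act a) (trans (All.lookup s e∈) (sym (All.lookup s′ e∈)))) (sym (act-app h′ c′ a p)))

    -- The element is a·x ↦ a·y for each arrow from x to y. It is well defined because x and y have
    -- the same type, hence identify the same labels, and it is injective because the targets form a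
    -- frame as well.
    frames-connected : ∀ {st} → Frame (map dom st) → Frame (map ran st) →
      ∃ λ h → h ∈ Bn n × Comm h × All (Sends h) st
    frames-connected {st} frD frR = h , Inj⇒Bn h inj , comm , All.tabulate sends
      where
      open ≡-Reasoning
      module D = Indexed dom frD
      module R = Indexed ran frR

      φ : Pt n → Pt n
      φ x = let ((_ , _ , y) , _ , a , _) = D.cover x in act a y

      -- The label which `D.cover` returns for `act a x` need not be `a`: it is `red t a`, which
      -- acts on `y` as `a` does because `y` too has type `t`.
      φ-act : ∀ {t x y} → (t , x , y) ∈ st → ∀ a → φ (act a x) ≡ act a y
      φ-act {t} {x} {y} e∈ a with D.cover (act a x)
      ... | e′ , e′∈ , b , b∈ , eq with trans (act-red t x (All.lookup (proj₁ frD) (∈-map⁺ dom e∈)) a) eq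
      ...   | eq′ with D.index-≡ e∈ e′∈ (red∈labels t a) b∈ eq′
      ...     | refl with D.label-≡ e∈ (red∈labels t a) b∈ eq′
      ...       | refl = act-red t y (All.lookup (proj₁ frR) (∈-map⁺ ran e∈)) a

      φ-comm : ∀ a x → φ (act a x) ≡ act a (φ x)
      φ-comm (i , s) x with D.cover x
      ... | (t , p , q) , e∈ , (j , r) , _ , refl = trans (cong φ (act-act i s j r p))
            (trans (φ-act e∈ (i + j , s · r)) (sym (act-act i s j r q)))

      h : SignedMap n
      h = tabulate (λ i → φ (i , pos))

      app-h : ∀ x → app h x ≡ φ x
      app-h (i , s) = begin
        s ⊙ lookup h i           ≡⟨ cong (s ⊙_) (lookup∘tabulate _ i) ⟩
        s ⊙ φ (i , pos)          ≡⟨ φ-comm (0 , s) (i , pos) ⟨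
        φ (i , s · pos)          ≡⟨ cong (λ r → φ (i , r)) (·-identityʳ s) ⟩
        φ (i , s) ∎

      sends : ∀ {e} → e ∈ st → Sends h e
      sends {t , x , y} e∈ = trans (app-h x) (φ-act e∈ (0 , pos))

      comm : Comm h
      comm x = trans (app-h (app g x)) (trans (φ-comm (1 , pos) x) (cong (app g) (sym (app-h x))))

      φ-inj : ∀ x y → φ x ≡ φ y → x ≡ y
      φ-inj x y eq with D.cover x | D.cover y
      ... | (t , p , q) , e∈ , a , a∈ , refl | (t′ , p′ , q′) , e′∈ , b , b∈ , refl
          with R.index-≡ e∈ e′∈ a∈ b∈ eq
      ...   | refl with R.label-≡ e∈ a∈ b∈ eq
      ...     | refl = refl

      inj : Inj h
      inj x y eq = φ-inj x y (trans (sym (app-h x)) (trans eq (app-h y)))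

  ∈⇒↭ : {A : Set} {x : A} {xs : List A} → x ∈ xs → ∃ λ ys → xs ↭ x ∷ ys
  ∈⇒↭ {x = x} x∈ with ∈-∃++ x∈
  ... | ys , zs , refl = ys ++ zs , shift x ys zs

  -- The label `(size t′ , proj₂ t′)` acts trivially on cycles of type `t′`, since θ′ · θ′ = 1. If
  -- it is trivial for `t` too, then `size t` divides `size t′`. By symmetry the lengths agree, and
  -- the remaining sign θ′ · θ is trivial only if the classes agree.
  order-determines-type : ∀ t t′ → red t (size t′ , proj₂ t′) ≡ red t (0 , pos) →
    red t′ (size t , proj₂ t) ≡ red t′ (0 , pos) → t ≡ t′
  order-determines-type (j , θ) (j′ , θ′) p q
    with ∣-antisym (m%n≡0⇒n∣m (suc j′) (suc j) (,-injectiveˡ p)) (m%n≡0⇒n∣m (suc j) (suc j′) (,-injectiveˡ q))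
  ... | refl = cong (j ,_) (same θ θ′ (trans (cong (λ d → θ′ · (θ ^ˢ d)) (sym (n/n≡1 (suc j)))) (,-injectiveʳ p)))
    where
    same : ∀ s r → r · (s · pos) ≡ pos → s ≡ r
    same pos pos _ = refl
    same neg neg _ = refl

  weightOf : Ty → ℕ
  weightOf t = length (labels t)

  -- The recursion for completions, and the conditions it applies to.

  -- Ω κ t m b counts the ways to complete a cycle through m of the g-cycles of type t, with b
  -- g-cycles of type t still unused; κ t m counts the admissible ways of closing it at once.
  mutual
    R : (Ty → ℕ → ℕ) → Ty → ℕ → ℕ
    R κ t zero    = 1
    R κ t (suc b) = Ω κ t 1 b

    Ω : (Ty → ℕ → ℕ) → Ty → ℕ → ℕ → ℕ
    Ω κ t m zero    = κ t m
    Ω κ t m (suc b) = κ t m * R κ t (suc b) + suc b * (weightOf t * Ω κ t (suc m) b)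

  -- A set P of elements commuting with g that can be tested one cycle at a time: h satisfies P
  -- iff G h holds at every point, and whether G h s holds is decided (OK) by the length m + 1
  -- and the label a of the return of s to its g-cycle, iter h (m + 1) s = a·s.
  record Condition {n : ℕ} (g : SignedMap n) (κ : Ty → ℕ → ℕ) : Set₁ where
    open Action g
    field
      P     : SignedMap n → Set
      P?    : Decidable P
      G     : SignedMap n → Pt n → Set
      OK    : Ty → ℕ → Label → Set
      OK?   : ∀ t m → Decidable (OK t m)
      κ-OK  : ∀ t m → # (OK? t m) (labels t) ≡ κ t (suc m)
      P⇒Comm : ∀ h → P h → Comm h
      P⇒G   : ∀ h → P h → ∀ x → G h x
      G⇒P   : ∀ h → Comm h → (∀ x → G h x) → P h
      G-iter : ∀ h i x → Comm h → G h x → G h (iter (app h) i x)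
      G-act : ∀ h a x → Comm h → G h x → G h (act a x)
      closing : ∀ h t s m a → Comm h → OfType (t , s) → Free (t , s) →
        (∀ i → 0 < i → i ≤ m → ∀ b c → act b (iter (app h) i s) ≢ act c s) →
        iter (app h) (suc m) s ≡ act a s → (G h s → OK t m a) × (OK t m a → G h s)

  -- Exploring an element along its cycles.

  module Counting {n : ℕ} {g : SignedMap n} {κ : Ty → ℕ → ℕ} (cond : Condition g κ) where
    open Action g
    open Condition cond

    sends? : ∀ h → Decidable (Sends h)
    sends? h (t , x , y) = app h x ≟ᴾ y

    Q? : ∀ st → Decidable (λ h → All (Sends h) st × P h)
    Q? st h = All.all? (sends? h) st ×-dec P? h

    N : List Arrow → ℕ
    N st = # (Q? st) (Bn n)

    frame-cover : ∀ {ps} → Frame ps → ∀ x → ∃ λ p → p ∈ ps × ∃ λ a → x ≡ act a (proj₂ p)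
    frame-cover {ps} fr x with ∈-concatMap⁻′ orb ps (∈-resp-↭ (↭-sym (proj₂ fr)) (∈-allPts x))
    ... | p , p∈ , x∈ with ∈-map⁻ (λ a → act a (proj₂ p)) {xs = labels (proj₁ p)} x∈
    ...   | a , _ , eq = p , p∈ , a , eq

    frame-act-∈ : ∀ {ps t x} → Frame ps → (t , x) ∈ ps → ∀ a → OfType (t , act a x) × Free (t , act a x)
    frame-act-∈ fr x∈ a with ∈⇒↭ x∈
    ... | ys , p = let fr′ = frame-act a (frame-↭ p fr) in All.lookup (proj₁ fr′) (here refl) , frame-free fr′ (here refl)

    -- The partial maps st met while h is explored: the values on the bases in st are known, those
    -- on S are not. In a closed state every cycle of h entered so far has been completed; in an
    -- open state s, h s, …, hᵐ s = c have been visited and the value at c is asked for next.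
    -- The visited points serve as the base points of their g-cycles.
    record Closed (st : List Arrow) (S : List (Ty × Pt n)) : Set where
      field
        frD  : Frame (map dom st ++ S)
        frR  : Frame (map ran st ++ S)
        good : ∀ h → Comm h → All (Sends h) st → ∀ {e} → e ∈ st → G h (proj₂ (dom e))

    record Open (st : List Arrow) (t : Ty) (s : Pt n) (m : ℕ) (c : Pt n) (S : List (Ty × Pt n)) : Set where
      field
        frD   : Frame ((t , c) ∷ map dom st ++ S)
        frR   : Frame ((t , s) ∷ map ran st ++ S)
        reach : ∀ h → Comm h → All (Sends h) st → iter (app h) m s ≡ c
        fresh : ∀ h → Comm h → All (Sends h) st → ∀ i → 0 < i → i ≤ m →
                ∀ a b → act a (iter (app h) i s) ≢ act b s
        good  : ∀ h → Comm h → All (Sends h) st → G h s → ∀ {e} → e ∈ st → G h (proj₂ (dom e))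

    start : ∀ {st t r S} → Closed st ((t , r) ∷ S) → Open st t r 0 r S
    start {st} {t} {r} {S} cl = record
      { frD   = frame-↭ (shift (t , r) (map dom st) S) frD
      ; frR   = frame-↭ (shift (t , r) (map ran st) S) frR
      ; reach = λ _ _ _ → refl
      ; fresh = λ { _ _ _ (suc i) _ () }
      ; good  = λ h c s _ → good h c s
      } where open Closed cl

    module _ {st t s m c S} (op : Open st t s m c S) where
      open Open op

      good-step : ∀ {y} h → Comm h → All (Sends h) ((t , c , y) ∷ st) → G h s →
        ∀ {e} → e ∈ ((t , c , y) ∷ st) → G h (proj₂ (dom e))
      good-step h cm (_ ∷ ss) gs (here refl) = subst (G h) (reach h cm ss) (G-iter h m s cm gs)
      good-step h cm (_ ∷ ss) gs (there e∈)  = good h cm ss gs e∈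

      closes : ∀ {a} h → Comm h → All (Sends h) ((t , c , act a s) ∷ st) →
        (G h s → OK t m a) × (OK t m a → G h s)
      closes {a} h cm (eq ∷ ss) = closing h t s m a cm (All.lookup (proj₁ frR) (here refl)) (frame-free frR (here refl))
        (fresh h cm ss) (trans (cong (app h) (reach h cm ss)) eq)

      -- In an open state `c` lacks an image and `s` a preimage. The arrow from `c` to `act a s`
      -- supplies both, after the g-cycle of `s` has been rebased at `act a s`.
      close : ∀ {a} → OK t m a → Closed ((t , c , act a s) ∷ st) S
      close {a} ok = record
        { frD  = frD
        ; frR  = frame-act a frR
        ; good = λ h cm ss → good-step h cm ss (proj₂ (closes h cm ss) ok)
        }

      close-fails : ∀ {a} → ¬ OK t m a → N ((t , c , act a s) ∷ st) ≡ 0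
      close-fails ¬ok = #-none (Q? _) (Bn n)
        (λ h _ (ss , p) → ¬ok (proj₁ (closes h (P⇒Comm h p) ss) (P⇒G h p s)))

      extend : ∀ {r S′} a → S ↭ (t , r) ∷ S′ → Open ((t , c , act a r) ∷ st) t s (suc m) (act a r) S′
      extend {r} {S′} a p = record
        { frD   = frame-act a (frame-↭ permD frD)
        ; frR   = frame-↭ (swap _ _ ↭-refl) (frame-act a frR′)
        ; reach = λ { h cm (eq ∷ ss) → trans (cong (app h) (reach h cm ss)) eq }
        ; fresh = fresh′
        ; good  = good-step
        }
        where
        permD : (t , c) ∷ map dom st ++ S ↭ (t , r) ∷ (t , c) ∷ map dom st ++ S′
        permD = ↭-trans (prep _ (↭-trans (++⁺ˡ (map dom st) p) (shift (t , r) (map dom st) S′))) (swap _ _ ↭-refl)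
        frR′ : Frame ((t , r) ∷ (t , s) ∷ map ran st ++ S′)
        frR′ = frame-↭ (↭-trans (prep _ (↭-trans (++⁺ˡ (map ran st) p) (shift (t , r) (map ran st) S′))) (swap _ _ ↭-refl)) frR
        fresh′ : ∀ h → Comm h → All (Sends h) ((t , c , act a r) ∷ st) → ∀ i → 0 < i → i ≤ suc m →
                ∀ b d → act b (iter (app h) i s) ≢ act d s
        fresh′ h cm (eq ∷ ss) i i>0 i≤ b d with ℕP.m≤n⇒m<n∨m≡n i≤
        ... | inj₁ (s≤s i≤m) = fresh h cm ss i i>0 i≤m b d
        -- The newest point lies on the g-cycle of `r`, which the range frame separates from that of
        -- `s`.
        ... | inj₂ refl = λ e → frame-disjoint (frame-act a frR′) (here refl) b d
                (trans (cong (act b) (sym (trans (cong (app h) (reach h cm ss)) eq))) e)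

      -- If an arrow already sends x to y, then a·y is the image of a·x. By injectivity c would be
      -- a·x, but c and x are bases of different orbits.
      hit-range : ∀ {e} a → e ∈ st → N ((t , c , act a (proj₂ (ran e))) ∷ st) ≡ 0
      hit-range {t′ , x , y} a e∈ = #-none (Q? _) (Bn n)
        (λ { h h∈ (eq ∷ ss , p) → frame-disjoint frD (∈-++⁺ˡ (∈-map⁺ dom e∈)) (0 , pos) a
               (Bn⇒Inj h h∈ c (act a x) (trans eq (sym (trans (act-app h (P⇒Comm h p) a x)
                  (cong (act a) (All.lookup ss e∈)))))) })

      -- As `h` is injective and commutes with g, the same labels fix `c` and its image, and these
      -- labels determine the type.
      hit-other-type : ∀ {t′ r} a → t′ ≢ t → (t′ , r) ∈ S → N ((t , c , act a r) ∷ st) ≡ 0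
      hit-other-type {t′} {r} a ne r∈ = #-none (Q? _) (Bn n) impossible
        where
        order : ∀ t x → OfType (t , x) → act (size t , proj₂ t) x ≡ x
        order t x ty = trans (cong (proj₂ t ⊙_) ty) (trans (⊙-⊙ (proj₂ t) (proj₂ t) x) (cong (_⊙ x) (·-self (proj₂ t))))
        impossible : ∀ h → h ∈ Bn n → ¬ (All (Sends h) ((t , c , act a r) ∷ st) × P h)
        impossible h h∈ (eq ∷ ss , p) = ne (sym (order-determines-type t t′ ord ord′))
          where
          y = act a r
          ty = frame-act-∈ frR (there (∈-++⁺ʳ (map ran st) r∈)) a
          ord : red t (size t′ , proj₂ t′) ≡ red t (0 , pos)
          ord = frame-free frD (here refl) (size t′ , proj₂ t′) (0 , pos) (Bn⇒Inj h h∈ _ _ (trans (act-app h (P⇒Comm h p) (size t′ , proj₂ t′) c)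
            (trans (cong (act (size t′ , proj₂ t′)) eq) (trans (order t′ y (proj₁ ty)) (sym eq)))))
          ord′ : red t′ (size t , proj₂ t) ≡ red t′ (0 , pos)
          ord′ = proj₂ ty (size t , proj₂ t) (0 , pos) (trans (cong (act (size t , proj₂ t)) (sym eq)) (trans (sym (act-app h (P⇒Comm h p) (size t , proj₂ t) c))
            (trans (cong (app h) (order t c (All.lookup (proj₁ frD) (here refl)))) eq)))

      -- Elements are sorted by their value at `c`, and the possible values are arranged along the
      -- orbits of the range frame.
      N-query : N st ≡ ∑ℕ.∑ (concatMap orb ((t , s) ∷ map ran st ++ S)) (λ y → N ((t , c , y) ∷ st))
      N-query = trans (#-partition (Q? st) _≟ᴾ_ (λ h → app h c) (Bn n) Unique-allPts (λ h _ → ∈-allPts (app h c)))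
        (trans (∑ℕ.∑-cong (allPts n) (λ y → #-cong _ (Q? ((t , c , y) ∷ st)) (Bn n)
                  (λ { h _ (eq , ss , p) → eq ∷ ss , p }) (λ { h _ (eq ∷ ss , p) → eq , ss , p })))
               (∑ℕ.∑-↭ _ (↭-sym (proj₂ frR))))

    N-step : ∀ {st t s m c xs rest} → Open st t s m c (map (t ,_) xs ++ rest) → All (λ p → proj₁ p ≢ t) rest →
      (V W : ℕ) → (∀ a → OK t m a → N ((t , c , act a s) ∷ st) ≡ V) →
      (∀ {r} → r ∈ xs → ∀ a → N ((t , c , act a r) ∷ st) ≡ W) →
      N st ≡ κ t (suc m) * V + length xs * (weightOf t * W)
    N-step {st} {t} {s} {m} {c} {xs} {rest} op ne V W hV hW = begin
      N st
        ≡⟨ N-query op ⟩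
      ∑ℕ.∑ (concatMap orb ((t , s) ∷ map ran st ++ map (t ,_) xs ++ rest)) F
        ≡⟨ ∑ℕ.∑-concatMap orb ((t , s) ∷ map ran st ++ map (t ,_) xs ++ rest) F ⟩
      O (t , s) + ∑ℕ.∑ (map ran st ++ map (t ,_) xs ++ rest) O
        ≡⟨ cong (O (t , s) +_) (trans (∑ℕ.∑-++ (map ran st) _ O) (cong₂ _+_ ran-part (∑ℕ.∑-++ (map (t ,_) xs) rest O))) ⟩
      O (t , s) + (∑ℕ.∑ (map (t ,_) xs) O + ∑ℕ.∑ rest O)
        ≡⟨ cong₂ _+_ start-part (trans (cong₂ _+_ same-part rest-part) (ℕP.+-identityʳ _)) ⟩
      κ t (suc m) * V + length xs * (weightOf t * W) ∎
      where
      open ≡-Reasoning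
      F : Pt n → ℕ
      F y = N ((t , c , y) ∷ st)
      O : Ty × Pt n → ℕ
      O p = ∑ℕ.∑ (orb p) F

      ran-part : ∑ℕ.∑ (map ran st) O ≡ 0
      ran-part = trans (∑ℕ.∑-map ran st O) (∑ℕ.∑-zero st (λ e e∈ →
        trans (∑ℕ.∑-map _ (labels (proj₁ e)) F) (∑ℕ.∑-zero (labels (proj₁ e)) (λ a _ → hit-range op a e∈))))

      rest-part : ∑ℕ.∑ rest O ≡ 0
      rest-part = ∑ℕ.∑-zero rest (λ p p∈ → trans (∑ℕ.∑-map _ (labels (proj₁ p)) F)
        (∑ℕ.∑-zero (labels (proj₁ p)) (λ a _ → hit-other-type op a (All.lookup ne p∈) (∈-++⁺ʳ (map (t ,_) xs) p∈))))

      same-part : ∑ℕ.∑ (map (t ,_) xs) O ≡ length xs * (weightOf t * W)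
      same-part = trans (∑ℕ.∑-map (t ,_) xs O) (trans (∑ℕ.∑-cong∈ xs (λ r r∈ →
        trans (∑ℕ.∑-map _ (labels t) F) (trans (∑ℕ.∑-cong (labels t) (hW r∈)) (∑ℕ-const (labels t) W))))
        (∑ℕ-const xs (weightOf t * W)))

      start-label : ∀ a → F (act a s) ≡ 𝟙 (OK? t m a) * V
      start-label a with OK? t m a
      ... | yes ok = trans (hV a ok) (sym (ℕP.*-identityˡ V))
      ... | no ¬ok = close-fails op ¬ok

      start-part : O (t , s) ≡ κ t (suc m) * V
      start-part = trans (∑ℕ.∑-map _ (labels t) F) (trans (∑ℕ.∑-cong (labels t) start-label)
        (trans (sym (∑ℕ.∑-*ʳ V (labels t) (λ a → 𝟙 (OK? t m a)))) (cong (_* V) (trans (sym (#≡∑ (OK? t m) (labels t))) (κ-OK t m)))))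

    -- Existence is `frames-connected`, uniqueness `Comm-determined`. The element found satisfies
    -- `P` because `good` gives `G` at all bases and `G-act` carries it over their orbits.
    N-complete : ∀ {st} → Closed st [] → N st ≡ 1
    N-complete {st} cl with frames-connected (subst Frame (++-identityʳ _) (Closed.frD cl)) (subst Frame (++-identityʳ _) (Closed.frR cl))
    ... | h , h∈ , cm , ss = #-one (Q? st) (Unique-Bn n) h∈ (ss , G⇒P h cm everywhere)
          (λ h′ _ (ss′ , p′) → Comm-determined frD′ (P⇒Comm h′ p′) cm ss′ ss)
      where
      frD′ = subst Frame (++-identityʳ _) (Closed.frD cl)
      everywhere : ∀ x → G h x
      everywhere x with frame-cover frD′ x
      ... | p , p∈ , a , refl with ∈-map⁻ dom p∈
      ...   | e , e∈ , refl = G-act h a _ cm (Closed.good cl h cm ss e∈)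

    module _ {t : Ty} {rest : List (Ty × Pt n)} (ne : All (λ p → proj₁ p ≢ t) rest)
             (ρ : ℕ) (N-rest : ∀ {st} → Closed st rest → N st ≡ ρ) where
      mutual
        -- A cycle of h stays within one type, so `rest` is untouched until the bases of type `t`
        -- are exhausted, and its count ρ factors out.
        N-closed : ∀ b xs {st} → length xs ≡ b → Closed st (map (t ,_) xs ++ rest) → N st ≡ R κ t b * ρ
        N-closed zero    []       refl cl = trans (N-rest cl) (sym (ℕP.*-identityˡ ρ))
        N-closed (suc b) (r ∷ xs) len  cl = N-open b xs (ℕP.suc-injective len) (start cl)

        N-open : ∀ b xs {st s m c} → length xs ≡ b → Open st t s m c (map (t ,_) xs ++ rest) →
          N st ≡ Ω κ t (suc m) b * ρ
        N-open zero [] {m = m} refl op =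
          trans (N-step op ne ρ 0 (λ a ok → N-rest (close op ok)) (λ ())) (ℕP.+-identityʳ _)
        N-open (suc b) xs {m = m} len op = trans
          (N-step {xs = xs} op ne (R κ t (suc b) * ρ) (Ω κ t (suc (suc m)) b * ρ)
            (λ a ok → N-closed (suc b) xs len (close op ok))
            (λ {r} r∈ a → next r∈ a))
          (trans (cong (λ l → κ t (suc m) * (R κ t (suc b) * ρ) + l * (weightOf t * (Ω κ t (suc (suc m)) b * ρ))) len)
                 (solve 6 (λ k r p l w o → k :* (r :* p) :+ l :* (w :* (o :* p)) := (k :* r :+ l :* (w :* o)) :* p) refl
                    (κ t (suc m)) (R κ t (suc b)) ρ (suc b) (weightOf t) (Ω κ t (suc (suc m)) b)))
          where
          open ℕSolver.+-*-Solver using (solve; _:+_; _:*_; _:=_)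
          next : ∀ {r} → r ∈ xs → ∀ a → N ((t , _ , act a r) ∷ _) ≡ Ω κ t (suc (suc m)) b * ρ
          next {r} r∈ a with ∈-∃++ r∈
          ... | ys , zs , refl = N-open b (ys ++ zs)
                (ℕP.suc-injective (trans (sym (trans (length-++ ys) (trans (ℕP.+-suc _ _) (cong suc (sym (length-++ ys)))))) len))
                (extend op a (↭-trans (++⁺ʳ rest (↭-reflexive (map-++ (t ,_) ys (r ∷ zs))))
                  (↭-trans (++⁺ʳ rest (shift (t , r) (map (t ,_) ys) (map (t ,_) zs)))
                    (prep _ (++⁺ʳ rest (↭-reflexive (sym (map-++ (t ,_) ys zs))))))))

    flat : List (Ty × List (Pt n)) → List (Ty × Pt n)
    flat = concatMap (λ (t , xs) → map (t ,_) xs)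

    N-groups : ∀ {st} gs → AllPairs (λ p q → proj₁ p ≢ proj₁ q) gs → Closed st (flat gs) →
      N st ≡ product (map (λ (t , xs) → R κ t (length xs)) gs)
    N-groups []              _        cl = N-complete cl
    N-groups ((t , xs) ∷ gs) (ne ∷ d) cl = N-closed (All.tabulate other) _ (N-groups gs d) (length xs) xs refl cl
      where
      other : ∀ {p} → p ∈ flat gs → proj₁ p ≢ t
      other p∈ with ∈-concatMap⁻′ (λ (t , xs) → map (t ,_) xs) gs p∈
      ... | q , q∈ , p∈q with ∈-map⁻ _ p∈q
      ...   | _ , _ , refl = λ eq → All.lookup ne q∈ (sym eq)

    count-groups : ∀ gs → AllPairs (λ p q → proj₁ p ≢ proj₁ q) gs → Frame (flat gs) →
      # P? (Bn n) ≡ product (map (λ (t , xs) → R κ t (length xs)) gs)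
    count-groups gs d fr = trans (#-cong P? (Q? []) (Bn n) (λ _ _ p → [] , p) (λ _ _ → proj₂))
      (N-groups gs d (record { frD = fr ; frR = fr ; good = λ _ _ _ () }))

  -- Labels whose q-th power is g on a cycle.

  ^ˢ-+ : ∀ s m n → s ^ˢ (m + n) ≡ (s ^ˢ m) · (s ^ˢ n)
  ^ˢ-+ s zero    n = refl
  ^ˢ-+ s (suc m) n = trans (cong (s ·_) (^ˢ-+ s m n)) (sym (·-assoc s _ _))

  ^ˢ-* : ∀ s m n → s ^ˢ (m * n) ≡ (s ^ˢ n) ^ˢ m
  ^ˢ-* s zero    n = refl
  ^ˢ-* s (suc m) n = trans (^ˢ-+ s n (m * n)) (cong ((s ^ˢ n) ·_) (^ˢ-* s m n))

  pos-^ˢ : ∀ m → pos ^ˢ m ≡ pos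
  pos-^ˢ zero    = refl
  pos-^ˢ (suc m) = pos-^ˢ m

  pos≢neg : pos ≢ neg
  pos≢neg ()

  ≢pos⇒neg : ∀ s → s ≢ pos → s ≡ neg
  ≢pos⇒neg pos ne = ⊥-elim (ne refl)
  ≢pos⇒neg neg ne = refl

  -- For θ = neg and q even, the relation forces j odd and d + e odd.
  sign-count : ∀ q i j θ d e → q * i + e * j ≡ 1 + d * j →
    ∑ℕ.∑ signs (λ s → 𝟙 (((s ^ˢ q) · (θ ^ˢ d)) ≟ˢ (θ ^ˢ e))) ≡ rootsZ2 q θ
  sign-count q i j pos d e rel = trans
    (∑ℕ.∑-cong signs (λ s → 𝟙-cong (((s ^ˢ q) · (pos ^ˢ d)) ≟ˢ (pos ^ˢ e)) ((s ^ˢ q) ≟ˢ pos)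
       (λ eq → trans (sym (simp s)) (trans eq (pos-^ˢ e)))
       (λ eq → trans (simp s) (trans eq (sym (pos-^ˢ e))))))
    (sym (#≡∑ (λ s → (s ^ˢ q) ≟ˢ pos) signs))
    where
    simp : ∀ s → (s ^ˢ q) · (pos ^ˢ d) ≡ s ^ˢ q
    simp s = trans (cong ((s ^ˢ q) ·_) (pos-^ˢ d)) (·-identityʳ _)
  sign-count q i j neg d e rel = trans (by-parity (neg ^ˢ q) refl) (sym (#≡∑ (λ s → (s ^ˢ q) ≟ˢ neg) signs))
    where
    u = neg ^ˢ d
    v = neg ^ˢ e
    total : Sgn → Sgn → Sgn → Sgn → ℕ
    total a b u v = 𝟙 ((a · u) ≟ˢ v) + (𝟙 ((b · u) ≟ˢ v) + 0)
    odd-case : ∀ u v → total pos neg u v ≡ 1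
    odd-case pos pos = refl
    odd-case pos neg = refl
    odd-case neg pos = refl
    odd-case neg neg = refl
    even-case : ∀ u v → v ≡ neg · u → total pos pos u v ≡ 0
    even-case pos _ refl = refl
    even-case neg _ refl = refl
    opposite : neg ^ˢ q ≡ pos → v ≡ neg · u
    opposite even = trans (sym (parity e)) (trans flipped (cong (neg ·_) (parity d)))
      where
      flipped : (neg ^ˢ j) ^ˢ e ≡ neg · ((neg ^ˢ j) ^ˢ d)
      flipped = begin
        (neg ^ˢ j) ^ˢ e                        ≡⟨ ^ˢ-* neg e j ⟨
        neg ^ˢ (e * j)                         ≡⟨ cong (_· (neg ^ˢ (e * j))) (trans (cong (neg ^ˢ_) (ℕP.*-comm q i)) (trans (^ˢ-* neg i q) (trans (cong (_^ˢ i) even) (pos-^ˢ i)))) ⟨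
        (neg ^ˢ (q * i)) · (neg ^ˢ (e * j))    ≡⟨ ^ˢ-+ neg (q * i) (e * j) ⟨
        neg ^ˢ (q * i + e * j)                 ≡⟨ cong (neg ^ˢ_) rel ⟩
        neg · (neg ^ˢ (d * j))                 ≡⟨ cong (neg ·_) (^ˢ-* neg d j) ⟩
        neg · ((neg ^ˢ j) ^ˢ d)                ∎
        where open ≡-Reasoning
      odd-j : neg ^ˢ j ≡ neg
      odd-j = ≢pos⇒neg _ (λ eq → pos≢neg (trans (sym (trans (cong (_^ˢ e) eq) (pos-^ˢ e)))
        (trans flipped (cong (neg ·_) (trans (cong (_^ˢ d) eq) (pos-^ˢ d))))))
      parity : ∀ x → (neg ^ˢ j) ^ˢ x ≡ neg ^ˢ x
      parity x = cong (_^ˢ x) odd-j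
    -- If q is odd, s ↦ s^q is the identity and each side counts one sign; if q is even, it is
    -- constant and neither side counts any.
    by-parity : ∀ r → neg ^ˢ q ≡ r → total (pos ^ˢ q) (neg ^ˢ q) u v ≡ ∑ℕ.∑ signs (λ s → 𝟙 ((s ^ˢ q) ≟ˢ neg))
    by-parity pos eq rewrite pos-^ˢ q | eq = even-case u v (opposite eq)
    by-parity neg eq rewrite pos-^ˢ q | eq = odd-case u v

  inverse-mod : ∀ q j → gcd q (suc j) ≡ 1 → ∃ λ x → (q * x) % suc j ≡ 1 % suc j
  inverse-mod q j co with coprime-Bézout (gcd≡1⇒coprime co)
  ... | Bézout.+- x y eq = x , trans (cong (_% suc j) (trans (ℕP.*-comm q x) (sym eq))) ([m+kn]%n≡m%n 1 y (suc j))
  -- Here q x is -1 modulo j + 1, and so is `j`; hence the inverse is x j.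
  ... | Bézout.-+ x y eq = x * j , (begin
        (q * (x * j)) % suc j                  ≡⟨ [m+kn]%n≡m%n (q * (x * j)) y (suc j) ⟨
        (q * (x * j) + y * suc j) % suc j      ≡⟨ cong (λ z → (q * (x * j) + z) % suc j) eq ⟨
        (q * (x * j) + (1 + x * q)) % suc j    ≡⟨ cong (_% suc j) (solve 3 (λ q x j → q :* (x :* j) :+ (con 1 :+ x :* q) := con 1 :+ (x :* q) :* (con 1 :+ j)) refl q x j) ⟩
        (1 + (x * q) * suc j) % suc j          ≡⟨ [m+kn]%n≡m%n 1 (x * q) (suc j) ⟩
        1 % suc j                              ∎)
    where
    open ≡-Reasoning
    open ℕSolver.+-*-Solver using (solve; _:+_; _:*_; _:=_; con)

  *-mod-congˡ : ∀ a {b c} j → b % suc j ≡ c % suc j → (a * b) % suc j ≡ (a * c) % suc j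
  *-mod-congˡ a {b} {c} j eq = trans (%-distribˡ-* a b (suc j))
    (trans (cong (λ z → ((a % suc j) * z) % suc j) eq) (sym (%-distribˡ-* a c (suc j))))

  inverse-mod-unique : ∀ q j x y → (q * x) % suc j ≡ 1 % suc j → (q * y) % suc j ≡ 1 % suc j →
    x % suc j ≡ y % suc j
  inverse-mod-unique q j x y p r = begin
    x % suc j               ≡⟨ cong (_% suc j) (ℕP.*-identityʳ x) ⟨
    (x * 1) % suc j         ≡⟨ *-mod-congˡ x j r ⟨
    (x * (q * y)) % suc j   ≡⟨ cong (_% suc j) (solve 3 (λ x q y → x :* (q :* y) := y :* (q :* x)) refl x q y) ⟩
    (y * (q * x)) % suc j   ≡⟨ *-mod-congˡ y j p ⟩
    (y * 1) % suc j         ≡⟨ cong (_% suc j) (ℕP.*-identityʳ y) ⟩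
    y % suc j               ∎
    where
    open ≡-Reasoning
    open ℕSolver.+-*-Solver using (solve; _:*_; _:=_)

  -- The congruence as an exact equation. Its quotients count the turns which `red` converts into
  -- powers of θ, and `sign-count` compares their parities.
  mod-relation : ∀ a j → a % suc j ≡ 1 % suc j → a + (1 / suc j) * suc j ≡ 1 + (a / suc j) * suc j
  mod-relation a j eq = begin
    a + e * suc j                          ≡⟨ cong (_+ e * suc j) (m≡m%n+[m/n]*n a (suc j)) ⟩
    (a % suc j + d * suc j) + e * suc j    ≡⟨ cong (λ r → (r + d * suc j) + e * suc j) eq ⟩
    (1 % suc j + d * suc j) + e * suc j    ≡⟨ solve 3 (λ r x y → (r :+ x) :+ y := (r :+ y) :+ x) refl (1 % suc j) (d * suc j) (e * suc j) ⟩
    (1 % suc j + e * suc j) + d * suc j    ≡⟨ cong (_+ d * suc j) (m≡m%n+[m/n]*n 1 (suc j)) ⟨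
    1 + d * suc j                          ∎
    where
    open ≡-Reasoning
    open ℕSolver.+-*-Solver using (solve; _:+_; _:=_)
    d = a / suc j
    e = 1 / suc j

  _≟ᴸ_ : DecidableEquality Label
  _≟ᴸ_ = ProdP.≡-dec ℕ._≟_ _≟ˢ_

  -- For a = s·gⁱ this says a^q = g on a cycle of type `t`. The right side is reduced too because on
  -- a cycle of length 1 the normal form of g is θ.
  root? : ∀ q t → Decidable (λ (a : Label) → red t (q * proj₁ a , proj₂ a ^ˢ q) ≡ red t (1 , pos))
  root? q t (i , s) = red t (q * i , s ^ˢ q) ≟ᴸ red t (1 , pos)

  -- The exponent must be an inverse of q modulo the length: it exists only in the coprime case and
  -- is then unique among the labels. `sign-count` then counts the signs that go with it.
  root-count : ∀ q t → # (root? q t) (labels t) ≡ (if gcd q (size t) ≡ᵇ 1 then rootsZ2 q (proj₂ t) else 0)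
  root-count q t@(j , θ) = trans (#≡∑ (root? q t) (labels t)) (trans (∑ℕ.∑-product (upTo (suc j)) signs (λ a → 𝟙 (root? q t a))) by-gcd)
    where
    row : ℕ → ℕ
    row i = ∑ℕ.∑ signs (λ s → 𝟙 (root? q t (i , s)))
    row-yes : ∀ i → (q * i) % suc j ≡ 1 % suc j → row i ≡ rootsZ2 q θ
    row-yes i eq = trans (∑ℕ.∑-cong signs (λ s → 𝟙-cong (root? q t (i , s)) (_ ≟ˢ _) ,-injectiveʳ (cong₂ _,_ eq)))
      (sign-count q i (suc j) θ ((q * i) / suc j) (1 / suc j) (mod-relation (q * i) j eq))
    row-no : ∀ i → (q * i) % suc j ≢ 1 % suc j → row i ≡ 0
    row-no i ne = ∑ℕ.∑-zero signs (λ s _ → 𝟙-no (root? q t (i , s)) (ne ∘ ,-injectiveˡ))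
    coprime-if : ∀ i → (q * i) % suc j ≡ 1 % suc j → gcd q (suc j) ≡ 1
    coprime-if i eq = ∣1⇒≡1 (∣m+n∣m⇒∣n
      (subst (gcd q (suc j) ∣_) (trans (mod-relation (q * i) j eq) (ℕP.+-comm 1 _))
        (∣m∣n⇒∣m+n (∣m⇒∣m*n i (gcd[m,n]∣m q (suc j))) (∣n⇒∣m*n (1 / suc j) (gcd[m,n]∣n q (suc j)))))
      (∣n⇒∣m*n ((q * i) / suc j) (gcd[m,n]∣n q (suc j))))
    by-gcd : ∑ℕ.∑ (upTo (suc j)) row ≡ (if gcd q (suc j) ≡ᵇ 1 then rootsZ2 q θ else 0)
    by-gcd with gcd q (suc j) ≡ᵇ 1 in eq
    ... | false = ∑ℕ.∑-zero (upTo (suc j)) (λ i _ → row-no i (λ p →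
            subst T (trans (sym (cong (_≡ᵇ 1) (coprime-if i p))) eq) tt))
    ... | true with inverse-mod q j (ℕP.≡ᵇ⇒≡ _ 1 (subst T (sym eq) tt))
    ...   | x , p = trans (∑ℕ.∑-single row (UniqueP.upTo⁺ (suc j)) (∈-upTo⁺ (m%n<n x (suc j)))
              (λ i i∈ i≢ → row-no i (λ r → i≢ (trans (sym (m<n⇒m%n≡m (∈-upTo⁻ i∈))) (inverse-mod-unique q j i x r p)))))
              (row-yes (x % suc j) (trans (*-mod-congˡ q j (m%n%n≡m%n x (suc j))) p))

  -- The condition hᵏ = g.

  valid : ℕ → Ty → ℕ → Bool
  valid k t i = ⌊ suc i ∣? k ⌋ ∧ (gcd (suc i) (size t) ≡ᵇ 1)

  -- At most the divisor k/m contributes. The sum over all divisors is kept so that it can be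
  -- compared with the sum over h in the exponent; `suc i` is that h.
  κroots : ℕ → Ty → ℕ → ℕ
  κroots k t m = ∑ℕ.∑ (upTo k) (λ i → if valid k t i ∧ ((k / suc i) ≡ᵇ m) then rootsZ2 (suc i) (proj₂ t) else 0)

  T-⌊⌋⁻ : {A : Set} (d : Dec A) → T ⌊ d ⌋ → A
  T-⌊⌋⁻ (yes a) _ = a

  T-⌊⌋⁺ : {A : Set} (d : Dec A) → A → T ⌊ d ⌋
  T-⌊⌋⁺ (yes _) _ = tt
  T-⌊⌋⁺ (no ¬a) a = ⊥-elim (¬a a)

  if-no : {A : Set} {b : Bool} {x y : A} → ¬ T b → (if b then x else y) ≡ y
  if-no {b = true}  ¬t = ⊥-elim (¬t tt)
  if-no {b = false} ¬t = refl

  if-yes : {A : Set} {b : Bool} {x y : A} → T b → (if b then x else y) ≡ x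
  if-yes {b = true} _ = refl

  κroots-div : ∀ k → 1 ≤ k → ∀ t m → suc m ∣ k →
    κroots k t (suc m) ≡ (if gcd (k / suc m) (size t) ≡ᵇ 1 then rootsZ2 (k / suc m) (proj₂ t) else 0)
  κroots-div k 1≤k t m m∣k@(divides zero refl) = ⊥-elim (ℕP.1+n≰n 1≤k)
  κroots-div k 1≤k t m m∣k@(divides (suc q) refl) =
    trans (∑ℕ.∑-single f (UniqueP.upTo⁺ k) (∈-upTo⁺ (ℕP.m≤m*n (suc q) (suc m))) others)
      (trans at-q (cong (λ z → if gcd z (size t) ≡ᵇ 1 then rootsZ2 z (proj₂ t) else 0) (sym (m*n/n≡m (suc q) (suc m)))))
    where
    f : ℕ → ℕ
    f i = if valid k t i ∧ ((k / suc i) ≡ᵇ suc m) then rootsZ2 (suc i) (proj₂ t) else 0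
    div-q : k / suc q ≡ suc m
    div-q = trans (cong (λ z → z / suc q) (ℕP.*-comm (suc q) (suc m))) (m*n/n≡m (suc m) (suc q))
    at-q : f q ≡ (if gcd (suc q) (size t) ≡ᵇ 1 then rootsZ2 (suc q) (proj₂ t) else 0)
    at-q with suc q ∣? k
    ... | no ¬d = ⊥-elim (¬d (divides (suc m) (ℕP.*-comm (suc q) (suc m))))
    ... | yes _ with gcd (suc q) (size t) ≡ᵇ 1
    ...   | false = refl
    ...   | true rewrite div-q = if-yes (ℕP.≡⇒≡ᵇ m m refl)
    others : ∀ i → i ∈ upTo k → i ≢ q → f i ≡ 0
    others i _ i≢q = if-no (λ t′ → i≢q (ℕP.suc-injective (ℕP.*-cancelʳ-≡ (suc i) (suc q) (suc m)
      (let (v , e) = Equivalence.to (T-∧ {valid k t i}) t′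
           i∣k = T-⌊⌋⁻ (suc i ∣? k) (proj₁ (Equivalence.to (T-∧ {⌊ suc i ∣? k ⌋}) v))
       in trans (ℕP.*-comm (suc i) (suc m)) (trans (cong (_* suc i) (sym (ℕP.≡ᵇ⇒≡ (k / suc i) (suc m) e))) (m/n*n≡m i∣k))))))

  κroots-¬div : ∀ k t m → ¬ suc m ∣ k → κroots k t (suc m) ≡ 0
  κroots-¬div k t m ¬m∣k = ∑ℕ.∑-zero (upTo k) (λ i _ → if-no (λ t′ → ¬m∣k
    (let (v , e) = Equivalence.to (T-∧ {valid k t i}) t′
         i∣k = T-⌊⌋⁻ (suc i ∣? k) (proj₁ (Equivalence.to (T-∧ {⌊ suc i ∣? k ⌋}) v))
     in divides (suc i) (trans (sym (m/n*n≡m i∣k)) (trans (cong (_* suc i) (ℕP.≡ᵇ⇒≡ (k / suc i) (suc m) e)) (ℕP.*-comm (suc m) (suc i)))))))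

  rootCondition : ∀ {n} (g : SignedMap n) k → 1 ≤ k → Condition g (κroots k)
  rootCondition g k 1≤k = record
    { P       = λ h → h ^ᴮ k ≡ g
    ; P?      = λ h → (h ^ᴮ k) ≟ᴮ g
    ; G       = λ h x → iter (app h) k x ≡ app g x
    ; OK      = λ t m a → suc m ∣ k × red t ((k / suc m) * proj₁ a , proj₂ a ^ˢ (k / suc m)) ≡ red t (1 , pos)
    ; OK?     = λ t m a → (suc m ∣? k) ×-dec root? (k / suc m) t a
    ; κ-OK    = κ-OK′
    ; P⇒Comm  = λ { h refl x → trans (cong (app h) (app-^ h k x)) (trans (sym (iter-comm (app h) (app h) (λ _ → refl) k x)) (sym (app-^ h k (app h x)))) }
    ; P⇒G     = λ { h refl x → sym (app-^ h k x) }
    ; G⇒P     = λ h _ all → app-ext (h ^ᴮ k) g (λ x → trans (app-^ h k x) (all x))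
    ; G-iter  = λ h i x c gx → trans (iter-comm (app h) (iter (app h) i) (λ y → sym (iter-comm (app h) (app h) (λ _ → refl) i y)) k x)
                  (trans (cong (iter (app h) i) gx) (iter-comm (app h) (app g) c i x))
    ; G-act   = λ h a x c gx → trans (iter-comm (app h) (act a) (act-app h c a) k x) (trans (cong (act a) gx) (act-comm a (1 , pos) x))
    ; closing = closing′
    }
    where
    open Action g
    κ-OK′ : ∀ t m → # (λ a → (suc m ∣? k) ×-dec root? (k / suc m) t a) (labels t) ≡ κroots k t (suc m)
    κ-OK′ t m = by-cases (suc m ∣? k)
      where
      by-cases : (d : Dec (suc m ∣ k)) → # (λ a → d ×-dec root? (k / suc m) t a) (labels t) ≡ κroots k t (suc m)
      by-cases d@(yes m∣k) = trans (#-cong (λ a → d ×-dec root? (k / suc m) t a) (root? (k / suc m) t) (labels t) (λ _ _ → proj₂) (λ _ _ → m∣k ,_))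
        (trans (root-count (k / suc m) t) (sym (κroots-div k 1≤k t m m∣k)))
      by-cases d@(no ¬m∣k) = trans (#-none (λ a → d ×-dec root? (k / suc m) t a) (labels t) (λ _ _ p → ¬m∣k (proj₁ p)))
        (sym (κroots-¬div k t m ¬m∣k))

    closing′ : ∀ h t s m a → Comm h → OfType (t , s) → Free (t , s) →
        (∀ i → 0 < i → i ≤ m → ∀ b c → act b (iter (app h) i s) ≢ act c s) →
        iter (app h) (suc m) s ≡ act a s →
        (iter (app h) k s ≡ app g s → suc m ∣ k × red t ((k / suc m) * proj₁ a , proj₂ a ^ˢ (k / suc m)) ≡ red t (1 , pos)) ×
        (suc m ∣ k × red t ((k / suc m) * proj₁ a , proj₂ a ^ˢ (k / suc m)) ≡ red t (1 , pos) → iter (app h) k s ≡ app g s)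
    closing′ h t s m (i , σ) cm ty free fresh ret = to , from
      where
      -- One passage through the cycle of h multiplies `s` by the label a, and h commutes with a, so
      -- q passages multiply by a^q.
      turns : ∀ q → iter (app h) (q * suc m) s ≡ act (q * i , σ ^ˢ q) s
      turns zero    = refl
      turns (suc q) = trans (iter-+ (app h) (suc m) (q * suc m) s)
        (trans (cong (iter (app h) (suc m)) (turns q))
        (trans (iter-comm (app h) (act (q * i , σ ^ˢ q)) (act-app h cm (q * i , σ ^ˢ q)) (suc m) s)
        (trans (cong (act (q * i , σ ^ˢ q)) ret)
        (trans (act-comm (q * i , σ ^ˢ q) (i , σ) s) (act-act i σ (q * i) (σ ^ˢ q) s)))))
      q = k / suc m
      r = k % suc m
      split : iter (app h) k s ≡ act (q * i , σ ^ˢ q) (iter (app h) r s)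
      split = trans (cong (λ z → iter (app h) z s) (m≡m%n+[m/n]*n k (suc m)))
        (trans (iter-+ (app h) r (q * suc m) s) (trans (cong (iter (app h) r) (turns q))
               (iter-comm (app h) (act (q * i , σ ^ˢ q)) (act-app h cm (q * i , σ ^ˢ q)) r s)))
      -- With remainder r, hᵏ s = a^q (hʳ s) is to equal g s; so hʳ s would lie on the g-cycle of
      -- `s` up to sign, before the first return, unless r = 0.
      divisible : iter (app h) k s ≡ app g s → suc m ∣ k
      divisible gs with r ℕ.≟ 0
      ... | yes r≡0 = m%n≡0⇒n∣m k (suc m) r≡0
      ... | no  r≢0 = ⊥-elim (fresh r (ℕP.n≢0⇒n>0 r≢0) (ℕP.≤-pred (m%n<n k (suc m)))
                        (q * i , σ ^ˢ q) (1 , pos) (trans (sym split) gs))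
      whole : suc m ∣ k → iter (app h) k s ≡ act (q * i , σ ^ˢ q) s
      whole d = trans (cong (λ z → iter (app h) z s) (sym (m/n*n≡m d))) (turns q)
      to : iter (app h) k s ≡ app g s → suc m ∣ k × red t (q * i , σ ^ˢ q) ≡ red t (1 , pos)
      to gs = divisible gs , free (q * i , σ ^ˢ q) (1 , pos) (trans (sym (whole (divisible gs))) gs)
      from : suc m ∣ k × red t (q * i , σ ^ˢ q) ≡ red t (1 , pos) → iter (app h) k s ≡ app g s
      from (d , e) = trans (whole d) (trans (sym (act-red t s ty (q * i , σ ^ˢ q))) (trans (cong (λ b → act b s) e) (act-red t s ty (1 , pos))))

  -- The centralizer.

  κall : Ty → ℕ → ℕ
  κall t _ = weightOf t

  #-all : {A : Set} (xs : List A) → # {P = λ _ → ⊤} (λ _ → yes tt) xs ≡ length xs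
  #-all []       = refl
  #-all (x ∷ xs) = cong suc (#-all xs)

  centralizerCondition : ∀ {n} (g : SignedMap n) → Condition g κall
  centralizerCondition g = record
    { P       = λ h → (h ∘ᴮ g) ≡ (g ∘ᴮ h)
    ; P?      = λ h → (h ∘ᴮ g) ≟ᴮ (g ∘ᴮ h)
    ; G       = λ _ _ → ⊤
    ; OK      = λ _ _ _ → ⊤
    ; OK?     = λ _ _ _ → yes tt
    ; κ-OK    = λ t _ → #-all (labels t)
    ; P⇒Comm  = λ h eq x → trans (sym (app-∘ h g x)) (trans (cong (λ w → app w x) eq) (app-∘ g h x))
    ; P⇒G     = λ _ _ _ → tt
    ; G⇒P     = λ h c _ → app-ext _ _ (λ x → trans (app-∘ h g x) (trans (c x) (sym (app-∘ g h x))))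
    ; G-iter  = λ _ _ _ _ _ → tt
    ; G-act   = λ _ _ _ _ _ → tt
    ; closing = λ _ _ _ _ _ _ _ _ _ _ → (λ _ → tt) , (λ _ → tt)
    }

  R-all : ∀ t b → R κall t (suc b) ≡ weightOf t * (suc b * R κall t b)
  Ω-all : ∀ t m b → Ω κall t m b ≡ weightOf t * (suc b * R κall t b)
  R-all t b = Ω-all t 1 b
  Ω-all t m zero    = sym (ℕP.*-identityʳ (weightOf t))
  Ω-all t m (suc b) = trans (cong (λ z → u * r + suc b * (u * z)) (trans (Ω-all t (suc m) b) (sym (R-all t b))))
    (solve 3 (λ u r b → u :* r :+ (con 1 :+ b) :* (u :* r) := u :* ((con 2 :+ b) :* r)) refl u r b)
    where
    open ℕSolver.+-*-Solver using (solve; _:+_; _:*_; _:=_; con)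
    u = weightOf t
    r = R κall t (suc b)

  -- The representative of a conjugacy class and its frame.

  mults : ∀ {m} → ℕ → Vec (ℕ × ℕ) m → List (Ty × ℕ)
  mults j []            = []
  mults j ((a , c) ∷ b) = ((j , pos) , a) ∷ ((j , neg) , c) ∷ mults (suc j) b

  total : List (Ty × ℕ) → ℕ
  total []             = 0
  total ((t , a) ∷ ms) = a * size t + total ms

  total-mults : ∀ {m} j (b : Vec (ℕ × ℕ) m) → total (mults j b) ≡ weight (suc j) b
  total-mults j []            = refl
  total-mults j ((a , c) ∷ b) = trans (sym (ℕP.+-assoc (a * suc j) (c * suc j) _))
    (cong₂ _+_ (trans (sym (ℕP.*-distribʳ-+ (suc j) a c)) (ℕP.*-comm (a + c) (suc j))) (total-mults (suc j) b))

  -- `blocks` with the two classes put into one list of types, so that one induction serves both.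
  layout : List (Ty × ℕ) → ℕ → List (ℕ × Sgn)
  layout []             o = []
  layout ((t , a) ∷ ms) o = cycs (proj₂ t) (size t) a o ++ layout ms (o + a * size t)

  blocks≡layout : ∀ {m} j (b : Vec (ℕ × ℕ) m) o → blocks (suc j) b o ≡ layout (mults j b) o
  blocks≡layout j []            o = refl
  blocks≡layout j ((a , c) ∷ b) o = cong (cycs pos (suc j) a o ++_) (cong (cycs neg (suc j) c (o + a * suc j) ++_)
    (trans (blocks≡layout (suc j) b _) (cong (layout (mults (suc j) b))
      (trans (cong (o +_) (ℕP.*-distribʳ-+ (suc j) a c)) (sym (ℕP.+-assoc o _ _))))))

  length-cyc : ∀ θ o j → length (cyc θ o j) ≡ j
  length-cyc θ o j = trans (length-map _ (upTo j)) (length-applyUpTo id j)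

  length-cycs : ∀ θ j a o → length (cycs θ j a o) ≡ a * j
  length-cycs θ j zero    o = refl
  length-cycs θ j (suc a) o = trans (length-++ (cyc θ o j)) (cong₂ _+_ (length-cyc θ o j) (length-cycs θ j a (o + j)))

  length-layout : ∀ ms o → length (layout ms o) ≡ total ms
  length-layout []             o = refl
  length-layout ((t , a) ∷ ms) o = trans (length-++ (cycs (proj₂ t) (size t) a o))
    (cong₂ _+_ (length-cycs (proj₂ t) (size t) a o) (length-layout ms _))

  nth-++ʳ : {A : Set} (xs ys : List A) (i : ℕ) → nth (xs ++ ys) (length xs + i) ≡ nth ys i
  nth-++ʳ []       ys i = refl
  nth-++ʳ (x ∷ xs) ys i = nth-++ʳ xs ys i

  nth-map-applyUpTo : {A B : Set} (f : A → B) (u : ℕ → A) (ys : List B) (j i : ℕ) → i < j →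
    nth (map f (applyUpTo u j) ++ ys) i ≡ just (f (u i))
  nth-map-applyUpTo f u ys (suc j) zero    _       = refl
  nth-map-applyUpTo f u ys (suc j) (suc i) (s≤s p) = nth-map-applyUpTo f (u ∘ suc) ys j i p

  mults-types-≥ : ∀ {m} j (b : Vec (ℕ × ℕ) m) → All (λ q → j ≤ proj₁ (proj₁ q)) (mults j b)
  mults-types-≥ j []      = []
  mults-types-≥ j (_ ∷ b) = ℕP.≤-refl ∷ ℕP.≤-refl ∷ All.map ℕP.<⇒≤ (mults-types-≥ (suc j) b)

  mults-distinct : ∀ {m} j (b : Vec (ℕ × ℕ) m) → AllPairs (λ p q → proj₁ p ≢ proj₁ q) (mults j b)
  mults-distinct j []      = []
  mults-distinct j (_ ∷ b) =
    ((λ ()) ∷ All.map (λ { p refl → ℕP.1+n≰n p }) (mults-types-≥ (suc j) b)) ∷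
    All.map (λ { p refl → ℕP.1+n≰n p }) (mults-types-≥ (suc j) b) ∷ mults-distinct (suc j) b

  prodR : (Ty → ℕ → ℕ) → List (Ty × ℕ) → ℕ
  prodR κ ms = product (map (λ (t , a) → R κ t a) ms)

  module Representative {n′ : ℕ} (b : Vec (ℕ × ℕ) (suc n′)) (wt : weight 1 b ≡ suc n′) where
    private
      g = rep b
      entries = blocks 1 b 0
    open Action g

    -- Reduction modulo n makes this total on ℕ; positions below n are unchanged by it.
    point : ℕ → Pt (suc n′)
    point i = i mod (suc n′) , pos

    toℕ-mod : ∀ {i} → i < suc n′ → toℕ (i mod (suc n′)) ≡ i
    toℕ-mod {i} i< = trans (FinP.toℕ-fromℕ< _) (m<n⇒m%n≡m i<)

    toEntry-just : ∀ (i : Fin (suc n′)) x s → x < suc n′ → toEntry i (just (x , s)) ≡ (x mod (suc n′) , s)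
    toEntry-just i x s x< with x ℕP.<? (suc n′)
    ... | yes p = cong (_, s) (FinP.toℕ-injective (trans (FinP.toℕ-fromℕ< p) (sym (toℕ-mod x<))))
    ... | no ¬p = ⊥-elim (¬p x<)

    app-point : ∀ i x s → i < suc n′ → x < suc n′ → nth entries i ≡ just (x , s) → app g (point i) ≡ s ⊙ point x
    app-point i x s i< x< eq = trans (lookup∘tabulate (λ k → toEntry k (nth entries (toℕ k))) (i mod (suc n′)))
      (trans (cong (λ k → toEntry (i mod (suc n′)) (nth entries k)) (toℕ-mod i<))
      (trans (cong (toEntry (i mod (suc n′))) eq)
      (trans (toEntry-just (i mod (suc n′)) x s x<) (cong (x mod (suc n′) ,_) (sym (·-identityʳ s))))))

    length-entries : length entries ≡ suc n′
    length-entries = trans (cong length (blocks≡layout 0 b 0)) (trans (length-layout (mults 0 b) 0) (trans (total-mults 0 b) wt))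

    module _ (t : Ty) (pre rest : List (ℕ × Sgn)) (o : ℕ) (at : length pre ≡ o)
             (here-cyc : entries ≡ pre ++ cyc (proj₂ t) o (size t) ++ rest) where
      private
        j′ = proj₁ t
        j = size t
        θ = proj₂ t

      -- Keeps the entries of the cycle within range, where `toEntry` does not fall back on its
      -- default.
      fits : o + j ≤ suc n′
      fits = begin
        o + j                               ≤⟨ ℕP.m≤m+n (o + j) (length rest) ⟩
        o + j + length rest                 ≡⟨ ℕP.+-assoc o j _ ⟩
        o + (j + length rest)               ≡⟨ cong₂ (λ x y → x + (y + length rest)) at (length-cyc θ o j) ⟨
        length pre + (length (cyc θ o j) + length rest) ≡⟨ cong (length pre +_) (length-++ (cyc θ o j)) ⟨
        length pre + length (cyc θ o j ++ rest) ≡⟨ length-++ pre ⟨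
        length (pre ++ cyc θ o j ++ rest)   ≡⟨ cong length here-cyc ⟨
        length entries                      ≡⟨ length-entries ⟩
        (suc n′) ∎
        where open ℕP.≤-Reasoning

      entry : ∀ i → i < j → nth entries (o + i) ≡ just (if suc i <ᵇ j then (o + suc i , pos) else (o , θ))
      entry i i<j = trans (cong₂ (λ es k → nth es (k + i)) here-cyc (sym at))
        (trans (nth-++ʳ pre _ i) (nth-map-applyUpTo _ id rest j i i<j))

      iter-point : ∀ i → i < j → iter (app g) i (point o) ≡ point (o + i)
      iter-point zero    _    = cong point (sym (ℕP.+-identityʳ o))
      iter-point (suc i) si<j = trans (cong (app g) (iter-point i (ℕP.<-trans (ℕP.n<1+n i) si<j)))
        (app-point (o + i) (o + suc i) pos (ℕP.<-≤-trans (ℕP.+-monoʳ-< o (ℕP.<-trans (ℕP.n<1+n i) si<j)) fits)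
          (ℕP.<-≤-trans (ℕP.+-monoʳ-< o si<j) fits)
          (trans (entry i (ℕP.<-trans (ℕP.n<1+n i) si<j)) (cong just (if-yes (ℕP.<⇒<ᵇ si<j)))))

      OfType-point : OfType (t , point o)
      OfType-point = trans (cong (app g) (iter-point j′ (ℕP.n<1+n j′)))
        (app-point (o + j′) o θ (ℕP.<-≤-trans (ℕP.+-monoʳ-< o (ℕP.n<1+n j′)) fits)
          (ℕP.<-≤-trans (ℕP.m<m+n o (s≤s z≤n)) fits)
          (trans (entry j′ (ℕP.n<1+n j′)) (cong just (if-no (λ p → ℕP.n≮n j (ℕP.<ᵇ⇒< j j p))))))

      orb-point : orb (t , point o) ≡ pairs (λ i → point (o + i)) j
      orb-point = trans (orb≡pairs (point o) id j) (pairs-cong< iter-point)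
        where
        pairs-cong< : ∀ {u v m} → (∀ i → i < m → u i ≡ v i) → pairs u m ≡ pairs v m
        pairs-cong< {m = zero}  eq = refl
        pairs-cong< {m = suc m} eq = cong₂ _++_ (cong pair (eq 0 (s≤s z≤n))) (pairs-cong< (λ i p → eq (suc i) (s≤s p)))

    pairs-+ : ∀ u m k → pairs u (m + k) ≡ pairs u m ++ pairs (λ i → u (m + i)) k
    pairs-+ u zero    k = refl
    pairs-+ u (suc m) k = cong (pair (u 0) ++_) (pairs-+ (u ∘ suc) m k)

    pairs-shift : ∀ o m k → pairs (λ i → point (o + i)) (m + k) ≡
      pairs (λ i → point (o + i)) m ++ pairs (λ i → point (o + m + i)) k
    pairs-shift o m k = trans (pairs-+ _ m k) (cong (pairs _ m ++_) (pairs-cong (λ i → cong point (sym (ℕP.+-assoc o m i))) k))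

    bases : Ty → ℕ → ℕ → List (Pt (suc n′))
    bases t zero    o = []
    bases t (suc a) o = point o ∷ bases t a (o + size t)

    groups : List (Ty × ℕ) → ℕ → List (Ty × List (Pt (suc n′)))
    groups []             o = []
    groups ((t , a) ∷ ms) o = (t , bases t a o) ∷ groups ms (o + a * size t)

    flatten : List (Ty × List (Pt (suc n′))) → List (Ty × Pt (suc n′))
    flatten = concatMap (λ (t , xs) → map (t ,_) xs)

    bases-orbits : ∀ t a pre rest o → length pre ≡ o → entries ≡ pre ++ cycs (proj₂ t) (size t) a o ++ rest →
      All OfType (map (t ,_) (bases t a o)) ×
      concatMap orb (map (t ,_) (bases t a o)) ≡ pairs (λ i → point (o + i)) (a * size t)
    bases-orbits t zero    pre rest o at eq = [] , refl
    bases-orbits t (suc a) pre rest o at eq = OfType-point t pre rest′ o at eq′ ∷ proj₁ ih ,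
      trans (cong₂ _++_ (orb-point t pre rest′ o at eq′) (proj₂ ih)) (sym (pairs-shift o (size t) (a * size t)))
      where
      c = cyc (proj₂ t) o (size t)
      rest′ = cycs (proj₂ t) (size t) a (o + size t) ++ rest
      eq′ : entries ≡ pre ++ c ++ rest′
      eq′ = trans eq (cong (pre ++_) (++-assoc c _ rest))
      ih = bases-orbits t a (pre ++ c) rest (o + size t)
        (trans (length-++ pre) (cong₂ _+_ at (length-cyc (proj₂ t) o (size t))))
        (trans eq′ (sym (++-assoc pre c rest′)))

    -- Consecutive blocks occupy consecutive positions, so their orbits concatenate to the signed
    -- points in their natural order.
    groups-orbits : ∀ ms pre o → length pre ≡ o → entries ≡ pre ++ layout ms o →
      All OfType (flatten (groups ms o)) × concatMap orb (flatten (groups ms o)) ≡ pairs (λ i → point (o + i)) (total ms)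
    groups-orbits []             pre o at eq = [] , refl
    groups-orbits ((t , a) ∷ ms) pre o at eq =
      AllP.++⁺ (proj₁ first) (proj₁ ih) ,
      trans (concatMap-++ orb (map (t ,_) (bases t a o)) _)
        (trans (cong₂ _++_ (proj₂ first) (proj₂ ih)) (sym (pairs-shift o (a * size t) (total ms))))
      where
      c = cycs (proj₂ t) (size t) a o
      first = bases-orbits t a pre (layout ms (o + a * size t)) o at eq
      ih = groups-orbits ms (pre ++ c) (o + a * size t)
        (trans (length-++ pre) (cong₂ _+_ at (length-cycs (proj₂ t) (size t) a o)))
        (trans eq (sym (++-assoc pre c _)))

    allPts≡pairs : allPts (suc n′) ≡ pairs point (suc n′)
    allPts≡pairs = go id point (λ i → cong (_, pos) (FinP.toℕ-injective (toℕ-mod (FinP.toℕ<n i))))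
      where
      go : ∀ {m} (f : Fin m → Fin (suc n′)) (u : ℕ → Pt (suc n′)) → (∀ i → u (toℕ i) ≡ (f i , pos)) →
        cartesianProduct (List.tabulate f) signs ≡ pairs u m
      go {zero}  f u eq = refl
      go {suc m} f u eq = cong₂ (λ x xs → pair x ++ xs) (sym (eq Fin.zero)) (go (f ∘ Fin.suc) (u ∘ suc) (eq ∘ Fin.suc))

    frame : Frame (flatten (groups (mults 0 b) 0))
    frame = proj₁ orbits , ↭-reflexive (trans (proj₂ orbits)
        (trans (cong (pairs point) (trans (total-mults 0 b) wt)) (sym allPts≡pairs)))
      where orbits = groups-orbits (mults 0 b) [] 0 refl (blocks≡layout 0 b 0)

    length-bases : ∀ t a o → length (bases t a o) ≡ a
    length-bases t zero    o = refl
    length-bases t (suc a) o = cong suc (length-bases t a _)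

    groups-distinct : ∀ ms o → AllPairs (λ p q → proj₁ p ≢ proj₁ q) ms → AllPairs (λ p q → proj₁ p ≢ proj₁ q) (groups ms o)
    groups-distinct []             o _        = []
    groups-distinct ((t , a) ∷ ms) o (p ∷ d) = go ms _ p ∷ groups-distinct ms _ d
      where
      go : ∀ ms o → All (λ q → t ≢ proj₁ q) ms → All (λ q → t ≢ proj₁ q) (groups ms o)
      go []       o []      = []
      go (_ ∷ ms) o (p ∷ d) = p ∷ go ms _ d

    product-groups : ∀ κ ms o → product (map (λ (t , xs) → R κ t (length xs)) (groups ms o)) ≡ prodR κ ms
    product-groups κ []             o = refl
    product-groups κ ((t , a) ∷ ms) o = cong₂ _*_ (cong (R κ t) (length-bases t a o)) (product-groups κ ms _)

  count-rep : ∀ {n} (b : Vec (ℕ × ℕ) n) → weight 1 b ≡ n → ∀ {κ} (cond : Condition (rep b) κ) →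
    # (Condition.P? cond) (Bn n) ≡ prodR κ (mults 0 b)
  count-rep []      _  cond = Counting.count-groups cond [] [] ([] , ↭-refl)
  count-rep (x ∷ b) wt cond = trans
    (Counting.count-groups cond (groups (mults 0 (x ∷ b)) 0) (groups-distinct _ 0 (mults-distinct 0 (x ∷ b))) frame)
    (product-groups _ (mults 0 (x ∷ b)) 0)
    where open Representative (x ∷ b) wt

  rootsB-rep : ∀ {n} (b : Vec (ℕ × ℕ) n) → weight 1 b ≡ n → ∀ k → 1 ≤ k →
    rootsB n k (rep b) ≡ prodR (κroots k) (mults 0 b)
  rootsB-rep b wt k 1≤k = count-rep b wt (rootCondition (rep b) k 1≤k)

  centralizer-rep : ∀ {n} (b : Vec (ℕ × ℕ) n) → weight 1 b ≡ n →
    centralizer n (rep b) ≡ prodR κall (mults 0 b)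
  centralizer-rep b wt = count-rep b wt (centralizerCondition (rep b))

open RootCounting

-- Fractions of natural numbers.

module GeneratingFunctions where
  open import Data.Rational using (_+_; _*_)
  open ∑ℚ

  private variable
    N : ℕ

  abstract
    -- Kept abstract, so that later computations use only the laws proved in this block.
    ι : ℕ → ℚ
    ι a = a ÷ 1

    ι-+ : ∀ a b → ι (a ℕ.+ b) ≡ ι a + ι b
    ι-+ a b = ℚP.toℚᵘ-injective (begin
      ℚ.toℚᵘ (ι (a ℕ.+ b))                ≈⟨ ℚP.toℚᵘ-fromℚᵘ (mkℚᵘ (int (a ℕ.+ b)) 0) ⟩
      mkℚᵘ (int (a ℕ.+ b)) 0                ≈⟨ *≡* (cong (λ z → z ℤ.* int 1) (trans (ℤP.pos-+ a b) (sym (cong₂ ℤ._+_ (ℤP.*-identityʳ (int a)) (ℤP.*-identityʳ (int b)))))) ⟩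
      mkℚᵘ (int a) 0 ℚᵘ.+ mkℚᵘ (int b) 0      ≈⟨ ℚᵘP.+-cong (ℚP.toℚᵘ-fromℚᵘ (mkℚᵘ (int a) 0)) (ℚP.toℚᵘ-fromℚᵘ (mkℚᵘ (int b) 0)) ⟨
      ℚ.toℚᵘ (ι a) ℚᵘ.+ ℚ.toℚᵘ (ι b)      ≈⟨ ℚP.toℚᵘ-homo-+ (ι a) (ι b) ⟨
      ℚ.toℚᵘ (ι a + ι b)                  ∎)
      where open ℚᵘP.≃-Reasoning

    ι-* : ∀ a b → ι (a ℕ.* b) ≡ ι a * ι b
    ι-* a b = ℚP.toℚᵘ-injective (begin
      ℚ.toℚᵘ (ι (a ℕ.* b))                ≈⟨ ℚP.toℚᵘ-fromℚᵘ (mkℚᵘ (int (a ℕ.* b)) 0) ⟩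
      mkℚᵘ (int (a ℕ.* b)) 0                ≈⟨ *≡* (cong (λ z → z ℤ.* int 1) (ℤP.pos-* a b)) ⟩
      mkℚᵘ (int a) 0 ℚᵘ.* mkℚᵘ (int b) 0      ≈⟨ ℚᵘP.*-cong (ℚP.toℚᵘ-fromℚᵘ (mkℚᵘ (int a) 0)) (ℚP.toℚᵘ-fromℚᵘ (mkℚᵘ (int b) 0)) ⟨
      ℚ.toℚᵘ (ι a) ℚᵘ.* ℚ.toℚᵘ (ι b)      ≈⟨ ℚP.toℚᵘ-homo-* (ι a) (ι b) ⟨
      ℚ.toℚᵘ (ι a * ι b)                  ∎)
      where open ℚᵘP.≃-Reasoning

    ÷-ι : ∀ a b → ι (suc b) * (a ÷ suc b) ≡ ι a
    ÷-ι a b = ℚP.toℚᵘ-injective (begin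
      ℚ.toℚᵘ (ι (suc b) * (a ÷ suc b))            ≈⟨ ℚP.toℚᵘ-homo-* (ι (suc b)) (a ÷ suc b) ⟩
      ℚ.toℚᵘ (ι (suc b)) ℚᵘ.* ℚ.toℚᵘ (a ÷ suc b)  ≈⟨ ℚᵘP.*-cong (ℚP.toℚᵘ-fromℚᵘ (mkℚᵘ (int (suc b)) 0)) (ℚP.toℚᵘ-fromℚᵘ (mkℚᵘ (int a) b)) ⟩
      mkℚᵘ (int (suc b)) 0 ℚᵘ.* mkℚᵘ (int a) b          ≈⟨ *≡* (trans (ℤP.*-identityʳ _) (trans (ℤP.*-comm (int (suc b)) (int a)) (cong (λ z → int a ℤ.* int (suc z)) (sym (ℕP.+-identityʳ b))))) ⟩
      mkℚᵘ (int a) 0                                ≈⟨ ℚP.toℚᵘ-fromℚᵘ (mkℚᵘ (int a) 0) ⟨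
      ℚ.toℚᵘ (ι a)                                ∎)
      where open ℚᵘP.≃-Reasoning

    ι-0 : ι 0 ≡ 0ℚ
    ι-0 = refl

    ι-1 : ι 1 ≡ 1ℚ
    ι-1 = refl

  ι-cancel : ∀ b .{{_ : ℕ.NonZero b}} {x y} → ι b * x ≡ ι b * y → x ≡ y
  ι-cancel (suc b) {x} {y} eq = trans (sym (undo x)) (trans (cong ((1 ÷ suc b) *_) eq) (undo y))
    where
    undo : ∀ z → (1 ÷ suc b) * (ι (suc b) * z) ≡ z
    undo z = trans (sym (ℚP.*-assoc (1 ÷ suc b) (ι (suc b)) z))
      (trans (cong (_* z) (trans (ℚP.*-comm (1 ÷ suc b) (ι (suc b))) (trans (÷-ι 1 b) ι-1))) (ℚP.*-identityˡ z))

  ÷-unique : ∀ a b .{{_ : ℕ.NonZero b}} {x} → ι b * x ≡ ι a → a ÷ b ≡ x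
  ÷-unique a b@(suc b′) eq = ι-cancel b (trans (÷-ι a b′) (sym eq))

  ι-÷ : ∀ a b .{{_ : ℕ.NonZero b}} → ι b * (a ÷ b) ≡ ι a
  ι-÷ a (suc b) = ÷-ι a b

  *-leftComm : ∀ x y z → x * (y * z) ≡ y * (x * z)
  *-leftComm x y z = trans (sym (ℚP.*-assoc x y z)) (trans (cong (_* z) (ℚP.*-comm x y)) (ℚP.*-assoc y x z))

  ÷-* : ∀ a b c d .{{_ : ℕ.NonZero b}} .{{_ : ℕ.NonZero d}} → (a ℕ.* c) ÷ (b ℕ.* d) ≡ (a ÷ b) * (c ÷ d)
  ÷-* a b@(suc _) c d@(suc _) = ÷-unique (a ℕ.* c) (b ℕ.* d) (begin
    ι (b ℕ.* d) * ((a ÷ b) * (c ÷ d))       ≡⟨ cong (_* ((a ÷ b) * (c ÷ d))) (ι-* b d) ⟩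
    (ι b * ι d) * ((a ÷ b) * (c ÷ d))       ≡⟨ ℚP.*-assoc (ι b) (ι d) _ ⟩
    ι b * (ι d * ((a ÷ b) * (c ÷ d)))       ≡⟨ cong (ι b *_) (*-leftComm (ι d) (a ÷ b) (c ÷ d)) ⟩
    ι b * ((a ÷ b) * (ι d * (c ÷ d)))       ≡⟨ ℚP.*-assoc (ι b) (a ÷ b) _ ⟨
    (ι b * (a ÷ b)) * (ι d * (c ÷ d))       ≡⟨ cong₂ _*_ (ι-÷ a b) (ι-÷ c d) ⟩
    ι a * ι c                               ≡⟨ ι-* a c ⟨
    ι (a ℕ.* c)                             ∎)
    where open ≡-Reasoning

  -- Sums over ranges and over the divisors of a monomial; the product of series.

  ∑-applyUpTo : {A : Set} (u : ℕ → A) (n : ℕ) (f : A → ℚ) → ∑ (applyUpTo u n) f ≡ ∑ (upTo n) (f ∘ u)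
  ∑-applyUpTo u n f = trans (cong (λ xs → ∑ xs f) (sym (map-applyUpTo id u n))) (∑-map u (upTo n) f)

  ∑-upTo-suc : ∀ n (f : ℕ → ℚ) → ∑ (upTo (suc n)) f ≡ f 0 + ∑ (upTo n) (f ∘ suc)
  ∑-upTo-suc n f = cong (f 0 +_) (∑-applyUpTo suc n f)

  ∑-upTo-snoc : ∀ n (f : ℕ → ℚ) → ∑ (upTo (suc n)) f ≡ ∑ (upTo n) f + f n
  ∑-upTo-snoc n f = trans (cong (λ xs → ∑ xs f) (sym (upTo-∷ʳ n)))
    (trans (∑-++ (upTo n) (n ∷ []) f) (cong (∑ (upTo n) f +_) (ℚP.+-identityʳ (f n))))

  ∑-upTo-extend : ∀ a c (f : ℕ → ℚ) → (∀ m → a ≤ m → f m ≡ 0ℚ) → ∑ (upTo (c ℕ.+ a)) f ≡ ∑ (upTo a) f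
  ∑-upTo-extend a zero    f z = refl
  ∑-upTo-extend a (suc c) f z = trans (∑-upTo-snoc (c ℕ.+ a) f)
    (trans (cong₂ _+_ (∑-upTo-extend a c f z) (z (c ℕ.+ a) (ℕP.m≤n+m a c))) (ℚP.+-identityʳ _))

  -- Both sides run over the triangle x + y ≤ a. The induction splits off the row x = 0.
  ∑-triangle : ∀ a (K : ℕ → ℕ → ℚ) →
    ∑ (upTo (suc a)) (λ x → ∑ (upTo (suc (a ∸ x))) (K x)) ≡
    ∑ (upTo (suc a)) (λ y → ∑ (upTo (suc (a ∸ y))) (λ x → K x y))
  ∑-triangle zero    K = refl
  ∑-triangle (suc a) K = begin
    ∑ (upTo (suc (suc a))) (λ x → ∑ (upTo (suc (suc a ∸ x))) (K x))
      ≡⟨ ∑-upTo-suc (suc a) (λ x → ∑ (upTo (suc (suc a ∸ x))) (K x)) ⟩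
    ∑ (upTo (suc (suc a))) (K 0) + ∑ (upTo (suc a)) (λ x → ∑ (upTo (suc (a ∸ x))) (K (suc x)))
      ≡⟨ cong (∑ (upTo (suc (suc a))) (K 0) +_) (trans (∑-triangle a (K ∘ suc)) pad) ⟩
    ∑ (upTo (suc (suc a))) (K 0) + ∑ (upTo (suc (suc a))) (λ y → ∑ (upTo (suc a ∸ y)) (λ x → K (suc x) y))
      ≡⟨ ∑-+ (upTo (suc (suc a))) (K 0) g ⟨
    ∑ (upTo (suc (suc a))) (λ y → K 0 y + ∑ (upTo (suc a ∸ y)) (λ x → K (suc x) y))
      ≡⟨ ∑-cong (upTo (suc (suc a))) (λ y → sym (∑-upTo-suc (suc a ∸ y) (λ x → K x y))) ⟩
    ∑ (upTo (suc (suc a))) (λ y → ∑ (upTo (suc (suc a ∸ y))) (λ x → K x y)) ∎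
    where
    open ≡-Reasoning
    g : ℕ → ℚ
    g y = ∑ (upTo (suc a ∸ y)) (λ x → K (suc x) y)
    -- The additional index y = a + 1 contributes an empty sum.
    pad : ∑ (upTo (suc a)) (λ y → ∑ (upTo (suc (a ∸ y))) (λ x → K (suc x) y)) ≡ ∑ (upTo (suc (suc a))) g
    pad = sym (trans (∑-upTo-snoc (suc a) g) (trans (cong₂ _+_
      (∑-cong∈ (upTo (suc a)) (λ y y∈ → cong (λ z → ∑ (upTo z) (λ x → K (suc x) y)) (ℕP.+-∸-assoc 1 (ℕP.≤-pred (∈-upTo⁻ y∈)))))
      (cong (λ z → ∑ (upTo z) (λ x → K (suc x) (suc a))) (ℕP.n∸n≡0 a)))
      (ℚP.+-identityʳ _)))

  ∑-below : ∀ a c (e : Mono N) (f : Mono (suc N) → ℚ) → ∑ (below ((a , c) ∷ e)) f ≡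
    ∑ (upTo (suc a)) (λ x → ∑ (upTo (suc c)) (λ y → ∑ (below e) (λ d → f ((x , y) ∷ d))))
  ∑-below a c e f = trans
    (∑-concatMap (λ x → concatMap (λ y → map ((x , y) ∷_) (below e)) (upTo (suc c))) (upTo (suc a)) f)
    (∑-cong (upTo (suc a)) (λ x → trans
      (∑-concatMap (λ y → map ((x , y) ∷_) (below e)) (upTo (suc c)) f)
      (∑-cong (upTo (suc c)) (λ y → ∑-map ((x , y) ∷_) (below e) f))))

  -- The pairs of monomials whose product divides `e` form a symmetric set, a product of triangles,
  -- one for each variable.
  ∑-below-swap : ∀ (e : Mono N) (K : Mono N → Mono N → ℚ) →
    ∑ (below e) (λ d → ∑ (below (quot e d)) (K d)) ≡ ∑ (below e) (λ d → ∑ (below (quot e d)) (λ d′ → K d′ d))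
  ∑-below-swap []            K = refl
  ∑-below-swap ((a , c) ∷ e) K = begin
    ∑ (below ((a , c) ∷ e)) (λ d → ∑ (below (quot ((a , c) ∷ e) d)) (K d))
      ≡⟨ expand K ⟩
    ∑ (upTo (suc a)) (λ x → ∑ (upTo (suc (a ∸ x))) (λ x′ → S x x′))
      ≡⟨ ∑-triangle a S ⟩
    ∑ (upTo (suc a)) (λ x → ∑ (upTo (suc (a ∸ x))) (λ x′ → S x′ x))
      ≡⟨ ∑-cong (upTo (suc a)) (λ x → ∑-cong (upTo (suc (a ∸ x))) (λ x′ →
           trans (∑-triangle c (λ y y′ → ∑ (below e) (λ d → ∑ (below (quot e d)) (λ d′ → K ((x′ , y) ∷ d) ((x , y′) ∷ d′))))) (∑-cong (upTo (suc c)) (λ y → ∑-cong (upTo (suc (c ∸ y))) (λ y′ →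
             ∑-below-swap e (λ d d′ → K ((x′ , y′) ∷ d) ((x , y) ∷ d′))))))) ⟩
    ∑ (upTo (suc a)) (λ x → ∑ (upTo (suc (a ∸ x))) (λ x′ → S′ x x′))
      ≡⟨ expand (λ d d′ → K d′ d) ⟨
    ∑ (below ((a , c) ∷ e)) (λ d → ∑ (below (quot ((a , c) ∷ e) d)) (λ d′ → K d′ d)) ∎
    where
    open ≡-Reasoning
    split : (Mono (suc _) → Mono (suc _) → ℚ) → ℕ → ℕ → ℚ
    split K x x′ = ∑ (upTo (suc c)) (λ y → ∑ (upTo (suc (c ∸ y))) (λ y′ →
      ∑ (below e) (λ d → ∑ (below (quot e d)) (λ d′ → K ((x , y) ∷ d) ((x′ , y′) ∷ d′)))))
    S S′ : ℕ → ℕ → ℚ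
    S = split K
    S′ = split (λ d d′ → K d′ d)
    expand : ∀ K → ∑ (below ((a , c) ∷ e)) (λ d → ∑ (below (quot ((a , c) ∷ e) d)) (K d)) ≡
      ∑ (upTo (suc a)) (λ x → ∑ (upTo (suc (a ∸ x))) (λ x′ → split K x x′))
    expand K = trans (∑-below a c e (λ d → ∑ (below (quot ((a , c) ∷ e) d)) (K d))) (∑-cong (upTo (suc a)) (λ x →
      trans (∑-cong (upTo (suc c)) (λ y →
        trans (∑-cong (below e) (λ d → ∑-below (a ∸ x) (c ∸ y) (quot e d) (K ((x , y) ∷ d))))
          (trans (∑-swap (below e) (upTo (suc (a ∸ x))) (λ d x′ → ∑ (upTo (suc (c ∸ y))) (λ y′ → row x y x′ y′ d)))
            (∑-cong (upTo (suc (a ∸ x))) (λ x′ → ∑-swap (below e) (upTo (suc (c ∸ y))) (λ d y′ → row x y x′ y′ d))))))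
        (∑-swap (upTo (suc c)) (upTo (suc (a ∸ x))) (λ y x′ → ∑ (upTo (suc (c ∸ y))) (λ y′ → ∑ (below e) (row x y x′ y′))))))
      where
      row : ℕ → ℕ → ℕ → ℕ → Mono _ → ℚ
      row x y x′ y′ d = ∑ (below (quot e d)) (λ d′ → K ((x , y) ∷ d) ((x′ , y′) ∷ d′))

  ∸-comm : ∀ a b c → a ∸ b ∸ c ≡ a ∸ c ∸ b
  ∸-comm a b c = trans (ℕP.∸-+-assoc a b c) (trans (cong (a ∸_) (ℕP.+-comm b c)) (sym (ℕP.∸-+-assoc a c b)))

  quot-comm : ∀ (e d d′ : Mono N) → quot (quot e d) d′ ≡ quot (quot e d′) d
  quot-comm []            []            []            = refl
  quot-comm ((a , c) ∷ e) ((x , y) ∷ d) ((x′ , y′) ∷ d′) =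
    cong₂ _∷_ (cong₂ _,_ (∸-comm a x x′) (∸-comm c y y′)) (quot-comm e d d′)

  ⊛-cong : ∀ {F F′ G G′ : Ser N} → (∀ e → F e ≡ F′ e) → (∀ e → G e ≡ G′ e) → ∀ e → (F ⊛ G) e ≡ (F′ ⊛ G′) e
  ⊛-cong p q e = ∑-cong (below e) (λ d → cong₂ _*_ (p d) (q (quot e d)))

  -- The form in which commutativity enters `euler-pow`, where `euler F` has to pass a factor `F`.
  ⊛-leftComm : ∀ (F G H : Ser N) e → (F ⊛ (G ⊛ H)) e ≡ (G ⊛ (F ⊛ H)) e
  ⊛-leftComm F G H e = begin
    ∑ (below e) (λ d → F d * ∑ (below (quot e d)) (λ d′ → G d′ * H (quot (quot e d) d′)))
      ≡⟨ ∑-cong (below e) (λ d → ∑-*ˡ (F d) (below (quot e d)) _) ⟩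
    ∑ (below e) (λ d → ∑ (below (quot e d)) (λ d′ → F d * (G d′ * H (quot (quot e d) d′))))
      ≡⟨ ∑-below-swap e (λ d d′ → F d * (G d′ * H (quot (quot e d) d′))) ⟩
    ∑ (below e) (λ d → ∑ (below (quot e d)) (λ d′ → F d′ * (G d * H (quot (quot e d′) d))))
      ≡⟨ ∑-cong (below e) (λ d → ∑-cong (below (quot e d)) (λ d′ →
           trans (*-leftComm (F d′) (G d) _) (cong (λ z → G d * (F d′ * H z)) (quot-comm e d′ d)))) ⟩
    ∑ (below e) (λ d → ∑ (below (quot e d)) (λ d′ → G d * (F d′ * H (quot (quot e d) d′))))
      ≡⟨ ∑-cong (below e) (λ d → ∑-*ˡ (G d) (below (quot e d)) _) ⟨
    ∑ (below e) (λ d → G d * ∑ (below (quot e d)) (λ d′ → F d′ * H (quot (quot e d) d′))) ∎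
    where open ≡-Reasoning

  deg-quot : ∀ (e : Mono N) d → d ∈ below e → deg d ℕ.+ deg (quot e d) ≡ deg e
  deg-quot []            []  _  = refl
  deg-quot ((a , c) ∷ e) d′ d∈ with ∈-concatMap⁻′ (λ x → concatMap (λ y → map ((x , y) ∷_) (below e)) (upTo (suc c))) (upTo (suc a)) d∈
  ... | x , x∈ , p with ∈-concatMap⁻′ (λ y → map ((x , y) ∷_) (below e)) (upTo (suc c)) p
  ...   | y , y∈ , q with ∈-map⁻ ((x , y) ∷_) q
  ...     | d , d∈′ , refl = begin
    (x ℕ.+ y ℕ.+ deg d) ℕ.+ ((a ∸ x) ℕ.+ (c ∸ y) ℕ.+ deg (quot e d))
      ≡⟨ solve 6 (λ x y d x′ y′ d′ → (x :+ y :+ d) :+ (x′ :+ y′ :+ d′) := (x :+ x′) :+ (y :+ y′) :+ (d :+ d′)) refl x y (deg d) (a ∸ x) (c ∸ y) (deg (quot e d)) ⟩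
    (x ℕ.+ (a ∸ x)) ℕ.+ (y ℕ.+ (c ∸ y)) ℕ.+ (deg d ℕ.+ deg (quot e d))
      ≡⟨ cong₂ ℕ._+_ (cong₂ ℕ._+_ (ℕP.m+[n∸m]≡n (ℕP.≤-pred (∈-upTo⁻ x∈))) (ℕP.m+[n∸m]≡n (ℕP.≤-pred (∈-upTo⁻ y∈)))) (deg-quot e d d∈′) ⟩
    a ℕ.+ c ℕ.+ deg e ∎
    where
    open ≡-Reasoning
    open ℕSolver.+-*-Solver using (solve; _:+_; _:=_)

  -- The Euler operator, the sum of t ∂/∂t over all variables.

  euler : Ser N → Ser N
  euler F e = ι (deg e) * F e

  -- The Leibniz rule, which is the additivity of the degree when a monomial is split into two
  -- factors.
  euler-⊛ : ∀ (F G : Ser N) e → euler (F ⊛ G) e ≡ (euler F ⊛ G) e + (F ⊛ euler G) e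
  euler-⊛ F G e = begin
    ι (deg e) * ∑ (below e) (λ d → F d * G (quot e d))
      ≡⟨ ∑-*ˡ (ι (deg e)) (below e) _ ⟩
    ∑ (below e) (λ d → ι (deg e) * (F d * G (quot e d)))
      ≡⟨ ∑-cong∈ (below e) leibniz ⟩
    ∑ (below e) (λ d → (ι (deg d) * F d) * G (quot e d) + F d * (ι (deg (quot e d)) * G (quot e d)))
      ≡⟨ ∑-+ (below e) _ _ ⟩
    (euler F ⊛ G) e + (F ⊛ euler G) e ∎
    where
    open ≡-Reasoning
    leibniz : ∀ d → d ∈ below e → ι (deg e) * (F d * G (quot e d)) ≡
      (ι (deg d) * F d) * G (quot e d) + F d * (ι (deg (quot e d)) * G (quot e d))
    leibniz d d∈ = trans (cong (λ z → z * (F d * G (quot e d))) (trans (cong ι (sym (deg-quot e d d∈))) (ι-+ (deg d) (deg (quot e d)))))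
      (trans (ℚP.*-distribʳ-+ (F d * G (quot e d)) (ι (deg d)) (ι (deg (quot e d))))
        (cong₂ _+_ (sym (ℚP.*-assoc (ι (deg d)) (F d) (G (quot e d)))) (*-leftComm (ι (deg (quot e d))) (F d) (G (quot e d)))))

  euler-one : ∀ (e : Mono N) → euler oneS e ≡ 0ℚ
  euler-one e with deg e
  ... | zero  = trans (cong (_* 1ℚ) ι-0) (ℚP.*-identityʳ 0ℚ)
  ... | suc m = ℚP.*-zeroʳ (ι (suc m))

  euler-pow : ∀ (F : Ser N) m e → euler (F ^S suc m) e ≡ ι (suc m) * (euler F ⊛ (F ^S m)) e
  euler-pow F zero    e = begin
    euler (F ⊛ oneS) e                          ≡⟨ euler-⊛ F oneS e ⟩
    (euler F ⊛ oneS) e + (F ⊛ euler oneS) e     ≡⟨ cong ((euler F ⊛ oneS) e +_) (∑-zero (below e) (λ d _ → trans (cong (F d *_) (euler-one (quot e d))) (ℚP.*-zeroʳ (F d)))) ⟩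
    (euler F ⊛ oneS) e + 0ℚ                     ≡⟨ trans (ℚP.+-identityʳ ((euler F ⊛ oneS) e)) (trans (sym (ℚP.*-identityˡ ((euler F ⊛ oneS) e))) (cong (_* (euler F ⊛ oneS) e) (sym ι-1))) ⟩
    ι 1 * (euler F ⊛ oneS) e                    ∎
    where open ≡-Reasoning
  euler-pow F (suc m) e = begin
    euler (F ⊛ (F ^S suc m)) e
      ≡⟨ euler-⊛ F (F ^S suc m) e ⟩
    X + (F ⊛ euler (F ^S suc m)) e
      ≡⟨ cong (X +_) (∑-cong (below e) (λ d → trans (cong (F d *_) (euler-pow F m (quot e d))) (*-leftComm (F d) (ι (suc m)) _))) ⟩
    X + ∑ (below e) (λ d → ι (suc m) * (F d * (euler F ⊛ (F ^S m)) (quot e d)))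
      ≡⟨ cong (X +_) (trans (sym (∑-*ˡ (ι (suc m)) (below e) _)) (cong (ι (suc m) *_) (⊛-leftComm F (euler F) (F ^S m) e))) ⟩
    X + ι (suc m) * X
      ≡⟨ cong (_+ ι (suc m) * X) (ℚP.*-identityˡ X) ⟨
    1ℚ * X + ι (suc m) * X
      ≡⟨ ℚP.*-distribʳ-+ X 1ℚ (ι (suc m)) ⟨
    (1ℚ + ι (suc m)) * X
      ≡⟨ cong (_* X) (trans (ι-+ 1 (suc m)) (cong (_+ ι (suc m)) ι-1)) ⟨
    ι (suc (suc m)) * X ∎
    where
    open ≡-Reasoning
    X = (euler F ⊛ (F ^S suc m)) e

  -- The exponential as the solution of D L = (D F) L.

  module Exponential (F : Ser N) (F₀ : ∀ e → deg e ≡ 0 → F e ≡ 0ℚ) where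

    deg-quot-< : ∀ {e d : Mono N} → d ∈ below e → deg d ≢ 0 → deg (quot e d) < deg e
    deg-quot-< {e} {d} d∈ ne = subst (deg (quot e d) <_) (deg-quot e d d∈) (ℕP.m<n+m _ (ℕP.n≢0⇒n>0 ne))

    pow-low : ∀ m e → deg e < m → (F ^S m) e ≡ 0ℚ
    pow-low (suc m) e (s≤s de≤m) = ∑-zero (below e) vanish
      where
      vanish : ∀ d → d ∈ below e → F d * (F ^S m) (quot e d) ≡ 0ℚ
      vanish d d∈ with deg d ℕ.≟ 0
      ... | yes z = trans (cong (_* (F ^S m) (quot e d)) (F₀ d z)) (ℚP.*-zeroˡ ((F ^S m) (quot e d)))
      ... | no nz = trans (cong (F d *_) (pow-low m (quot e d) (ℕP.<-≤-trans (deg-quot-< {e} d∈ nz) de≤m))) (ℚP.*-zeroʳ (F d))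

    -- `expS` truncates at a degree that varies with the monomial; a common bound M is needed to
    -- differentiate and multiply whole series.
    partial : ℕ → Ser N
    partial M e = ∑ (upTo (suc M)) (λ m → (F ^S m) e * (1 ÷ (m !)))

    partial≡exp : ∀ M e → deg e ≤ M → partial M e ≡ expS F e
    partial≡exp M e de≤M = trans (cong (λ z → ∑ (upTo z) f) (sym (trans (ℕP.+-suc (M ∸ deg e) (deg e)) (cong suc (ℕP.m∸n+n≡m de≤M)))))
      (∑-upTo-extend (suc (deg e)) (M ∸ deg e) f
        (λ m lt → trans (cong (_* (1 ÷ (m !))) (pow-low m e lt)) (ℚP.*-zeroˡ (1 ÷ (m !)))))
      where
      f : ℕ → ℚ
      f m = (F ^S m) e * (1 ÷ (m !))

    euler₀ : ∀ d → deg d ≡ 0 → euler F d ≡ 0ℚ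
    euler₀ d z = trans (cong (ι (deg d) *_) (F₀ d z)) (ℚP.*-zeroʳ (ι (deg d)))

    factorial-shift : ∀ m → ι (suc m) * (1 ÷ (suc m !)) ≡ 1 ÷ (m !)
    factorial-shift m = sym (÷-unique 1 (m !) {{ℕP._!≢0 m}} (begin
      ι (m !) * (ι (suc m) * (1 ÷ (suc m !)))   ≡⟨ ℚP.*-assoc (ι (m !)) (ι (suc m)) _ ⟨
      (ι (m !) * ι (suc m)) * (1 ÷ (suc m !))   ≡⟨ cong (_* (1 ÷ (suc m !))) (trans (ℚP.*-comm (ι (m !)) (ι (suc m))) (sym (ι-* (suc m) (m !)))) ⟩
      ι (suc m !) * (1 ÷ (suc m !))             ≡⟨ ι-÷ 1 (suc m !) {{ℕP._!≢0 (suc m)}} ⟩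
      ι 1 ∎))
      where open ≡-Reasoning

    -- D sends Fᵐ⁺¹/(m + 1)! to (D F) Fᵐ/m!, which lowers the bound by one.
    euler-partial : ∀ M e → ι (deg e) * partial (suc M) e ≡ (euler F ⊛ partial M) e
    euler-partial M e = begin
      ι (deg e) * partial (suc M) e
        ≡⟨ ∑-*ˡ (ι (deg e)) (upTo (suc (suc M))) (λ m → (F ^S m) e * (1 ÷ (m !))) ⟩
      ∑ (upTo (suc (suc M))) (λ m → ι (deg e) * ((F ^S m) e * (1 ÷ (m !))))
        ≡⟨ ∑-cong (upTo (suc (suc M))) (λ m → sym (ℚP.*-assoc (ι (deg e)) ((F ^S m) e) (1 ÷ (m !)))) ⟩
      ∑ (upTo (suc (suc M))) (λ m → euler (F ^S m) e * (1 ÷ (m !)))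
        ≡⟨ ∑-upTo-suc (suc M) (λ m → euler (F ^S m) e * (1 ÷ (m !))) ⟩
      euler oneS e * (1 ÷ 1) + ∑ (upTo (suc M)) (λ m → euler (F ^S suc m) e * (1 ÷ (suc m !)))
        ≡⟨ cong₂ _+_ (trans (cong (_* (1 ÷ 1)) (euler-one e)) (ℚP.*-zeroˡ (1 ÷ 1))) (∑-cong (upTo (suc M)) term) ⟩
      0ℚ + ∑ (upTo (suc M)) (λ m → (euler F ⊛ (F ^S m)) e * (1 ÷ (m !)))
        ≡⟨ ℚP.+-identityˡ _ ⟩
      ∑ (upTo (suc M)) (λ m → (euler F ⊛ (F ^S m)) e * (1 ÷ (m !)))
        ≡⟨ ∑-cong (upTo (suc M)) (λ m → trans (∑-*ʳ (1 ÷ (m !)) (below e) (λ d → euler F d * (F ^S m) (quot e d))) (∑-cong (below e) (λ d → ℚP.*-assoc (euler F d) ((F ^S m) (quot e d)) (1 ÷ (m !))))) ⟩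
      ∑ (upTo (suc M)) (λ m → ∑ (below e) (λ d → euler F d * ((F ^S m) (quot e d) * (1 ÷ (m !)))))
        ≡⟨ ∑-swap (upTo (suc M)) (below e) (λ m d → euler F d * ((F ^S m) (quot e d) * (1 ÷ (m !)))) ⟩
      ∑ (below e) (λ d → ∑ (upTo (suc M)) (λ m → euler F d * ((F ^S m) (quot e d) * (1 ÷ (m !)))))
        ≡⟨ ∑-cong (below e) (λ d → sym (∑-*ˡ (euler F d) (upTo (suc M)) (λ m → (F ^S m) (quot e d) * (1 ÷ (m !))))) ⟩
      (euler F ⊛ partial M) e ∎
      where
      open ≡-Reasoning
      term : ∀ m → euler (F ^S suc m) e * (1 ÷ (suc m !)) ≡ (euler F ⊛ (F ^S m)) e * (1 ÷ (m !))
      term m = trans (cong (_* (1 ÷ (suc m !))) (trans (euler-pow F m e) (ℚP.*-comm (ι (suc m)) ((euler F ⊛ (F ^S m)) e))))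
        (trans (ℚP.*-assoc ((euler F ⊛ (F ^S m)) e) (ι (suc m)) (1 ÷ (suc m !))) (cong ((euler F ⊛ (F ^S m)) e *_) (factorial-shift m)))

    -- The constant term of D F vanishes, so the coefficient at `e` only meets coefficients of lower
    -- degree.
    ⊛-agree : ∀ {A B : Ser N} e → (∀ e′ → deg e′ < deg e → A e′ ≡ B e′) → (euler F ⊛ A) e ≡ (euler F ⊛ B) e
    ⊛-agree {A} {B} e agree = ∑-cong∈ (below e) term
      where
      term : ∀ d → d ∈ below e → euler F d * A (quot e d) ≡ euler F d * B (quot e d)
      term d d∈ with deg d ℕ.≟ 0
      ... | yes z = trans (cong (_* A (quot e d)) (euler₀ d z)) (trans (trans (ℚP.*-zeroˡ (A (quot e d))) (sym (ℚP.*-zeroˡ (B (quot e d))))) (cong (_* B (quot e d)) (sym (euler₀ d z))))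
      ... | no nz = cong (euler F d *_) (agree (quot e d) (deg-quot-< {e} d∈ nz))

    euler-exp : ∀ e → euler (expS F) e ≡ (euler F ⊛ expS F) e
    euler-exp e = trans (cong (ι (deg e) *_) (sym (partial≡exp (suc (deg e)) e (ℕP.n≤1+n _))))
      (trans (euler-partial (deg e) e) (⊛-agree e (λ e′ lt → partial≡exp (deg e) e′ (ℕP.<⇒≤ lt))))

    -- In degree d > 0 the equation expresses d times a coefficient through coefficients of lower
    -- degree, and d can be cancelled.
    euler-unique : ∀ {A B : Ser N} → (∀ e → deg e ≡ 0 → A e ≡ B e) →
      (∀ e → euler A e ≡ (euler F ⊛ A) e) → (∀ e → euler B e ≡ (euler F ⊛ B) e) → ∀ e → A e ≡ B e
    euler-unique {A} {B} base eA eB e = go (deg e) e ℕP.≤-refl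
      where
      go : ∀ M e → deg e ≤ M → A e ≡ B e
      go M e le with deg e ℕ.≟ 0
      ... | yes z = base e z
      go zero    e le | no nz = ⊥-elim (nz (ℕP.n≤0⇒n≡0 le))
      go (suc M) e le | no nz = ι-cancel (deg e) {{ℕ.≢-nonZero nz}}
        (trans (eA e) (trans (⊛-agree e (λ e′ lt → go M e′ (ℕP.≤-pred (ℕP.<-≤-trans lt le)))) (sym (eB e))))

  ind-yes : ∀ {b} → T b → ind b ≡ 1ℚ
  ind-yes {true} _ = refl

  ind-no : ∀ {b} → ¬ T b → ind b ≡ 0ℚ
  ind-no {true}  ¬t = ⊥-elim (¬t tt)
  ind-no {false} _  = refl

  ind-cong : ∀ {a b} → (T a → T b) → (T b → T a) → ind a ≡ ind b
  ind-cong {true}  f g = sym (ind-yes (f tt))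
  ind-cong {false} f g = sym (ind-no g)

  ind-∧ : ∀ a b → ind (a ∧ b) ≡ ind a * ind b
  ind-∧ true  b = sym (ℚP.*-identityˡ (ind b))
  ind-∧ false b = sym (ℚP.*-zeroˡ (ind b))

  ind-no-* : ∀ {b} → ¬ T b → ∀ x → ind b * x ≡ 0ℚ
  ind-no-* ¬t x = trans (cong (_* x) (ind-no ¬t)) (ℚP.*-zeroˡ x)

  ind-yes-* : ∀ {b} → T b → ∀ x → ind b * x ≡ x
  ind-yes-* t x = trans (cong (_* x) (ind-yes t)) (ℚP.*-identityˡ x)

  ind-*-cong : ∀ b {x y} → (T b → x ≡ y) → ind b * x ≡ ind b * y
  ind-*-cong true  eq = cong (1ℚ *_) (eq tt)
  ind-*-cong false {x} {y} eq = trans (ℚP.*-zeroˡ x) (sym (ℚP.*-zeroˡ y))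

  ι-∑ : {A : Set} (xs : List A) (f : A → ℕ) → ι (∑ℕ.∑ xs f) ≡ ∑ xs (λ x → ι (f x))
  ι-∑ []       f = ι-0
  ι-∑ (x ∷ xs) f = trans (ι-+ (f x) (∑ℕ.∑ xs f)) (cong (ι (f x) +_) (ι-∑ xs f))

  ∑-* : {A B : Set} (xs : List A) (ys : List B) (f : A → ℚ) (g : B → ℚ) →
    ∑ xs f * ∑ ys g ≡ ∑ xs (λ x → ∑ ys (λ y → f x * g y))
  ∑-* xs ys f g = trans (∑-*ʳ (∑ ys g) xs f) (∑-cong xs (λ x → ∑-*ˡ (f x) ys g))

  -- Series in one variable: products, and the substitution of a power for the variable.

  conv : (ℕ → ℚ) → (ℕ → ℚ) → ℕ → ℚ
  conv f g x = ∑ (upTo (suc x)) (λ p → f p * g (x ∸ p))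

  -- The coefficients of f(uʲ); for j ≥ 1 no index a > x can satisfy j a = x.
  dilate : ℕ → (ℕ → ℚ) → ℕ → ℚ
  dilate j f x = ∑ (upTo (suc x)) (λ a → ind (j ℕ.* a ≡ᵇ x) * f a)

  module _ (j′ : ℕ) where
    private
      j = suc j′

    dilate-* : ∀ f a → dilate j f (j ℕ.* a) ≡ f a
    dilate-* f a = trans (∑-single (λ b → ind (j ℕ.* b ≡ᵇ j ℕ.* a) * f b) (UniqueP.upTo⁺ _)
        (∈-upTo⁺ (s≤s (ℕP.m≤n*m a j)))
        (λ b _ b≢a → ind-no-* (λ t → b≢a (ℕP.*-cancelˡ-≡ b a j (ℕP.≡ᵇ⇒≡ (j ℕ.* b) (j ℕ.* a) t))) (f b)))
      (ind-yes-* (ℕP.≡⇒≡ᵇ (j ℕ.* a) (j ℕ.* a) refl) (f a))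

    dilate-∤ : ∀ f x → ¬ j ∣ x → dilate j f x ≡ 0ℚ
    dilate-∤ f x ¬d = ∑-zero (upTo (suc x)) (λ a _ →
      ind-no-* (λ t → ¬d (divides a (trans (sym (ℕP.≡ᵇ⇒≡ (j ℕ.* a) x t)) (ℕP.*-comm j a)))) (f a))

    dilate-extend : ∀ f x B → x ≤ B → ∑ (upTo (suc B)) (λ a → ind (j ℕ.* a ≡ᵇ x) * f a) ≡ dilate j f x
    dilate-extend f x B x≤B = trans
      (cong (λ z → ∑ (upTo z) h) (sym (trans (ℕP.+-suc (B ∸ x) x) (cong suc (ℕP.m∸n+n≡m x≤B)))))
      (∑-upTo-extend (suc x) (B ∸ x) h (λ a x<a → ind-no-* (λ t → ℕP.n≮n x (ℕP.<-≤-trans x<a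
        (subst (a ≤_) (ℕP.≡ᵇ⇒≡ (j ℕ.* a) x t) (ℕP.m≤n*m a j)))) (f a)))
      where
      h : ℕ → ℚ
      h a = ind (j ℕ.* a ≡ᵇ x) * f a

    dilate-small : ∀ f x → x < j → dilate j f x ≡ ind (x ≡ᵇ 0) * f 0
    dilate-small f zero    _  = trans (cong (dilate j f) (sym (ℕP.*-zeroʳ j))) (trans (dilate-* f 0) (sym (ℚP.*-identityˡ (f 0))))
    dilate-small f (suc x) lt = trans (dilate-∤ f (suc x) (λ d → ℕP.n≮n j (ℕP.≤-<-trans (∣⇒≤ d) lt))) (sym (ℚP.*-zeroˡ (f 0)))

    module _ (F : ℕ → ℚ) (F-∤ : ∀ p → ¬ j ∣ p → F p ≡ 0ℚ) where

      -- `F` lives on multiples of j, so each term may be multiplied by Σₘ [j m = p]; summing over p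
      -- first leaves one term for each m.
      conv-dilate : ∀ h b → conv F (dilate j h) (j ℕ.* b) ≡ ∑ (upTo (suc b)) (λ m → F (j ℕ.* m) * h (b ∸ m))
      conv-dilate h b = begin
        ∑ (upTo (suc x)) G
          ≡⟨ ∑-cong∈ (upTo (suc x)) (λ p p∈ → sym (select p (ℕP.≤-pred (∈-upTo⁻ p∈)))) ⟩
        ∑ (upTo (suc x)) (λ p → ∑ (upTo (suc b)) (λ m → ind (j ℕ.* m ≡ᵇ p) * G p))
          ≡⟨ ∑-swap (upTo (suc x)) (upTo (suc b)) (λ p m → ind (j ℕ.* m ≡ᵇ p) * G p) ⟩
        ∑ (upTo (suc b)) (λ m → ∑ (upTo (suc x)) (λ p → ind (j ℕ.* m ≡ᵇ p) * G p))
          ≡⟨ ∑-cong∈ (upTo (suc b)) (λ m m∈ → trans (pick m (ℕP.≤-pred (∈-upTo⁻ m∈))) (value m)) ⟩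
        ∑ (upTo (suc b)) (λ m → F (j ℕ.* m) * h (b ∸ m)) ∎
        where
        open ≡-Reasoning
        x = j ℕ.* b
        G : ℕ → ℚ
        G p = F p * dilate j h (x ∸ p)
        select : ∀ p → p ≤ x → ∑ (upTo (suc b)) (λ m → ind (j ℕ.* m ≡ᵇ p) * G p) ≡ G p
        select p p≤x with j ∣? p
        ... | no ¬d = trans (∑-zero (upTo (suc b)) (λ m _ → trans (cong (ind (j ℕ.* m ≡ᵇ p) *_) G≡0) (ℚP.*-zeroʳ (ind (j ℕ.* m ≡ᵇ p))))) (sym G≡0)
          where
          G≡0 : G p ≡ 0ℚ
          G≡0 = trans (cong (_* dilate j h (x ∸ p)) (F-∤ p ¬d)) (ℚP.*-zeroˡ (dilate j h (x ∸ p)))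
        ... | yes (divides q eq) = trans
          (∑-single (λ m → ind (j ℕ.* m ≡ᵇ p) * G p) (UniqueP.upTo⁺ (suc b))
            (∈-upTo⁺ (s≤s (ℕP.*-cancelˡ-≤ j (subst (_≤ x) eq′ p≤x))))
            (λ m _ m≢q → ind-no-* (λ t → m≢q (ℕP.*-cancelˡ-≡ m q j (trans (ℕP.≡ᵇ⇒≡ (j ℕ.* m) p t) eq′))) (G p)))
          (ind-yes-* (ℕP.≡⇒≡ᵇ (j ℕ.* q) p (sym eq′)) (G p))
          where eq′ = trans eq (ℕP.*-comm q j)
        pick : ∀ m → m ≤ b → ∑ (upTo (suc x)) (λ p → ind (j ℕ.* m ≡ᵇ p) * G p) ≡ G (j ℕ.* m)
        pick m m≤b = trans (∑-single (λ p → ind (j ℕ.* m ≡ᵇ p) * G p) (UniqueP.upTo⁺ (suc x))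
            (∈-upTo⁺ (s≤s (ℕP.*-monoʳ-≤ j m≤b)))
            (λ p _ p≢ → ind-no-* (λ t → p≢ (sym (ℕP.≡ᵇ⇒≡ (j ℕ.* m) p t))) (G p)))
          (ind-yes-* (ℕP.≡⇒≡ᵇ (j ℕ.* m) (j ℕ.* m) refl) (G (j ℕ.* m)))
        value : ∀ m → G (j ℕ.* m) ≡ F (j ℕ.* m) * h (b ∸ m)
        value m = cong (F (j ℕ.* m) *_) (trans (cong (dilate j h) (sym (ℕP.*-distribˡ-∸ j b m))) (dilate-* h (b ∸ m)))

      conv-dilate-∤ : ∀ h x → ¬ j ∣ x → conv F (dilate j h) x ≡ 0ℚ
      conv-dilate-∤ h x ¬d = ∑-zero (upTo (suc x)) vanish
        where
        vanish : ∀ p → p ∈ upTo (suc x) → F p * dilate j h (x ∸ p) ≡ 0ℚ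
        vanish p p∈ with j ∣? p | j ∣? (x ∸ p)
        ... | no ¬p | _     = trans (cong (_* dilate j h (x ∸ p)) (F-∤ p ¬p)) (ℚP.*-zeroˡ (dilate j h (x ∸ p)))
        ... | yes _ | no ¬q = trans (cong (F p *_) (dilate-∤ h (x ∸ p) ¬q)) (ℚP.*-zeroʳ (F p))
        ... | yes p′ | yes q = ⊥-elim (¬d (subst (j ∣_) (ℕP.m+[n∸m]≡n (ℕP.≤-pred (∈-upTo⁻ p∈))) (∣m∣n⇒∣m+n p′ q)))

  -- The quotients ρ and their logarithmic derivative.

  ½ : ℚ
  ½ = 1 ÷ 2

  weightOf≡ : ∀ t → weightOf t ≡ size t ℕ.* 2
  weightOf≡ t = trans (pairs-length (upTo (size t))) (cong (ℕ._* 2) (length-applyUpTo id (size t)))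
    where
    pairs-length : ∀ (xs : List ℕ) → length (cartesianProduct xs signs) ≡ length xs ℕ.* 2
    pairs-length []       = refl
    pairs-length (x ∷ xs) = cong (λ z → suc (suc z)) (pairs-length xs)

  weightOf≢0 : ∀ t → ℕ.NonZero (weightOf t)
  weightOf≢0 t = _

  R-all≢0 : ∀ t b → ℕ.NonZero (R κall t b)
  R-all≢0 t zero    = _
  R-all≢0 t (suc b) = subst ℕ.NonZero (sym (R-all t b))
    (ℕP.m*n≢0 (weightOf t) _ {{weightOf≢0 t}} {{ℕP.m*n≢0 (suc b) _ {{_}} {{R-all≢0 t b}}}})

  ρ : ℕ → Ty → ℕ → ℚ
  ρ k t b = R (κroots k) t b ÷ R κall t b

  module _ (k : ℕ) (t : Ty) where
    private
      κ = κroots k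
      u = weightOf t
      Z = R κall t

    κ·ρ : ℕ → ℕ → ℕ → ℚ
    κ·ρ m b i = ι (κ t (m ℕ.+ i)) * ρ k t (b ∸ i)

    -- Since Z(b + 1) = 2j(b + 1) Z(b), the recursion for `Ω` divided by Z becomes Ω(m, b + 1)/Z(b +
    -- 1) = κ(m) ρ(b + 1) + Ω(m + 1, b)/Z(b), and this unrolls into the sum.
    Ω-ratio : ∀ m b → Ω κ t m b ÷ Z b ≡ ∑ (upTo (suc b)) (κ·ρ m b)
    Ω-ratio m zero    = ÷-unique (κ t m) 1 (begin
      ι 1 * (ι (κ t (m ℕ.+ 0)) * ρ k t 0 + 0ℚ)   ≡⟨ cong₂ _*_ ι-1 (ℚP.+-identityʳ (ι (κ t (m ℕ.+ 0)) * 1ℚ)) ⟩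
      1ℚ * (ι (κ t (m ℕ.+ 0)) * 1ℚ)              ≡⟨ trans (ℚP.*-identityˡ (ι (κ t (m ℕ.+ 0)) * 1ℚ)) (ℚP.*-identityʳ (ι (κ t (m ℕ.+ 0)))) ⟩
      ι (κ t (m ℕ.+ 0))                          ≡⟨ cong (λ z → ι (κ t z)) (ℕP.+-identityʳ m) ⟩
      ι (κ t m)                                  ∎)
      where open ≡-Reasoning
    Ω-ratio m (suc b) = trans (÷-unique (Ω κ t m (suc b)) (Z (suc b)) {{R-all≢0 t (suc b)}} (begin
      ι Z′ * (ι c * ρ k t (suc b) + X)
        ≡⟨ ℚP.*-distribˡ-+ (ι Z′) (ι c * ρ k t (suc b)) X ⟩
      ι Z′ * (ι c * ρ k t (suc b)) + ι Z′ * X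
        ≡⟨ cong₂ _+_ (trans (*-leftComm (ι Z′) (ι c) (ρ k t (suc b))) (cong (ι c *_) (ι-÷ (R κ t (suc b)) Z′ {{R-all≢0 t (suc b)}})))
                     (cong (λ z → ι z * X) (trans (R-all t b) (solve 3 (λ u s z → u :* (s :* z) := (s :* u) :* z) refl u (suc b) (Z b)))) ⟩
      ι c * ι (R κ t (suc b)) + ι ((suc b ℕ.* u) ℕ.* Z b) * X
        ≡⟨ cong₂ _+_ (sym (ι-* c (R κ t (suc b)))) (trans (cong (_* X) (ι-* (suc b ℕ.* u) (Z b))) (trans (ℚP.*-assoc (ι (suc b ℕ.* u)) (ι (Z b)) X)
             (cong (ι (suc b ℕ.* u) *_) (ι-÷ (Ω κ t (suc m) b) (Z b) {{R-all≢0 t b}})))) ⟩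
      ι (c ℕ.* R κ t (suc b)) + ι (suc b ℕ.* u) * ι (Ω κ t (suc m) b)
        ≡⟨ cong (ι (c ℕ.* R κ t (suc b)) +_) (trans (sym (ι-* (suc b ℕ.* u) (Ω κ t (suc m) b))) (cong ι (ℕP.*-assoc (suc b) u (Ω κ t (suc m) b)))) ⟩
      ι (c ℕ.* R κ t (suc b)) + ι (suc b ℕ.* (u ℕ.* Ω κ t (suc m) b))
        ≡⟨ ι-+ (c ℕ.* R κ t (suc b)) (suc b ℕ.* (u ℕ.* Ω κ t (suc m) b)) ⟨
      ι (Ω κ t m (suc b)) ∎))
      (sym (trans (∑-upTo-suc (suc b) (κ·ρ m (suc b))) (cong₂ _+_
        (cong (λ z → ι (κ t z) * ρ k t (suc b)) (ℕP.+-identityʳ m))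
        (trans (∑-cong (upTo (suc b)) (λ i → cong (λ z → ι (κ t z) * ρ k t (b ∸ i)) (ℕP.+-suc m i))) (sym (Ω-ratio (suc m) b))))))
      where
      open ≡-Reasoning
      open ℕSolver.+-*-Solver using (solve; _:*_; _:=_)
      c = κ t m
      Z′ = Z (suc b)
      X = Ω κ t (suc m) b ÷ Z b

    -- Both sides are R(b + 1)/Z(b): the left by the recursion for Z, the right by `Ω-ratio` at m =
    -- 1.
    ρ-recursion : ∀ b → ι (u ℕ.* suc b) * ρ k t (suc b) ≡ ∑ (upTo (suc b)) (κ·ρ 1 b)
    ρ-recursion b = trans (sym (÷-unique (R κ t (suc b)) (Z b) {{R-all≢0 t b}} (begin
      ι (Z b) * (ι (u ℕ.* suc b) * ρ k t (suc b))   ≡⟨ ℚP.*-assoc (ι (Z b)) (ι (u ℕ.* suc b)) _ ⟨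
      (ι (Z b) * ι (u ℕ.* suc b)) * ρ k t (suc b)   ≡⟨ cong (_* ρ k t (suc b)) (trans (sym (ι-* (Z b) (u ℕ.* suc b))) (cong ι
                                                        (trans (ℕP.*-comm (Z b) (u ℕ.* suc b)) (trans (ℕP.*-assoc u (suc b) (Z b)) (sym (R-all t b)))))) ⟩
      ι (Z (suc b)) * ρ k t (suc b)                 ≡⟨ ι-÷ (R κ t (suc b)) (Z (suc b)) {{R-all≢0 t (suc b)}} ⟩
      ι (R κ t (suc b))                             ∎)))
      (Ω-ratio 1 b)
      where open ≡-Reasoning

    -- The Euler derivative of the part of the exponent in one variable: with p = jk/h the
    -- coefficient 1/(2p) of tᵖ turns into 1/2.
    ψ : ℕ → ℚ
    ψ p = ∑ (upTo k) (λ i → ind (valid k t i) * (ind ((size t ℕ.* k) / suc i ≡ᵇ p) * (ι (rootsZ2 (suc i) (proj₂ t)) * ½)))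

    φ : ℕ → ℚ
    φ = dilate (size t) (ρ k t)

    valid⇒∣ : ∀ i → T (valid k t i) → suc i ∣ k
    valid⇒∣ i v = T-⌊⌋⁻ (suc i ∣? k) (proj₁ (Equivalence.to (T-∧ {⌊ suc i ∣? k ⌋}) v))

    -- Matches the exponent (jk)/h of the theorem with j m for a closing length m = k/h; the two
    -- roundings agree because h divides k.
    valid⇒/ : ∀ i → T (valid k t i) → (size t ℕ.* k) / suc i ≡ size t ℕ.* (k / suc i)
    valid⇒/ i v = *-/-assoc (size t) (valid⇒∣ i v)

    ψ-∤ : ∀ p → ¬ size t ∣ p → ψ p ≡ 0ℚ
    ψ-∤ p ¬d = ∑-zero (upTo k) (λ i _ → trans (ind-*-cong (valid k t i) (λ v → ind-no-* (λ q →
        ¬d (divides (k / suc i) (trans (sym (ℕP.≡ᵇ⇒≡ ((size t ℕ.* k) / suc i) p q)) (trans (valid⇒/ i v) (ℕP.*-comm (size t) (k / suc i))))))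
        (ι (rootsZ2 (suc i) (proj₂ t)) * ½)))
      (ℚP.*-zeroʳ (ind (valid k t i))))

    ψ-* : ∀ m → ψ (size t ℕ.* m) ≡ ι (κ t m) * ½
    ψ-* m = sym (trans (cong (_* ½) (ι-∑ (upTo k) κ-term)) (trans (∑-*ʳ ½ (upTo k) (λ i → ι (κ-term i))) (∑-cong (upTo k) term)))
      where
      r : ℕ → ℕ
      r i = rootsZ2 (suc i) (proj₂ t)
      κ-term : ℕ → ℕ
      κ-term i = if valid k t i ∧ ((k / suc i) ≡ᵇ m) then r i else 0
      ι-if : ∀ b x → ι (if b then x else 0) ≡ ind b * ι x
      ι-if true  x = sym (ℚP.*-identityˡ (ι x))
      ι-if false x = trans ι-0 (sym (ℚP.*-zeroˡ (ι x)))
      term : ∀ i → ι (κ-term i) * ½ ≡ ind (valid k t i) * (ind ((size t ℕ.* k) / suc i ≡ᵇ size t ℕ.* m) * (ι (r i) * ½))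
      term i = begin
        ι (κ-term i) * ½
          ≡⟨ cong (_* ½) (trans (ι-if (valid k t i ∧ ((k / suc i) ≡ᵇ m)) (r i)) (cong (_* ι (r i)) (ind-∧ (valid k t i) _))) ⟩
        ((ind (valid k t i) * ind ((k / suc i) ≡ᵇ m)) * ι (r i)) * ½
          ≡⟨ trans (ℚP.*-assoc (ind (valid k t i) * ind ((k / suc i) ≡ᵇ m)) (ι (r i)) ½) (ℚP.*-assoc (ind (valid k t i)) (ind ((k / suc i) ≡ᵇ m)) (ι (r i) * ½)) ⟩
        ind (valid k t i) * (ind ((k / suc i) ≡ᵇ m) * (ι (r i) * ½))
          ≡⟨ ind-*-cong (valid k t i) (λ v → cong (_* (ι (r i) * ½)) (ind-cong
               (λ q → ℕP.≡⇒≡ᵇ ((size t ℕ.* k) / suc i) (size t ℕ.* m) (trans (valid⇒/ i v) (cong (size t ℕ.*_) (ℕP.≡ᵇ⇒≡ (k / suc i) m q))))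
               (λ q → ℕP.≡⇒≡ᵇ (k / suc i) m (ℕP.*-cancelˡ-≡ (k / suc i) m (size t) (trans (sym (valid⇒/ i v)) (ℕP.≡ᵇ⇒≡ ((size t ℕ.* k) / suc i) (size t ℕ.* m) q)))))) ⟩
        ind (valid k t i) * (ind ((size t ℕ.* k) / suc i ≡ᵇ size t ℕ.* m) * (ι (r i) * ½)) ∎
        where open ≡-Reasoning

    valid⇒/≢0 : 1 ≤ k → ∀ i → T (valid k t i) → k / suc i ≢ 0
    valid⇒/≢0 1≤k i v eq = ℕP.n≮n 0 (subst (0 <_) eq (m≥n⇒m/n>0 (∣⇒≤ {{ℕ.>-nonZero 1≤k}} (valid⇒∣ i v))))

    -- Removes the term m = 0 of the convolution, which has no counterpart in `ρ-recursion`.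
    κ-0 : 1 ≤ k → κ t 0 ≡ 0
    κ-0 1≤k = ∑ℕ.∑-zero (upTo k) (λ i _ → if-no (λ q → let (v , e) = Equivalence.to (T-∧ {valid k t i}) q
      in valid⇒/≢0 1≤k i v (ℕP.≡ᵇ⇒≡ (k / suc i) 0 e)))

    -- The equation D φ = ψ φ in one variable. Both sides vanish off the multiples of j, and at x =
    -- j b it is half of `ρ-recursion`.
    conv-ψφ : 1 ≤ k → ∀ x → conv ψ φ x ≡ ι x * φ x
    conv-ψφ 1≤k x with size t ∣? x
    ... | no ¬d = trans (conv-dilate-∤ (proj₁ t) ψ ψ-∤ (ρ k t) x ¬d)
                    (sym (trans (cong (ι x *_) (dilate-∤ (proj₁ t) (ρ k t) x ¬d)) (ℚP.*-zeroʳ (ι x))))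
    ... | yes (divides b refl) rewrite ℕP.*-comm b (size t) =
      trans (conv-dilate (proj₁ t) ψ ψ-∤ (ρ k t) b) (trans (multiple b) (cong (ι (size t ℕ.* b) *_) (sym (dilate-* (proj₁ t) (ρ k t) b))))
      where
      multiple : ∀ b → ∑ (upTo (suc b)) (λ m → ψ (size t ℕ.* m) * ρ k t (b ∸ m)) ≡ ι (size t ℕ.* b) * ρ k t b
      multiple b = trans (∑-upTo-suc b (λ m → ψ (size t ℕ.* m) * ρ k t (b ∸ m))) (trans (cong₂ _+_ first (rest b)) (ℚP.+-identityˡ (ι (size t ℕ.* b) * ρ k t b)))
        where
        first : ψ (size t ℕ.* 0) * ρ k t b ≡ 0ℚ
        first = trans (cong (_* ρ k t b) (trans (ψ-* 0) (trans (cong (λ z → ι z * ½) (κ-0 1≤k)) (trans (cong (_* ½) ι-0) (ℚP.*-zeroˡ ½))))) (ℚP.*-zeroˡ (ρ k t b))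
        rest : ∀ b → ∑ (upTo b) (λ m → ψ (size t ℕ.* suc m) * ρ k t (b ∸ suc m)) ≡ ι (size t ℕ.* b) * ρ k t b
        rest zero    = sym (trans (cong (λ z → ι z * ρ k t 0) (ℕP.*-zeroʳ (size t))) (trans (cong (_* ρ k t 0) ι-0) (ℚP.*-zeroˡ (ρ k t 0))))
        rest (suc b) = begin
          ∑ (upTo (suc b)) (λ m → ψ (size t ℕ.* suc m) * ρ k t (b ∸ m))
            ≡⟨ ∑-cong (upTo (suc b)) (λ m → trans (cong (_* ρ k t (b ∸ m)) (trans (ψ-* (suc m)) (ℚP.*-comm (ι (κ t (suc m))) ½))) (ℚP.*-assoc ½ (ι (κ t (suc m))) (ρ k t (b ∸ m)))) ⟩
          ∑ (upTo (suc b)) (λ m → ½ * κ·ρ 1 b m)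
            ≡⟨ ∑-*ˡ ½ (upTo (suc b)) (κ·ρ 1 b) ⟨
          ½ * ∑ (upTo (suc b)) (κ·ρ 1 b)
            ≡⟨ cong (½ *_) (ρ-recursion b) ⟨
          ½ * (ι (u ℕ.* suc b) * ρ k t (suc b))
            ≡⟨ ℚP.*-assoc ½ (ι (u ℕ.* suc b)) (ρ k t (suc b)) ⟨
          (½ * ι (u ℕ.* suc b)) * ρ k t (suc b)
            ≡⟨ cong (_* ρ k t (suc b)) halve ⟩
          ι (size t ℕ.* suc b) * ρ k t (suc b) ∎
          where
          open ≡-Reasoning
          halve : ½ * ι (u ℕ.* suc b) ≡ ι (size t ℕ.* suc b)
          halve = trans (cong (λ z → ½ * ι z) (trans (cong (ℕ._* suc b) (trans (weightOf≡ t) (ℕP.*-comm (size t) 2))) (ℕP.*-assoc 2 (size t) (suc b))))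
            (trans (cong (½ *_) (ι-* 2 (size t ℕ.* suc b))) (trans (sym (ℚP.*-assoc ½ (ι 2) _))
              (trans (cong (_* ι (size t ℕ.* suc b)) (trans (ℚP.*-comm ½ (ι 2)) (trans (ι-÷ 1 2) ι-1))) (ℚP.*-identityˡ _))))

  -- Series in several variables with one-variable factors.

  δ : ℕ → ℚ
  δ x = ind (x ≡ᵇ 0)

  conv-δ : ∀ f x → conv δ f x ≡ f x
  conv-δ f x = trans (∑-upTo-suc x (λ p → δ p * f (x ∸ p))) (trans (cong₂ _+_ (ℚP.*-identityˡ (f x))
    (∑-zero (upTo x) (λ p _ → ℚP.*-zeroˡ (f (x ∸ suc p))))) (ℚP.+-identityʳ (f x)))

  prodS : (ℕ → ℚ) → (ℕ → ℚ) → Ser N → Ser (suc N)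
  prodS f g H ((x , y) ∷ e) = (f x * g y) * H e

  ⊛-prodS : ∀ f g (H : Ser N) f′ g′ H′ x y e →
    (prodS f g H ⊛ prodS f′ g′ H′) ((x , y) ∷ e) ≡ (conv f f′ x * conv g g′ y) * (H ⊛ H′) e
  ⊛-prodS f g H f′ g′ H′ x y e = begin
    (prodS f g H ⊛ prodS f′ g′ H′) ((x , y) ∷ e)
      ≡⟨ ∑-below x y e (λ d → prodS f g H d * prodS f′ g′ H′ (quot ((x , y) ∷ e) d)) ⟩
    ∑ (upTo (suc x)) (λ p → ∑ (upTo (suc y)) (λ q → ∑ (below e) (λ d →
        ((f p * g q) * H d) * ((f′ (x ∸ p) * g′ (y ∸ q)) * H′ (quot e d)))))
      ≡⟨ ∑-cong (upTo (suc x)) (λ p → ∑-cong (upTo (suc y)) (λ q → trans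
           (∑-cong (below e) (λ d → rearrange (f p) (g q) (H d) (f′ (x ∸ p)) (g′ (y ∸ q)) (H′ (quot e d))))
           (sym (∑-*ˡ (F p * G q) (below e) (λ d → H d * H′ (quot e d)))))) ⟩
    ∑ (upTo (suc x)) (λ p → ∑ (upTo (suc y)) (λ q → (F p * G q) * (H ⊛ H′) e))
      ≡⟨ ∑-cong (upTo (suc x)) (λ p → ∑-*ʳ ((H ⊛ H′) e) (upTo (suc y)) (λ q → F p * G q)) ⟨
    ∑ (upTo (suc x)) (λ p → ∑ (upTo (suc y)) (λ q → F p * G q) * (H ⊛ H′) e)
      ≡⟨ ∑-*ʳ ((H ⊛ H′) e) (upTo (suc x)) (λ p → ∑ (upTo (suc y)) (λ q → F p * G q)) ⟨
    ∑ (upTo (suc x)) (λ p → ∑ (upTo (suc y)) (λ q → F p * G q)) * (H ⊛ H′) e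
      ≡⟨ cong (_* (H ⊛ H′) e) (∑-* (upTo (suc x)) (upTo (suc y)) F G) ⟨
    (conv f f′ x * conv g g′ y) * (H ⊛ H′) e ∎
    where
    open ≡-Reasoning
    F G : ℕ → ℚ
    F p = f p * f′ (x ∸ p)
    G q = g q * g′ (y ∸ q)
    rearrange : ∀ a b c a′ b′ c′ → ((a * b) * c) * ((a′ * b′) * c′) ≡ ((a * a′) * (b * b′)) * (c * c′)
    rearrange = solve 6 (λ a b c a′ b′ c′ → ((a :* b) :* c) :* ((a′ :* b′) :* c′) := ((a :* a′) :* (b :* b′)) :* (c :* c′)) refl
      where open ℚSolver.+-*-Solver using (solve; _:*_; _:=_)

  ⊛-distribʳ : ∀ (F G H : Ser N) e → ((λ d → F d + G d) ⊛ H) e ≡ (F ⊛ H) e + (G ⊛ H) e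
  ⊛-distribʳ F G H e = trans (∑-cong (below e) (λ d → ℚP.*-distribʳ-+ (H (quot e d)) (F d) (G d)))
    (∑-+ (below e) (λ d → F d * H (quot e d)) (λ d → G d * H (quot e d)))

  δ-+ : ∀ x y → δ (x ℕ.+ y) ≡ δ x * δ y
  δ-+ zero    y = sym (ℚP.*-identityˡ (δ y))
  δ-+ (suc x) y = sym (ℚP.*-zeroˡ (δ y))

  oneS-∷ : ∀ (e : Mono (suc N)) → oneS e ≡ prodS δ δ oneS e
  oneS-∷ ((x , y) ∷ e) = trans (δ-+ (x ℕ.+ y) (deg e)) (cong (_* oneS e) (δ-+ x y))

  ⊛-identityˡ : ∀ (G : Ser N) → (∀ e → (oneS ⊛ G) e ≡ G e)
  ⊛-identityˡ {zero}  G [] = trans (ℚP.+-identityʳ (1ℚ * G [])) (ℚP.*-identityˡ (G []))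
  ⊛-identityˡ {suc N} G ((x , y) ∷ e) = begin
    (oneS ⊛ G) ((x , y) ∷ e)
      ≡⟨ trans (⊛-cong {G = G} oneS-∷ (λ _ → refl) ((x , y) ∷ e)) (∑-below x y e (λ d → prodS δ δ oneS d * G (quot ((x , y) ∷ e) d))) ⟩
    ∑ (upTo (suc x)) (λ p → ∑ (upTo (suc y)) (λ q → ∑ (below e) (λ d → ((δ p * δ q) * oneS d) * G ((x ∸ p , y ∸ q) ∷ quot e d))))
      ≡⟨ ∑-cong (upTo (suc x)) (λ p → trans (∑-cong (upTo (suc y)) (λ q → trans
           (∑-cong (below e) (λ d → trans (ℚP.*-assoc (δ p * δ q) (oneS d) (rest p q (quot e d))) (ℚP.*-assoc (δ p) (δ q) (oneS d * rest p q (quot e d)))))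
           (trans (sym (∑-*ˡ (δ p) (below e) (λ d → δ q * (oneS d * rest p q (quot e d)))))
             (cong (δ p *_) (trans (sym (∑-*ˡ (δ q) (below e) (λ d → oneS d * rest p q (quot e d))))
               (cong (δ q *_) (⊛-identityˡ (rest p q) e)))))))
           (trans (sym (∑-*ˡ (δ p) (upTo (suc y)) (λ q → δ q * rest p q e))) (cong (δ p *_) (conv-δ (λ q → G ((x ∸ p , q) ∷ e)) y)))) ⟩
    conv δ (λ p → G ((p , y) ∷ e)) x
      ≡⟨ conv-δ (λ p → G ((p , y) ∷ e)) x ⟩
    G ((x , y) ∷ e) ∎
    where
    open ≡-Reasoning
    rest : ℕ → ℕ → Ser N
    rest p q d = G ((x ∸ p , y ∸ q) ∷ d)

  module _ (k : ℕ) where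

    -- Both series restricted to the variables t_{j,θ} with j > o: Λ is the product of the
    -- one-variable series φ, and Ψ the sum of the ψ, the Euler derivative of the exponent.
    Λ Ψ : ℕ → Ser N
    Λ o []            = 1ℚ
    Λ o ((x , y) ∷ e) = prodS (φ k (o , pos)) (φ k (o , neg)) (Λ (suc o)) ((x , y) ∷ e)
    Ψ o []            = 0ℚ
    Ψ o ((x , y) ∷ e) = prodS (ψ k (o , pos)) δ oneS ((x , y) ∷ e) +
      (prodS δ (ψ k (o , neg)) oneS ((x , y) ∷ e) + prodS δ δ (Ψ (suc o)) ((x , y) ∷ e))

    -- The logarithmic derivative turns the product into a sum: each of the two split-off variables
    -- contributes its ψ, the others their Ψ, matching the degree x + y + `deg e`.
    euler-Λ : 1 ≤ k → ∀ o (e : Mono N) → euler (Λ o) e ≡ (Ψ o ⊛ Λ o) e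
    euler-Λ 1≤k o []            = trans (cong (_* 1ℚ) ι-0) refl
    euler-Λ 1≤k o ((x , y) ∷ e) = sym (begin
      (Ψ o ⊛ Λ o) ((x , y) ∷ e)
        ≡⟨ ⊛-cong {F = Ψ o} {F′ = λ d → U d + (V d + W d)} {G = Λ o} {G′ = L}
             (λ { ((_ , _) ∷ _) → refl }) (λ { ((_ , _) ∷ _) → refl }) ((x , y) ∷ e) ⟩
      ((λ d → U d + (V d + W d)) ⊛ L) ((x , y) ∷ e)
        ≡⟨ trans (⊛-distribʳ U (λ d → V d + W d) L ((x , y) ∷ e)) (cong ((U ⊛ L) ((x , y) ∷ e) +_) (⊛-distribʳ V W L ((x , y) ∷ e))) ⟩
      (U ⊛ L) ((x , y) ∷ e) + ((V ⊛ L) ((x , y) ∷ e) + (W ⊛ L) ((x , y) ∷ e))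
        ≡⟨ cong₂ _+_ (⊛-prodS ψ⁺ δ oneS φ⁺ φ⁻ (Λ (suc o)) x y e)
             (cong₂ _+_ (⊛-prodS δ ψ⁻ oneS φ⁺ φ⁻ (Λ (suc o)) x y e) (⊛-prodS δ δ (Ψ (suc o)) φ⁺ φ⁻ (Λ (suc o)) x y e)) ⟩
      (conv ψ⁺ φ⁺ x * conv δ φ⁻ y) * (oneS ⊛ Λ (suc o)) e +
        ((conv δ φ⁺ x * conv ψ⁻ φ⁻ y) * (oneS ⊛ Λ (suc o)) e + (conv δ φ⁺ x * conv δ φ⁻ y) * (Ψ (suc o) ⊛ Λ (suc o)) e)
        ≡⟨ cong₂ _+_ (cong₂ _*_ (cong₂ _*_ (conv-ψφ k (o , pos) 1≤k x) (conv-δ φ⁻ y)) (⊛-identityˡ (Λ (suc o)) e))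
             (cong₂ _+_ (cong₂ _*_ (cong₂ _*_ (conv-δ φ⁺ x) (conv-ψφ k (o , neg) 1≤k y)) (⊛-identityˡ (Λ (suc o)) e))
               (cong₂ _*_ (cong₂ _*_ (conv-δ φ⁺ x) (conv-δ φ⁻ y)) (sym (euler-Λ 1≤k (suc o) e)))) ⟩
      ((ι x * φ⁺ x) * φ⁻ y) * l + ((φ⁺ x * (ι y * φ⁻ y)) * l + (φ⁺ x * φ⁻ y) * (ι (deg e) * l))
        ≡⟨ collect (ι x) (ι y) (ι (deg e)) (φ⁺ x) (φ⁻ y) l ⟩
      ((ι x + ι y) + ι (deg e)) * ((φ⁺ x * φ⁻ y) * l)
        ≡⟨ cong (_* ((φ⁺ x * φ⁻ y) * l)) (trans (ι-+ (x ℕ.+ y) (deg e)) (cong (_+ ι (deg e)) (ι-+ x y))) ⟨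
      euler (Λ o) ((x , y) ∷ e) ∎)
      where
      open ≡-Reasoning
      φ⁺ = φ k (o , pos)
      φ⁻ = φ k (o , neg)
      ψ⁺ = ψ k (o , pos)
      ψ⁻ = ψ k (o , neg)
      l = Λ (suc o) e
      L U V W : Ser (suc _)
      L = prodS φ⁺ φ⁻ (Λ (suc o))
      U = prodS ψ⁺ δ oneS
      V = prodS δ ψ⁻ oneS
      W = prodS δ δ (Ψ (suc o))
      collect : ∀ x y d p q l → ((x * p) * q) * l + ((p * (y * q)) * l + (p * q) * (d * l)) ≡ ((x + y) + d) * ((p * q) * l)
      collect = solve 6 (λ x y d p q l → ((x :* p) :* q) :* l :+ ((p :* (y :* q)) :* l :+ (p :* q) :* (d :* l)) := ((x :+ y) :+ d) :* ((p :* q) :* l)) refl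
        where open ℚSolver.+-*-Solver using (solve; _:+_; _:*_; _:=_)

    φ-0 : ∀ t → φ k t 0 ≡ 1ℚ
    φ-0 t = trans (dilate-small (proj₁ t) (ρ k t) 0 (s≤s z≤n)) (ℚP.*-identityˡ 1ℚ)

    φ-small : ∀ t x → x < size t → φ k t x ≡ δ x
    φ-small t x lt = trans (dilate-small (proj₁ t) (ρ k t) x lt) (ℚP.*-identityʳ (δ x))

    Λ-deg0 : ∀ o (e : Mono N) → deg e ≡ 0 → Λ o e ≡ 1ℚ
    Λ-deg0 o []                  _  = refl
    Λ-deg0 o ((zero , zero) ∷ e) eq = trans (cong₂ _*_ (cong₂ _*_ (φ-0 (o , pos)) (φ-0 (o , neg))) (Λ-deg0 (suc o) e eq)) refl

  -- The Euler derivative of the exponent.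

  zeros : Mono N
  zeros = Vec.tabulate (λ _ → 0 , 0)

  deg-zeros : ∀ N → deg (zeros {N}) ≡ 0
  deg-zeros zero    = refl
  deg-zeros (suc N) = deg-zeros N

  deg0⇒zeros : ∀ (e : Mono N) → deg e ≡ 0 → e ≡ zeros
  deg0⇒zeros []                  _  = refl
  deg0⇒zeros ((zero , zero) ∷ e) eq = cong ((0 , 0) ∷_) (deg0⇒zeros e eq)

  ⌊suc≟suc⌋ : ∀ {n} (i j : Fin n) → ⌊ Fin.suc i Fin.≟ Fin.suc j ⌋ ≡ ⌊ i Fin.≟ j ⌋
  ⌊suc≟suc⌋ i j with i Fin.≟ j
  ... | yes _ = refl
  ... | no _  = refl

  single-suc : ∀ (j : Fin N) θ p → single (Fin.suc j) θ p ≡ (0 , 0) ∷ single j θ p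
  single-suc j pos p = cong ((0 , 0) ∷_) (tabulate-cong (λ i → cong (λ b → if b then (p , 0) else (0 , 0)) (⌊suc≟suc⌋ i j)))
  single-suc j neg p = cong ((0 , 0) ∷_) (tabulate-cong (λ i → cong (λ b → if b then (0 , p) else (0 , 0)) (⌊suc≟suc⌋ i j)))

  deg-single : ∀ (j : Fin N) θ p → deg (single j θ p) ≡ p
  deg-single {suc N} Fin.zero pos p = trans (cong (p ℕ.+ 0 ℕ.+_) (deg-zeros N)) (trans (ℕP.+-identityʳ _) (ℕP.+-identityʳ p))
  deg-single {suc N} Fin.zero neg p = trans (cong (p ℕ.+_) (deg-zeros N)) (ℕP.+-identityʳ p)
  deg-single (Fin.suc j) θ p = trans (cong deg (single-suc j θ p)) (deg-single j θ p)

  at : Mono N → Mono N → ℚ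
  at e m = ind ⌊ e ≟ᴹ m ⌋

  at-∷ : ∀ a c x y (e m : Mono N) → at ((x , y) ∷ e) ((a , c) ∷ m) ≡ (ind (a ≡ᵇ x) * ind (c ≡ᵇ y)) * at e m
  at-∷ a c x y e m = trans (ind-cong to from) (trans (ind-∧ ((a ≡ᵇ x) ∧ (c ≡ᵇ y)) ⌊ e ≟ᴹ m ⌋) (cong (_* at e m) (ind-∧ (a ≡ᵇ x) (c ≡ᵇ y))))
    where
    to : T ⌊ ((x , y) ∷ e) ≟ᴹ ((a , c) ∷ m) ⌋ → T (((a ≡ᵇ x) ∧ (c ≡ᵇ y)) ∧ ⌊ e ≟ᴹ m ⌋)
    to t with T-⌊⌋⁻ (((x , y) ∷ e) ≟ᴹ ((a , c) ∷ m)) t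
    ... | refl = Equivalence.from (T-∧ {(a ≡ᵇ a) ∧ (c ≡ᵇ c)})
          (Equivalence.from (T-∧ {a ≡ᵇ a}) (ℕP.≡⇒≡ᵇ a a refl , ℕP.≡⇒≡ᵇ c c refl) , T-⌊⌋⁺ (e ≟ᴹ m) refl)
    from : T (((a ≡ᵇ x) ∧ (c ≡ᵇ y)) ∧ ⌊ e ≟ᴹ m ⌋) → T ⌊ ((x , y) ∷ e) ≟ᴹ ((a , c) ∷ m) ⌋
    from t with Equivalence.to (T-∧ {(a ≡ᵇ x) ∧ (c ≡ᵇ y)}) t
    ... | ac , em with Equivalence.to (T-∧ {a ≡ᵇ x}) ac
    ...   | ta , tc = T-⌊⌋⁺ (((x , y) ∷ e) ≟ᴹ ((a , c) ∷ m))
            (cong₂ _∷_ (cong₂ _,_ (sym (ℕP.≡ᵇ⇒≡ a x ta)) (sym (ℕP.≡ᵇ⇒≡ c y tc))) (T-⌊⌋⁻ (e ≟ᴹ m) em))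

  0≡ᵇ : ∀ x → ind (0 ≡ᵇ x) ≡ δ x
  0≡ᵇ zero    = refl
  0≡ᵇ (suc x) = refl

  at-zeros : ∀ (e : Mono N) → at e zeros ≡ oneS e
  at-zeros {N} e = ind-cong
    (λ t → ℕP.≡⇒≡ᵇ (deg e) 0 (trans (cong deg (T-⌊⌋⁻ (e ≟ᴹ zeros) t)) (deg-zeros N)))
    (λ t → T-⌊⌋⁺ (e ≟ᴹ zeros) (deg0⇒zeros e (ℕP.≡ᵇ⇒≡ (deg e) 0 t)))

  ∑-allFin-suc : ∀ N (f : Fin (suc N) → ℚ) → ∑ (allFin (suc N)) f ≡ f Fin.zero + ∑ (allFin N) (f ∘ Fin.suc)
  ∑-allFin-suc N f = cong (f Fin.zero +_) (trans (cong (λ xs → ∑ xs f) (sym (map-tabulate id Fin.suc))) (∑-map Fin.suc (allFin N) f))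

  module _ (k : ℕ) (1≤k : 1 ≤ k) where

    private
      p : Ty → ℕ → ℕ
      p t i = (size t ℕ.* k) / suc i

      half-roots : Ty → ℕ → ℚ
      half-roots t i = ι (rootsZ2 (suc i) (proj₂ t)) * ½

      p≢0 : ∀ t i → T (valid k t i) → p t i ≢ 0
      p≢0 t i v eq with ℕP.m*n≡0⇒m≡0∨n≡0 (size t) (trans (sym (valid⇒/ k t i v)) eq)
      ... | inj₂ z = valid⇒/≢0 k t 1≤k i v z

      -- Excluding q = 0 matters here, as `÷` takes the value 0 at a zero denominator.
      exponent-euler : ∀ r q → q ≢ 0 → ι q * (r ÷ (2 ℕ.* q)) ≡ ι r * ½
      exponent-euler r q q≢0 = ι-cancel 2 (trans (sym (ℚP.*-assoc (ι 2) (ι q) (r ÷ (2 ℕ.* q))))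
        (trans (cong (_* (r ÷ (2 ℕ.* q))) (sym (ι-* 2 q)))
        (trans (ι-÷ r (2 ℕ.* q) {{ℕP.m*n≢0 2 q {{_}} {{ℕ.≢-nonZero q≢0}}}})
        (sym (trans (*-leftComm (ι 2) (ι r) ½) (trans (cong (ι r *_) (trans (ι-÷ 1 2) ι-1)) (ℚP.*-identityʳ (ι r))))))))

    term : Mono N → Ty → Fin N → ℚ
    term e t j = ∑ (upTo k) (λ i → ind (valid k t i) * (at e (single j (proj₂ t) (p t i)) * half-roots t i))

    -- The position of a variable in the vector and its cycle length are separated by the offset
    -- `o`, so that the first variables can be split off by induction.
    termsFrom : ℕ → Ser N
    termsFrom {N} o e = ∑ (allFin N) (λ j → ∑ signs (λ θ → term e (o ℕ.+ toℕ j , θ) j))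

    euler-inner : ∀ (e : Mono N) → euler (inner k N) e ≡ termsFrom 0 e
    euler-inner {N} e = trans (∑-*ˡ (ι (deg e)) (allFin N) _) (∑-cong (allFin N) (λ j →
      trans (∑-*ˡ (ι (deg e)) signs (λ θ → ∑ (upTo k) (summand j θ))) (∑-cong signs (λ θ →
        trans (∑-*ˡ (ι (deg e)) (upTo k) (summand j θ)) (∑-cong (upTo k) (each j θ))))))
      where
      summand : Fin N → Sgn → ℕ → ℚ
      summand j θ i = let t = (toℕ j , θ) in
        ind (valid k t i) * (at e (single j θ (p t i)) * (rootsZ2 (suc i) θ ÷ (2 ℕ.* p t i)))
      each : ∀ j θ i → let t = (toℕ j , θ) in
        ι (deg e) * summand j θ i ≡ ind (valid k t i) * (at e (single j θ (p t i)) * half-roots t i)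
      each j θ i = trans (*-leftComm (ι (deg e)) (ind (valid k t i)) _) (ind-*-cong (valid k t i) (λ v →
        trans (*-leftComm (ι (deg e)) (at e s) _) (ind-*-cong ⌊ e ≟ᴹ s ⌋ (λ q →
          trans (cong (λ z → ι z * (rootsZ2 (suc i) θ ÷ (2 ℕ.* p t i))) (trans (cong deg (T-⌊⌋⁻ (e ≟ᴹ s) q)) (deg-single j θ (p t i))))
            (exponent-euler (rootsZ2 (suc i) θ) (p t i) (p≢0 t i v))))))
        where
        t = (toℕ j , θ)
        s = single j θ (p t i)

    inner₀ : ∀ (e : Mono N) → deg e ≡ 0 → inner k N e ≡ 0ℚ
    inner₀ {N} e eq = ∑-zero (allFin N) (λ j _ → ∑-zero signs (λ θ _ → ∑-zero (upTo k) (λ i _ →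
      let t = (toℕ j , θ); s = single j θ (p t i); c = rootsZ2 (suc i) θ ÷ (2 ℕ.* p t i) in
      trans (ind-*-cong (valid k t i) {at e s * c} {0ℚ} (λ v → ind-no-* (λ q →
        p≢0 t i v (trans (sym (deg-single j θ (p t i))) (trans (cong deg (sym (T-⌊⌋⁻ (e ≟ᴹ s) q))) eq))) c))
        (ℚP.*-zeroʳ (ind (valid k t i))))))

    termsFrom≡Ψ : ∀ o (e : Mono N) → termsFrom o e ≡ Ψ k o e
    termsFrom≡Ψ o []            = refl
    termsFrom≡Ψ {suc N} o ((x , y) ∷ e) = begin
      termsFrom o xye
        ≡⟨ ∑-allFin-suc N (λ j → ∑ signs (λ θ → term xye (o ℕ.+ toℕ j , θ) j)) ⟩
      (term xye (o ℕ.+ 0 , pos) Fin.zero + (term xye (o ℕ.+ 0 , neg) Fin.zero + 0ℚ)) +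
        ∑ (allFin N) (λ j → ∑ signs (λ θ → term xye (o ℕ.+ suc (toℕ j) , θ) (Fin.suc j)))
        ≡⟨ cong₂ _+_ (cong₂ _+_ at-pos (trans (ℚP.+-identityʳ _) at-neg)) later ⟩
      (a + b) + c
        ≡⟨ ℚP.+-assoc a b c ⟩
      a + (b + c) ∎
      where
      open ≡-Reasoning
      xye = (x , y) ∷ e
      a = prodS (ψ k (o , pos)) δ oneS xye
      b = prodS δ (ψ k (o , neg)) oneS xye
      c = prodS δ δ (Ψ k (suc o)) xye
      factor : ∀ v f g h r → v * (((f * g) * h) * r) ≡ (g * h) * (v * (f * r))
      factor = solve 5 (λ v f g h r → v :* (((f :* g) :* h) :* r) := (g :* h) :* (v :* (f :* r))) refl
        where open ℚSolver.+-*-Solver using (solve; _:*_; _:=_)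
      at-pos : term xye (o ℕ.+ 0 , pos) Fin.zero ≡ a
      at-pos rewrite ℕP.+-identityʳ o = trans (∑-cong (upTo k) (λ i →
          trans (cong (λ z → ind (valid k (o , pos) i) * (z * half-roots (o , pos) i))
                   (trans (at-∷ (p (o , pos) i) 0 x y e zeros) (cong₂ _*_ (cong (ind (p (o , pos) i ≡ᵇ x) *_) (0≡ᵇ y)) (at-zeros e))))
                (factor (ind (valid k (o , pos) i)) (ind (p (o , pos) i ≡ᵇ x)) (δ y) (oneS e) (half-roots (o , pos) i))))
        (trans (sym (∑-*ˡ (δ y * oneS e) (upTo k) (λ i → ind (valid k (o , pos) i) * (ind (p (o , pos) i ≡ᵇ x) * half-roots (o , pos) i))))
          (trans (ℚP.*-comm (δ y * oneS e) (ψ k (o , pos) x)) (sym (ℚP.*-assoc (ψ k (o , pos) x) (δ y) (oneS e)))))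
      at-neg : term xye (o ℕ.+ 0 , neg) Fin.zero ≡ b
      at-neg rewrite ℕP.+-identityʳ o = trans (∑-cong (upTo k) (λ i →
          trans (cong (λ z → ind (valid k (o , neg) i) * (z * half-roots (o , neg) i))
                   (trans (at-∷ 0 (p (o , neg) i) x y e zeros)
                     (cong₂ _*_ (trans (ℚP.*-comm (ind (0 ≡ᵇ x)) (ind (p (o , neg) i ≡ᵇ y))) (cong (ind (p (o , neg) i ≡ᵇ y) *_) (0≡ᵇ x))) (at-zeros e))))
                (factor (ind (valid k (o , neg) i)) (ind (p (o , neg) i ≡ᵇ y)) (δ x) (oneS e) (half-roots (o , neg) i))))
        (trans (sym (∑-*ˡ (δ x * oneS e) (upTo k) (λ i → ind (valid k (o , neg) i) * (ind (p (o , neg) i ≡ᵇ y) * half-roots (o , neg) i))))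
          (trans (ℚP.*-assoc (δ x) (oneS e) (ψ k (o , neg) y)) (trans (cong (δ x *_) (ℚP.*-comm (oneS e) (ψ k (o , neg) y)))
            (sym (ℚP.*-assoc (δ x) (ψ k (o , neg) y) (oneS e))))))
      shifted : ∀ t j → term xye t (Fin.suc j) ≡ (δ x * δ y) * term e t j
      shifted t j = trans (∑-cong (upTo k) (λ i →
          trans (cong (λ z → ind (valid k t i) * (z * half-roots t i))
                   (trans (cong (at xye) (single-suc j (proj₂ t) (p t i)))
                     (trans (at-∷ 0 0 x y e (single j (proj₂ t) (p t i)))
                       (cong (_* at e (single j (proj₂ t) (p t i))) (cong₂ _*_ (0≡ᵇ x) (0≡ᵇ y))))))
                (trans (cong (ind (valid k t i) *_) (ℚP.*-assoc (δ x * δ y) (at e (single j (proj₂ t) (p t i))) (half-roots t i)))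
                  (*-leftComm (ind (valid k t i)) (δ x * δ y) (at e (single j (proj₂ t) (p t i)) * half-roots t i)))))
        (sym (∑-*ˡ (δ x * δ y) (upTo k) (λ i → ind (valid k t i) * (at e (single j (proj₂ t) (p t i)) * half-roots t i))))
      later : ∑ (allFin N) (λ j → ∑ signs (λ θ → term xye (o ℕ.+ suc (toℕ j) , θ) (Fin.suc j))) ≡ c
      later = trans (∑-cong (allFin N) (λ j → trans (∑-cong signs (λ θ →
            trans (shifted (o ℕ.+ suc (toℕ j) , θ) j) (cong (λ z → (δ x * δ y) * term e (z , θ) j) (ℕP.+-suc o (toℕ j)))))
            (sym (∑-*ˡ (δ x * δ y) signs (λ θ → term e (suc o ℕ.+ toℕ j , θ) j)))))
        (trans (sym (∑-*ˡ (δ x * δ y) (allFin N) (λ j → ∑ signs (λ θ → term e (suc o ℕ.+ toℕ j , θ) j))))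
          (cong ((δ x * δ y) *_) (termsFrom≡Ψ (suc o) e)))

    exp-inner≡Λ : ∀ (e : Mono N) → expS (inner k N) e ≡ Λ k 0 e
    exp-inner≡Λ {N} = euler-unique base euler-exp
      (λ e → trans (euler-Λ k 1≤k 0 e) (⊛-cong {G = Λ k 0} (λ d → sym (trans (euler-inner d) (termsFrom≡Ψ 0 d))) (λ _ → refl) e))
      where
      open Exponential (inner k N) inner₀
      base : ∀ e → deg e ≡ 0 → expS (inner k N) e ≡ Λ k 0 e
      base e eq = trans (sym (partial≡exp 0 e (ℕP.≤-reflexive eq))) (trans constant (sym (Λ-deg0 k 0 e eq)))
        where
        constant : partial 0 e ≡ 1ℚ
        constant = trans (cong (λ z → ind (z ≡ᵇ 0) * 1ℚ + 0ℚ) eq) refl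

  -- The sum over bipartitions as a product over the types.

  deg-cvec : ∀ {m} j (b : Vec (ℕ × ℕ) m) → deg (cvec j b) ≡ weight j b
  deg-cvec j []            = refl
  deg-cvec j ((a , c) ∷ b) = cong₂ ℕ._+_ (sym (ℕP.*-distribˡ-+ j a c)) (deg-cvec (suc j) b)

  monoEq-deg : ∀ {m m′} (u : Mono m) (v : Mono m′) → T (monoEq u v) → deg u ≡ deg v
  monoEq-deg []            []              _ = refl
  monoEq-deg []            ((x , y) ∷ v)   t with Equivalence.to (T-∧ {x ≡ᵇ 0}) t
  ... | tx , t′ with Equivalence.to (T-∧ {y ≡ᵇ 0}) t′
  ...   | ty , t″ = cong₂ ℕ._+_ (sym (cong₂ ℕ._+_ (ℕP.≡ᵇ⇒≡ x 0 tx) (ℕP.≡ᵇ⇒≡ y 0 ty))) (monoEq-deg [] v t″)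
  monoEq-deg ((x , y) ∷ u) []              t with Equivalence.to (T-∧ {x ≡ᵇ 0}) t
  ... | tx , t′ with Equivalence.to (T-∧ {y ≡ᵇ 0}) t′
  ...   | ty , t″ = cong₂ ℕ._+_ (cong₂ ℕ._+_ (ℕP.≡ᵇ⇒≡ x 0 tx) (ℕP.≡ᵇ⇒≡ y 0 ty)) (monoEq-deg u [] t″)
  monoEq-deg ((x , y) ∷ u) ((x′ , y′) ∷ v) t with Equivalence.to (T-∧ {x ≡ᵇ x′}) t
  ... | tx , t′ with Equivalence.to (T-∧ {y ≡ᵇ y′}) t′
  ...   | ty , t″ = cong₂ ℕ._+_ (cong₂ ℕ._+_ (ℕP.≡ᵇ⇒≡ x x′ tx) (ℕP.≡ᵇ⇒≡ y y′ ty)) (monoEq-deg u v t″)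

  module _ (k : ℕ) where

    ratioProduct : ∀ {m} → ℕ → Vec (ℕ × ℕ) m → ℚ
    ratioProduct o []            = 1ℚ
    ratioProduct o ((a , c) ∷ b) = (ρ k (o , pos) a * ρ k (o , neg) c) * ratioProduct (suc o) b

    prodR-all≢0 : ∀ ms → ℕ.NonZero (prodR κall ms)
    prodR-all≢0 []             = _
    prodR-all≢0 ((t , a) ∷ ms) = ℕP.m*n≢0 (R κall t a) (prodR κall ms) {{R-all≢0 t a}} {{prodR-all≢0 ms}}

    ratio≡product : ∀ {m} o (b : Vec (ℕ × ℕ) m) →
      prodR (κroots k) (mults o b) ÷ prodR κall (mults o b) ≡ ratioProduct o b
    ratio≡product o []            = refl
    ratio≡product o ((a , c) ∷ b) = trans
      (÷-* (R κ t⁺ a) (R κall t⁺ a) (R κ t⁻ c ℕ.* prodR κ ms) (R κall t⁻ c ℕ.* prodR κall ms)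
        {{R-all≢0 t⁺ a}} {{prodR-all≢0 ((t⁻ , c) ∷ ms)}})
      (trans (cong (ρ k t⁺ a *_) (trans
          (÷-* (R κ t⁻ c) (R κall t⁻ c) (prodR κ ms) (prodR κall ms) {{R-all≢0 t⁻ c}} {{prodR-all≢0 ms}})
          (cong (ρ k t⁻ c *_) (ratio≡product (suc o) b))))
        (sym (ℚP.*-assoc (ρ k t⁺ a) (ρ k t⁻ c) (ratioProduct (suc o) b))))
      where
      κ = κroots k
      t⁺ = (o , pos)
      t⁻ = (o , neg)
      ms = mults (suc o) b

    range² : ℕ → List (ℕ × ℕ)
    range² B = cartesianProduct (upTo (suc B)) (upTo (suc B))

    coefficient : ∀ {m} → ℕ → Mono N → Vec (ℕ × ℕ) m → ℚ
    coefficient o e b = ind (monoEq (cvec (suc o) b) e) * ratioProduct o b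

    -- The parts j > B cannot occur, because the exponents of e are at most B.
    sum-coefficients : ∀ m o B (e : Mono N) → deg e ≤ B → B ≤ o ℕ.+ m →
      ∑ (allVecs (range² B) m) (coefficient o e) ≡ Λ k o e
    sum-coefficients-∷ : ∀ m o B x y (e : Mono N) → deg ((x , y) ∷ e) ≤ B → B ≤ o ℕ.+ suc m →
      ∑ (allVecs (range² B) (suc m)) (coefficient o ((x , y) ∷ e)) ≡ Λ k o ((x , y) ∷ e)
    sum-coefficients zero o B e de≤B B≤o = trans (ℚP.+-identityʳ _) (trans (ℚP.*-identityʳ _) (no-parts o e (ℕP.≤-trans de≤B (ℕP.≤-trans B≤o (ℕP.≤-reflexive (ℕP.+-identityʳ o))))))
      where
      -- All remaining exponents are at most o, while each remaining φ has no terms in degrees 1 to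
      -- o; so φ and δ agree there.
      no-parts : ∀ {N} o (e : Mono N) → deg e ≤ o → ind (monoEq [] e) ≡ Λ k o e
      no-parts o []            _  = refl
      no-parts o ((x , y) ∷ e) le = trans (ind-∧ (x ≡ᵇ 0) ((y ≡ᵇ 0) ∧ monoEq [] e))
        (trans (cong (δ x *_) (ind-∧ (y ≡ᵇ 0) (monoEq [] e)))
        (trans (sym (ℚP.*-assoc (δ x) (δ y) (ind (monoEq [] e))))
        (cong₂ _*_ (cong₂ _*_ (sym (φ-small k (o , pos) x (s≤s (ℕP.≤-trans (ℕP.≤-trans (ℕP.m≤m+n x y) (ℕP.m≤m+n (x ℕ.+ y) (deg e))) le))))
                              (sym (φ-small k (o , neg) y (s≤s (ℕP.≤-trans (ℕP.≤-trans (ℕP.m≤n+m y x) (ℕP.m≤m+n (x ℕ.+ y) (deg e))) le)))))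
          (no-parts (suc o) e (ℕP.≤-trans (ℕP.m≤n+m (deg e) (x ℕ.+ y)) (ℕP.≤-trans le (ℕP.n≤1+n o)))))))
    -- The monomial has no variables left while multiplicities remain. `monoEq` then reads the
    -- missing exponents as zeros, and one such pair is appended explicitly.
    sum-coefficients (suc m) o B [] de≤B B≤ = trans
      (∑-cong (allVecs (range² B) (suc m)) (λ { ((a , c) ∷ b) → refl }))
      (trans (sum-coefficients-∷ m o B 0 0 [] de≤B B≤)
        (trans (cong (_* 1ℚ) (cong₂ _*_ (φ-0 k (o , pos)) (φ-0 k (o , neg)))) refl))
    sum-coefficients (suc m) o B ((x , y) ∷ e) de≤B B≤ = sum-coefficients-∷ m o B x y e de≤B B≤
    sum-coefficients-∷ m o B x y e de≤B B≤ = begin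
      ∑ (allVecs (range² B) (suc m)) (coefficient o ((x , y) ∷ e))
        ≡⟨ trans (∑-concatMap (λ z → map (z ∷_) vs) (range² B) (coefficient o ((x , y) ∷ e)))
             (trans (∑-cong (range² B) (λ z → ∑-map (z ∷_) vs (coefficient o ((x , y) ∷ e))))
               (∑-product (upTo (suc B)) (upTo (suc B)) (λ z → ∑ vs (λ b → coefficient o ((x , y) ∷ e) (z ∷ b))))) ⟩
      ∑ (upTo (suc B)) (λ a → ∑ (upTo (suc B)) (λ c → ∑ vs (λ b → coefficient o ((x , y) ∷ e) ((a , c) ∷ b))))
        ≡⟨ ∑-cong (upTo (suc B)) (λ a → ∑-cong (upTo (suc B)) (λ c → trans (∑-cong vs (split a c))
             (trans (sym (∑-*ˡ (F a * G c) vs (coefficient (suc o) e))) (cong ((F a * G c) *_) ih)))) ⟩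
      ∑ (upTo (suc B)) (λ a → ∑ (upTo (suc B)) (λ c → (F a * G c) * Λ k (suc o) e))
        ≡⟨ trans (∑-cong (upTo (suc B)) (λ a → sym (∑-*ʳ (Λ k (suc o) e) (upTo (suc B)) (λ c → F a * G c))))
             (sym (∑-*ʳ (Λ k (suc o) e) (upTo (suc B)) (λ a → ∑ (upTo (suc B)) (λ c → F a * G c)))) ⟩
      ∑ (upTo (suc B)) (λ a → ∑ (upTo (suc B)) (λ c → F a * G c)) * Λ k (suc o) e
        ≡⟨ cong (_* Λ k (suc o) e) (sym (∑-* (upTo (suc B)) (upTo (suc B)) F G)) ⟩
      (∑ (upTo (suc B)) F * ∑ (upTo (suc B)) G) * Λ k (suc o) e
        ≡⟨ cong (_* Λ k (suc o) e) (cong₂ _*_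
             (dilate-extend o (ρ k (o , pos)) x B (ℕP.≤-trans (ℕP.≤-trans (ℕP.m≤m+n x y) (ℕP.m≤m+n (x ℕ.+ y) (deg e))) de≤B))
             (dilate-extend o (ρ k (o , neg)) y B (ℕP.≤-trans (ℕP.≤-trans (ℕP.m≤n+m y x) (ℕP.m≤m+n (x ℕ.+ y) (deg e))) de≤B))) ⟩
      Λ k o ((x , y) ∷ e) ∎
      where
      open ≡-Reasoning
      vs = allVecs (range² B) m
      F G : ℕ → ℚ
      F a = ind (suc o ℕ.* a ≡ᵇ x) * ρ k (o , pos) a
      G c = ind (suc o ℕ.* c ≡ᵇ y) * ρ k (o , neg) c
      ih : ∑ vs (coefficient (suc o) e) ≡ Λ k (suc o) e
      ih = sum-coefficients m (suc o) B e (ℕP.≤-trans (ℕP.m≤n+m (deg e) (x ℕ.+ y)) de≤B) (ℕP.≤-trans B≤ (ℕP.≤-reflexive (ℕP.+-suc o m)))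
      rearrange : ∀ i j l r s q → (i * (j * l)) * ((r * s) * q) ≡ ((i * r) * (j * s)) * (l * q)
      rearrange = solve 6 (λ i j l r s q → (i :* (j :* l)) :* ((r :* s) :* q) := ((i :* r) :* (j :* s)) :* (l :* q)) refl
        where open ℚSolver.+-*-Solver using (solve; _:*_; _:=_)
      split : ∀ a c b → coefficient o ((x , y) ∷ e) ((a , c) ∷ b) ≡ (F a * G c) * coefficient (suc o) e b
      split a c b = trans (cong (_* ratioProduct o ((a , c) ∷ b))
          (trans (ind-∧ (suc o ℕ.* a ≡ᵇ x) ((suc o ℕ.* c ≡ᵇ y) ∧ monoEq (cvec (suc (suc o)) b) e))
            (cong (ind (suc o ℕ.* a ≡ᵇ x) *_) (ind-∧ (suc o ℕ.* c ≡ᵇ y) (monoEq (cvec (suc (suc o)) b) e)))))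
        (rearrange (ind (suc o ℕ.* a ≡ᵇ x)) (ind (suc o ℕ.* c ≡ᵇ y)) (ind (monoEq (cvec (suc (suc o)) b) e))
          (ρ k (o , pos) a) (ρ k (o , neg) c) (ratioProduct (suc o) b))

    -- A bipartition of n contributes only to monomials of degree n. Hence the condition on its
    -- weight may be replaced by `deg e` = n, and only the last n of the sum survives.
    LHS≡Λ : 1 ≤ k → ∀ (e : Mono N) → LHS k N e ≡ Λ k 0 e
    LHS≡Λ {N} 1≤k e = begin
      ∑ (upTo (suc (deg e))) (λ n → ∑ (bipartitions n) (summand n))
        ≡⟨ ∑-cong (upTo (suc (deg e))) (λ n → trans (∑-cong∈ (bipartitions n) (λ b b∈ → cong (ind (monoEq (cvec 1 b) e) *_) (quotient n b b∈)))
             (trans (∑-filterᵇ (λ b → weight 1 b ≡ᵇ n) (allVecs (range² n) n) (coefficient 0 e))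
               (∑-cong (allVecs (range² n) n) (filtered n)))) ⟩
      ∑ (upTo (suc (deg e))) (λ n → ∑ (allVecs (range² n) n) (λ b → ind (deg e ≡ᵇ n) * coefficient 0 e b))
        ≡⟨ ∑-upTo-snoc (deg e) (λ n → ∑ (allVecs (range² n) n) (λ b → ind (deg e ≡ᵇ n) * coefficient 0 e b)) ⟩
      ∑ (upTo (deg e)) (λ n → ∑ (allVecs (range² n) n) (λ b → ind (deg e ≡ᵇ n) * coefficient 0 e b)) +
        ∑ (allVecs (range² (deg e)) (deg e)) (λ b → ind (deg e ≡ᵇ deg e) * coefficient 0 e b)
        ≡⟨ cong₂ _+_
             (∑-zero (upTo (deg e)) (λ n n∈ → ∑-zero (allVecs (range² n) n) (λ b _ →
               ind-no-* (λ t → ℕP.<⇒≢ (∈-upTo⁻ n∈) (sym (ℕP.≡ᵇ⇒≡ (deg e) n t))) (coefficient 0 e b))))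
             (∑-cong (allVecs (range² (deg e)) (deg e)) (λ b → ind-yes-* (ℕP.≡⇒≡ᵇ (deg e) (deg e) refl) (coefficient 0 e b))) ⟩
      0ℚ + ∑ (allVecs (range² (deg e)) (deg e)) (coefficient 0 e)
        ≡⟨ trans (ℚP.+-identityˡ _) (sum-coefficients (deg e) 0 (deg e) e ℕP.≤-refl ℕP.≤-refl) ⟩
      Λ k 0 e ∎
      where
      open ≡-Reasoning
      summand : ∀ n → Vec (ℕ × ℕ) n → ℚ
      summand n b = ind (monoEq (cvec 1 b) e) * (rootsB n k (rep b) ÷ centralizer n (rep b))
      quotient : ∀ n b → b ∈ bipartitions n → rootsB n k (rep b) ÷ centralizer n (rep b) ≡ ratioProduct 0 b
      quotient n b b∈ = trans (cong₂ _÷_ (rootsB-rep b wt k 1≤k) (centralizer-rep b wt)) (ratio≡product 0 b)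
        where
        wt : weight 1 b ≡ n
        wt = ℕP.≡ᵇ⇒≡ (weight 1 b) n (proj₂ (∈-filter⁻ (T? ∘ λ b → weight 1 b ≡ᵇ n) {xs = allVecs (range² n) n} b∈))
      filtered : ∀ n b → (if weight 1 b ≡ᵇ n then coefficient 0 e b else 0ℚ) ≡ ind (deg e ≡ᵇ n) * coefficient 0 e b
      filtered n b = trans (if-ind (weight 1 b ≡ᵇ n) (coefficient 0 e b))
        (trans (*-leftComm (ind (weight 1 b ≡ᵇ n)) (ind (monoEq (cvec 1 b) e)) (ratioProduct 0 b))
        (trans (ind-*-cong (monoEq (cvec 1 b) e) (λ t → cong (λ z → ind (z ≡ᵇ n) * ratioProduct 0 b)
                 (trans (sym (deg-cvec 1 b)) (monoEq-deg (cvec 1 b) e t))))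
        (*-leftComm (ind (monoEq (cvec 1 b) e)) (ind (deg e ≡ᵇ n)) (ratioProduct 0 b))))
        where
        if-ind : ∀ c x → (if c then x else 0ℚ) ≡ ind c * x
        if-ind true  x = sym (ℚP.*-identityˡ x)
        if-ind false x = sym (ℚP.*-zeroˡ x)

open GeneratingFunctions

theorem3p1 : (k : ℕ) → 1 ≤ k → (N : ℕ) → (e : Mono N) →
    LHS k N e ≡ expS (inner k N) e
theorem3p1 k 1≤k N e = trans (LHS≡Λ k 1≤k e) (sym (exp-inner≡Λ k 1≤k e))
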